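{- Let $\Sigma$ be a covariance matrix of full rank $n$. If $\boldsymbol{\nu}$ is an $n$-tuple of umbral monomials such that $f(\boldsymbol{\nu},\boldsymbol{t})=1+\frac12\boldsymbol{t}\Sigma^{ -1}\boldsymbol{t}^T$ and $\boldsymbol{\mu}$ is an $n$-tuple of umbral monomials such that $f(\boldsymbol{\mu},\boldsymbol{t})=1+\frac12\boldsymbol{t}\Sigma\boldsymbol{t}^T$, then for all $\boldsymbol{i}\in\mathbb{N}_0^n$ $$H_{\boldsymbol{i}}(\boldsymbol{x},\Sigma)\simeq(-1\boldsymbol{.}\beta\boldsymbol{.}\boldsymbol{\nu}+\boldsymbol{x}\Sigma^{ -1})^{\boldsymbol{i}},\qquad \tilde H_{\boldsymbol{i}}(\boldsymbol{x},\Sigma)\simeq(-1\boldsymbol{.}\beta\boldsymbol{.}\boldsymbol{\mu}+\boldsymbol{x})^{\boldsymbol{i}},$$ i.e. each polynomial on the left equals the evaluation under $E$ of the right-hand side.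
   Context: Vectors $\boldsymbol{x}=(x_1,\dots,x_n)$ and $\boldsymbol{t}=(t_1,\dots,t_n)$ are row vectors. Multivariate Hermite polynomials: $H_{\boldsymbol{i}}(\boldsymbol{x},\Sigma)=(-1)^{|\boldsymbol{i}|}\,D^{(\boldsymbol{i})}_{\boldsymbol{x}}\phi(\boldsymbol{x};\boldsymbol{0},\Sigma)/\phi(\boldsymbol{x};\boldsymbol{0},\Sigma)$, where $\phi(\boldsymbol{x};\boldsymbol{0},\Sigma)$ is the density of the multivariate Gaussian with mean $\boldsymbol{0}$ and covariance matrix $\Sigma$, $|\boldsymbol{i}|=i_1+\cdots+i_n$ and $D^{(\boldsymbol{i})}_{\boldsymbol{x}}=\partial^{|\boldsymbol{i}|}/\partial x_1^{i_1}\cdots\partial x_n^{i_n}$; and $\tilde H_{\boldsymbol{i}}(\boldsymbol{x},\Sigma)=H_{\boldsymbol{i}}(\boldsymbol{x}\Sigma^{ -1},\Sigma^{ -1})$. Umbral calculus: $R$ is the real or complex field, $A$ a set of symbols (umbrae), $E:R[A]\to R$ a linear functional with $E[1]=1$ and $E[\alpha^i\gamma^j\cdots]=E[\alpha^i]E[\gamma^j]\cdots$ for distinct umbrae; the components of $\boldsymbol{x}$ are treated as constants for $E$. $p\simeq q$ means $E[p]=E[q]$. An $n$-tuple $\boldsymbol{\nu}$ of umbral monomials (monomials in $R[A]$) has moments $g_{\boldsymbol{i}}=E[\boldsymbol{\nu}^{\boldsymbol{i}}]$, $\boldsymbol{\nu}^{\boldsymbol{i}}=\nu_1^{i_1}\cdots\nu_n^{i_n}$,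 and generating function $f(\boldsymbol{\nu},\boldsymbol{t})=1+\sum_{\boldsymbol{i}\ne\boldsymbol{0}}g_{\boldsymbol{i}}\boldsymbol{t}^{\boldsymbol{i}}/\boldsymbol{i}!$, $\boldsymbol{i}!=i_1!\cdots i_n!$. A partition $\boldsymbol{\lambda}\vdash\boldsymbol{i}$ of a multi-index is a matrix of nonnegative integers with $n$ rows, no zero column, columns in lexicographic order, and $r$-th row sum $i_r$; $l(\boldsymbol{\lambda})$ is its number of columns; if its distinct columns $\boldsymbol{\lambda}_1,\boldsymbol{\lambda}_2,\dots$ have multiplicities $r_1,r_2,\dots$, then $\mathfrak{m}(\boldsymbol{\lambda})!=r_1!r_2!\cdots$, $\boldsymbol{\lambda}!=\prod_j(\boldsymbol{\lambda}_j!)^{r_j}$, $g_{\boldsymbol{\lambda}}=\prod_jg_{\boldsymbol{\lambda}_j}^{r_j}$. The auxiliary umbra $-1\boldsymbol{.}\beta\boldsymbol{.}\boldsymbol{\nu}$ ($\beta$ denotes the Bell umbra) is the symbolic $n$-tuple with moments $$E[(-1\boldsymbol{.}\beta\boldsymbol{.}\boldsymbol{\nu})^{\boldsymbol{i}}]=\sum_{\boldsymbol{\lambda}\vdash\boldsymbol{i}}\frac{\boldsymbol{i}!}{\mathfrak{m}(\boldsymbol{\lambda})!\,\boldsymbol{\lambda}!}(-1)^{l(\boldsymbol{\lambda})}g_{\boldsymbol{\lambda}}.$$ For a constant row vector $\boldsymbol{c}$, the power $(-1\boldsymbol{.}\beta\boldsymbol{.}\boldsymbol{\nu}+\boldsymbol{c})^{\boldsymbol{i}}$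 is the $\boldsymbol{i}$-th power of the componentwise sum, expanded by the binomial theorem in each component. -}

module Defs where

open import Algebra.Apartness.Bundles using (HeytingField)
open import Algebra.Bundles using (AbelianGroup; CommutativeMonoid; CommutativeRing; Semiring)
import Algebra.Construct.DirectProduct as DirectProduct
import Algebra.Definitions.RawSemiring as RawSemiringDefinitions
import Algebra.Properties.CommutativeMonoid.Mult as CommutativeMonoidMult
import Algebra.Properties.CommutativeSemigroup as CommutativeSemigroup
open import Data.Bool using (if_then_else_)
open import Data.Fin as Fin using (Fin)
open import Data.List as List using (List; []; _∷_; cartesianProductWith; upTo; concatMap; deduplicate; filter; length)
open import Data.List.Membership.Propositional using (_∈_; lose)
open import Data.List.Membership.Propositional.Properties
  using (∈-filter⁺; ∈-filter⁻; ∈-concatMap⁺; ∈-cartesianProductWith⁺; ∈-cartesianProductWith⁻; ∈-upTo⁺)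
import Data.List.Properties as List
open import Data.List.Relation.Binary.Disjoint.Propositional using (Disjoint)
open import Data.List.Relation.Unary.All as All using (All; []; _∷_; all?)
import Data.List.Relation.Unary.All.Properties as All
open import Data.List.Relation.Unary.AllPairs as AllPairs using ([]; _∷_)
import Data.List.Relation.Unary.AllPairs.Properties as AllPairs
open import Data.List.Relation.Unary.Any using (here)
open import Data.List.Relation.Unary.Linked using (Linked; linked?)
open import Data.List.Relation.Unary.Unique.Propositional using (Unique)
open import Data.List.Relation.Unary.Unique.Propositional.Properties
  using (cartesianProductWith⁺; concat⁺; filter⁺; upTo⁺)
open import Data.Nat as ℕ using (ℕ; zero; suc; NonZero; _!; _∸_)
open import Data.Nat.Combinatorics using (_C_)
import Data.Nat.ListAction as ListAction
open import Data.Nat.ListAction.Properties using (product≢0)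
import Data.Nat.Properties as ℕ
open import Data.Nat.Properties using (_!≢0)
open import Data.Product using (∃; ∃-syntax; _×_; _,_; proj₁; proj₂)
open import Data.Sum using (_⊎_; inj₁; inj₂; [_,_]′)
open import Data.Vec as Vec using (Vec; []; _∷_; lookup)
open import Data.Vec.Functional using (Vector; updateAt)
import Data.Vec.Properties as Vec
import Data.Vec.Relation.Binary.Lex.NonStrict as Lex
open import Function using (_∘_; _⇔_; mk⇔)
open import Level as Level using (Level; _⊔_)
open import Relation.Binary using (Rel; Cotransitive; DecidableEquality; IsStrictPartialOrder)
open import Relation.Binary.Lattice.Definitions using (Supremum)
open import Relation.Binary.PropositionalEquality as ≡ using (_≡_; _≢_)
open import Relation.Nullary using (¬_; Dec; does; ¬?; _×-dec_)

-- The real numbers: a Cauchy complete Archimedean ordered field.  The order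
-- axioms are the constructive ones, so both the classical real line and
-- Cauchy reals without decidable order are instances.
record RealField c ℓ₁ ℓ₂ : Set (Level.suc (c ⊔ ℓ₁ ⊔ ℓ₂)) where
  field
    heytingField : HeytingField c ℓ₁ ℓ₂

  open HeytingField heytingField public

  commutativeRing : CommutativeRing c ℓ₁
  commutativeRing = record { isCommutativeRing = isCommutativeRing }

  open CommutativeRing commutativeRing public using (semiring)
  open Semiring semiring public using (rawSemiring)
  open RawSemiringDefinitions rawSemiring public
    using (sum; product; _^_) renaming (_×_ to _·_)

  infix 4 _<_ _≤_
  infixl 6 _∨_

  field
    _<_                  : Rel Carrier ℓ₂
    isStrictPartialOrder : IsStrictPartialOrder _≈_ _<_
    <-cotrans            : Cotransitive _<_
    <⇒#                  : ∀ {x y} → x < y → x # y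
    #⇒<⊎>                : ∀ {x y} → x # y → x < y ⊎ y < x
    +-monoˡ-<            : ∀ {x y} z → x < y → x + z < y + z
    *-pos                : ∀ {x y} → 0# < x → 0# < y → 0# < x * y

  _≤_ : Rel Carrier ℓ₂
  x ≤ y = ¬ (y < x)

  field
    _∨_         : Carrier → Carrier → Carrier
    ∨-supremum  : Supremum _≤_ _∨_
    archimedean : ∀ x {ε} → 0# < ε → ∃[ n ] x < n · ε

  ∣_∣ : Carrier → Carrier
  ∣ x ∣ = x ∨ (- x)

  Cauchy : (ℕ → Carrier) → Set (c ⊔ ℓ₂)
  Cauchy s = ∀ {ε} → 0# < ε → ∃[ N ] (∀ {m n} → N ℕ.≤ m → N ℕ.≤ n → ∣ s m - s n ∣ < ε)

  _⟶_ : (ℕ → Carrier) → Carrier → Set (c ⊔ ℓ₂)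
  s ⟶ l = ∀ {ε} → 0# < ε → ∃[ N ] (∀ {n} → N ℕ.≤ n → ∣ s n - l ∣ < ε)

  field
    complete : ∀ s → Cauchy s → ∃[ l ] s ⟶ l

module RealAnalysis {c ℓ₁ ℓ₂} (ℝ : RealField c ℓ₁ ℓ₂) where

  open RealField ℝ
  open CommutativeRing commutativeRing using (ring; +-commutativeMonoid)
  open import Algebra.Properties.Ring ring
    using (-‿distribˡ-*; -‿distribʳ-*; -‿involutive; -0#≈0#; -‿+-comm)
  open import Algebra.Apartness.Properties.HeytingCommutativeRing
    (HeytingField.heytingCommutativeRing heytingField) using (1#0; x-0≈x)
  open CommutativeMonoidMult +-commutativeMonoid using (×-distrib-+; ×-homo-+)

  module < = IsStrictPartialOrder isStrictPartialOrder

  private variable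
    u v x y z ε : Carrier

  <⇒≤ : x < y → x ≤ y
  <⇒≤ p q = <.irrefl refl (<.trans p q)

  ≤-refl : x ≤ x
  ≤-refl = <.irrefl refl

  ≤-reflexive : x ≈ y → x ≤ y
  ≤-reflexive p q = <.irrefl (sym p) q

  ≤-trans : x ≤ y → y ≤ z → x ≤ z
  ≤-trans p q z<x = [ q , p ]′ (<-cotrans z<x _)

  <-≤-trans : x < y → y ≤ z → x < z
  <-≤-trans p q with <-cotrans p _
  ... | inj₁ x<z = x<z
  ... | inj₂ z<y with () ← q z<y

  ≤-<-trans : x ≤ y → y < z → x < z
  ≤-<-trans p q with <-cotrans q _
  ... | inj₁ y<x with () ← p y<x
  ... | inj₂ x<z = x<z

  x+z-z≈x : ∀ x z → (x + z) - z ≈ x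
  x+z-z≈x x z = trans (+-assoc x z (- z)) (trans (+-congˡ (-‿inverseʳ z)) (+-identityʳ x))

  +-monoˡ-≤ : ∀ z → x ≤ y → x + z ≤ y + z
  +-monoˡ-≤ z p q = p (<.<-respʳ-≈ (x+z-z≈x _ z) (<.<-respˡ-≈ (x+z-z≈x _ z) (+-monoˡ-< (- z) q)))

  +-monoʳ-≤ : ∀ z → x ≤ y → z + x ≤ z + y
  +-monoʳ-≤ z p = ≤-trans (≤-reflexive (+-comm _ _)) (≤-trans (+-monoˡ-≤ z p) (≤-reflexive (+-comm _ _)))

  +-mono-≤ : x ≤ y → u ≤ v → x + u ≤ y + v
  +-mono-≤ p q = ≤-trans (+-monoˡ-≤ _ p) (+-monoʳ-≤ _ q)

  +-mono-< : x < y → u < v → x + u < y + v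
  +-mono-< {y = y} {u} {v} p q = <.trans (+-monoˡ-< _ p)
    (<.<-respˡ-≈ (+-comm u y) (<.<-respʳ-≈ (+-comm v y) (+-monoˡ-< y q)))

  neg-flip : x < 0# → 0# < - x
  neg-flip {x} p = <.<-respˡ-≈ (-‿inverseʳ x) (<.<-respʳ-≈ (+-identityˡ (- x)) (+-monoˡ-< (- x) p))

  0<1 : 0# < 1#
  0<1 with #⇒<⊎> 1#0
  ... | inj₂ p = p
  ... | inj₁ p = <.<-respʳ-≈ (trans (sym (-‿distribˡ-* 1# (- 1#))) (trans (-‿cong (*-identityˡ _)) (-‿involutive 1#)))
                   (*-pos (neg-flip p) (neg-flip p))

  pos⇒#0 : 0# < x → x # 0#
  pos⇒#0 p = #-sym (<⇒# p)

  inverse : x # 0# → ∃[ y ] y * x ≈ 1#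
  inverse {x} p with #⇒invertible p
  ... | y , yx≈1 , _ = y , trans (*-congˡ (sym (x-0≈x x))) yx≈1

  inverse-#0 : y * x ≈ 1# → y # 0#
  inverse-#0 {y} {x} p = invertible⇒#
    (x , trans (*-comm x _) (trans (*-congʳ (x-0≈x y)) p) , trans (*-congʳ (x-0≈x y)) p)

  pos-inverse : 0# < x → y * x ≈ 1# → 0# < y
  pos-inverse {x} {y} 0<x p with #⇒<⊎> (inverse-#0 p)
  ... | inj₂ 0<y = 0<y
  ... | inj₁ y<0 with () ← <⇒≤ 0<1 (<.<-respʳ-≈ (-‿inverseʳ 1#)
          (<.<-respˡ-≈ (+-identityˡ 1#) (<.<-respʳ-≈ (+-comm _ _) (+-monoˡ-< 1#
            (<.<-respʳ-≈ (trans (sym (-‿distribˡ-* y x)) (-‿cong p)) (*-pos (neg-flip y<0) 0<x))))))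

  product-#0ˡ : x * y # 0# → x # 0#
  product-#0ˡ {x} {y} p with inverse p
  ... | w , w*xy≈1 = inverse-#0 {y = x} {x = y * w} (trans (sym (*-assoc x y w)) (trans (*-comm _ w) w*xy≈1))

  0≤⇒pos : 0# ≤ x → x # 0# → 0# < x
  0≤⇒pos p q with #⇒<⊎> q
  ... | inj₁ x<0 with () ← p x<0
  ... | inj₂ 0<x = 0<x

  *-nonneg : 0# ≤ x → 0# ≤ y → 0# ≤ x * y
  *-nonneg {x} {y} p q xy<0 = <⇒≤ xy<0 (*-pos
    (0≤⇒pos p (product-#0ˡ (<⇒# xy<0)))
    (0≤⇒pos q (product-#0ˡ (<⇒# (<.<-respˡ-≈ (*-comm x y) xy<0)))))

  0≤∣x∣ : 0# ≤ ∣ x ∣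
  x≤∣x∣ : x ≤ ∣ x ∣
  -x≤∣x∣ : - x ≤ ∣ x ∣
  x≤∣x∣ {x} = proj₁ (∨-supremum x (- x))
  -x≤∣x∣ {x} = proj₁ (proj₂ (∨-supremum x (- x)))
  0≤∣x∣ {x} p = ≤-trans (≤-reflexive (sym (-‿inverseʳ x))) (+-mono-≤ x≤∣x∣ -x≤∣x∣)
    (<.<-respʳ-≈ (+-identityˡ 0#) (+-mono-< p p))

  ∣∣-least : x ≤ z → - x ≤ z → ∣ x ∣ ≤ z
  ∣∣-least {x} {z} = proj₂ (proj₂ (∨-supremum x (- x))) z

  ∣∣-resp : x ≈ y → ∣ x ∣ ≤ ∣ y ∣
  ∣∣-resp p = ∣∣-least (≤-trans (≤-reflexive p) x≤∣x∣) (≤-trans (≤-reflexive (-‿cong p)) -x≤∣x∣)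

  triangle : ∣ x + y ∣ ≤ ∣ x ∣ + ∣ y ∣
  triangle {x} {y} = ∣∣-least (+-mono-≤ x≤∣x∣ x≤∣x∣)
    (≤-trans (≤-reflexive (sym (-‿+-comm x y))) (+-mono-≤ -x≤∣x∣ -x≤∣x∣))

  ∣-x∣≤∣x∣ : ∣ - x ∣ ≤ ∣ x ∣
  ∣-x∣≤∣x∣ {x} = ∣∣-least -x≤∣x∣ (≤-trans (≤-reflexive (-‿involutive x)) x≤∣x∣)

  -- x - z = (x - y) - (z - y)
  ∣x-z∣≤ : ∣ x - z ∣ ≤ ∣ x - y ∣ + ∣ z - y ∣
  ∣x-z∣≤ {x} {z} {y} = ≤-trans (∣∣-resp eq) (≤-trans triangle (+-monoʳ-≤ _ ∣-x∣≤∣x∣))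
    where
    eq : x - z ≈ (x - y) + - (z - y)
    eq = sym (trans (+-congˡ (trans (sym (-‿+-comm z (- y))) (trans (+-congˡ (-‿involutive y)) (+-comm _ _))))
      (trans (+-assoc x (- y) (y - z)) (+-congˡ (trans (sym (+-assoc (- y) y (- z)))
        (trans (+-congʳ (-‿inverseˡ y)) (+-identityˡ _))))))

  double-cancel-≤ : x + x ≤ y + y → x ≤ y
  double-cancel-≤ p q = p (+-mono-< q q)

  *-monoʳ-≤ : 0# ≤ z → x ≤ y → x * z ≤ y * z
  *-monoʳ-≤ {z} {x} {y} p q = ≤-trans (≤-reflexive (sym (+-identityˡ _))) (≤-trans (+-monoˡ-≤ (x * z)
      (*-nonneg (≤-trans (≤-reflexive (sym (-‿inverseʳ x))) (+-monoˡ-≤ (- x) q)) p))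
    (≤-reflexive (trans (sym (distribʳ z (y - x) x)) (*-congʳ (trans (+-assoc y (- x) x)
      (trans (+-congˡ (-‿inverseˡ x)) (+-identityʳ y)))))))

  fromℕ : ℕ → Carrier
  fromℕ n = n · 1#

  ·-nonneg : ∀ n → 0# ≤ x → 0# ≤ n · x
  ·-nonneg zero    p = ≤-refl
  ·-nonneg (suc n) p = ≤-trans (≤-reflexive (sym (+-identityˡ 0#))) (+-mono-≤ p (·-nonneg n p))

  ·-monoʳ-≤ : ∀ n → x ≤ y → n · x ≤ n · y
  ·-monoʳ-≤ zero    p = ≤-refl
  ·-monoʳ-≤ (suc n) p = +-mono-≤ p (·-monoʳ-≤ n p)

  fromℕ-pos : ∀ n .{{_ : NonZero n}} → 0# < fromℕ n
  fromℕ-pos (suc n) = <-≤-trans 0<1 (≤-trans (≤-reflexive (sym (+-identityʳ 1#)))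
    (+-monoʳ-≤ 1# (·-nonneg n (<⇒≤ 0<1))))

  infix 8 1/_
  1/_ : (n : ℕ) .{{_ : NonZero n}} → Carrier
  1/ n = proj₁ (inverse (pos⇒#0 (fromℕ-pos n)))

  1/n*n≈1 : ∀ n .{{_ : NonZero n}} → 1/ n * fromℕ n ≈ 1#
  1/n*n≈1 n = proj₂ (inverse (pos⇒#0 (fromℕ-pos n)))

  1/-pos : ∀ n .{{_ : NonZero n}} → 0# < 1/ n
  1/-pos n = pos-inverse (fromℕ-pos n) (1/n*n≈1 n)

  ½ : Carrier
  ½ = 1/ 2

  ½+½ : ½ * x + ½ * x ≈ x
  ½+½ {x} = trans (sym (distribʳ x ½ ½)) (trans (*-congʳ (trans (+-cong (sym (*-identityʳ ½)) (sym (*-identityʳ ½)))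
    (trans (sym (distribˡ ½ 1# 1#)) (trans (*-congˡ (+-congˡ (sym (+-identityʳ 1#)))) (1/n*n≈1 2))))) (*-identityˡ x))

  double-∣∣-least : y + y ≤ x → - y + - y ≤ x → ∣ y ∣ + ∣ y ∣ ≤ x
  double-∣∣-least p q = ≤-trans (+-mono-≤ ∣y∣≤ ∣y∣≤) (≤-reflexive ½+½)
    where
    ∣y∣≤ = ∣∣-least (double-cancel-≤ (≤-trans p (≤-reflexive (sym ½+½))))
                    (double-cancel-≤ (≤-trans q (≤-reflexive (sym ½+½))))

  x*u≤∣x∣ : u ≤ 1# → - u ≤ 1# → x * u ≤ ∣ x ∣
  x*u≤∣x∣ {u} {x} p q = double-cancel-≤ (≤-trans (≤-reflexive (sym lhs))
    (≤-trans (+-mono-≤ (*-monoʳ-≤ 0≤1+u x≤∣x∣) (*-monoʳ-≤ 0≤1-u -x≤∣x∣)) (≤-reflexive rhs)))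
    where
    0≤1-u : 0# ≤ 1# - u
    0≤1-u = ≤-trans (≤-reflexive (sym (-‿inverseʳ u))) (+-monoˡ-≤ (- u) p)
    0≤1+u : 0# ≤ 1# + u
    0≤1+u = ≤-trans (≤-reflexive (sym (-‿inverseˡ u))) (+-monoˡ-≤ u q)
    lhs : x * (1# + u) + - x * (1# - u) ≈ x * u + x * u
    lhs = trans (+-cong (trans (distribˡ x 1# u) (trans (+-congʳ (*-identityʳ x)) (+-comm _ _)))
                        (trans (distribˡ (- x) 1# (- u)) (+-cong (*-identityʳ (- x)) negneg)))
      (trans (+-assoc (x * u) x _) (+-congˡ (trans (sym (+-assoc x (- x) _))
        (trans (+-congʳ (-‿inverseʳ x)) (+-identityˡ _)))))
      where
      negneg : - x * - u ≈ x * u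
      negneg = trans (sym (-‿distribˡ-* x (- u))) (trans (-‿cong (sym (-‿distribʳ-* x u))) (-‿involutive _))
    rhs : ∣ x ∣ * (1# + u) + ∣ x ∣ * (1# - u) ≈ ∣ x ∣ + ∣ x ∣
    rhs = trans (sym (distribˡ _ _ _)) (trans (*-congˡ (trans (+-assoc 1# u _) (trans (+-congˡ
        (trans (+-congˡ (+-comm 1# (- u))) (trans (sym (+-assoc u (- u) 1#))
          (trans (+-congʳ (-‿inverseʳ u)) (+-identityˡ 1#))))) refl)))
      (trans (distribˡ _ 1# 1#) (+-cong (*-identityʳ _) (*-identityʳ _))))

  ∣xy∣-halves : y + y ≤ 1# → - (y + y) ≤ 1# → ∣ x * y ∣ + ∣ x * y ∣ ≤ ∣ x ∣
  ∣xy∣-halves {y} {x} p q = double-∣∣-least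
    (≤-trans (≤-reflexive (sym (distribˡ x y y))) (x*u≤∣x∣ p q))
    (≤-trans (≤-reflexive (trans (-‿+-comm _ _) (trans (-‿cong (sym (distribˡ x y y))) (-‿distribʳ-* x (y + y)))))
      (x*u≤∣x∣ q (≤-trans (≤-reflexive (-‿involutive _)) p)))

  series : (ℕ → Carrier) → ℕ → Carrier
  series t zero    = 0#
  series t (suc n) = series t n + t n

  module RatioTest (t : ℕ → Carrier) (N : ℕ)
    (halves : ∀ {k} → N ℕ.≤ k → ∣ t (suc k) ∣ + ∣ t (suc k) ∣ ≤ ∣ t k ∣) where

    tail-bound : ∀ {k} → N ℕ.≤ k → ∀ m →
      ∣ series t (m ℕ.+ k) - series t k ∣ + (∣ t (m ℕ.+ k) ∣ + ∣ t (m ℕ.+ k) ∣) ≤ ∣ t k ∣ + ∣ t k ∣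
    tail-bound N≤k zero = ≤-trans (+-monoˡ-≤ _ (∣∣-least (≤-reflexive (-‿inverseʳ _))
      (≤-reflexive (trans (-‿cong (-‿inverseʳ _)) -0#≈0#)))) (≤-reflexive (+-identityˡ _))
    tail-bound {k} N≤k (suc m) = ≤-trans
      (+-mono-≤ (≤-trans (∣∣-resp eq) triangle) (halves (ℕ.≤-trans N≤k (ℕ.m≤n+m k m))))
      (≤-trans (≤-reflexive (+-assoc _ _ _)) (tail-bound N≤k m))
      where
      S = series t (m ℕ.+ k)
      eq : (S + t (m ℕ.+ k)) - series t k ≈ (S - series t k) + t (m ℕ.+ k)
      eq = trans (+-assoc _ _ _) (trans (+-congˡ (+-comm _ _)) (sym (+-assoc _ _ _)))

    close : ∀ {k m} → N ℕ.≤ k → k ℕ.≤ m → ∣ series t m - series t k ∣ ≤ ∣ t k ∣ + ∣ t k ∣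
    close {k} {m} N≤k k≤m = ≤-trans (≤-reflexive (sym (+-identityʳ _))) (≤-trans
      (+-monoʳ-≤ _ (≤-trans (≤-reflexive (sym (+-identityʳ 0#))) (+-mono-≤ 0≤∣x∣ 0≤∣x∣)))
      (≡.subst (λ j → ∣ series t j - series t k ∣ + (∣ t j ∣ + ∣ t j ∣) ≤ ∣ t k ∣ + ∣ t k ∣)
        (ℕ.m∸n+n≡m k≤m) (tail-bound N≤k (m ℕ.∸ k))))

    decay : ∀ j → suc j · ∣ t (j ℕ.+ N) ∣ ≤ ∣ t N ∣
    decay zero    = ≤-reflexive (+-identityʳ _)
    decay (suc j) = ≤-trans (+-monoˡ-≤ (suc j · b′) b′≤) (≤-trans (≤-reflexive (sym (×-distrib-+ b′ b′ (suc j))))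
      (≤-trans (·-monoʳ-≤ (suc j) (halves (ℕ.m≤n+m N j))) (decay j)))
      where
      b′ = ∣ t (suc j ℕ.+ N) ∣
      b′≤ : b′ ≤ suc j · b′
      b′≤ = ≤-trans (≤-reflexive (sym (+-identityʳ b′))) (+-monoʳ-≤ b′ (·-nonneg j 0≤∣x∣))

    2×_ 8×_ : Carrier → Carrier
    2× x = x + x
    8× x = 2× (2× (2× x))

    cauchy : Cauchy (series t)
    cauchy {ε} 0<ε with archimedean (8× ∣ t N ∣) 0<ε
    ... | n , 8b<nε = M , λ m≥M n≥M → ≤-<-trans
            (≤-trans ∣x-z∣≤ (+-mono-≤ (close (ℕ.m≤n+m N n) m≥M) (close (ℕ.m≤n+m N n) n≥M))) q<ε
      where
      2×-· : n · (2× x) ≈ 2× (n · x)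
      2×-· {x} = ×-distrib-+ x x n
      2×-≤ : x ≤ y → 2× x ≤ 2× y
      2×-≤ p = +-mono-≤ p p
      2×-cong : x ≈ y → 2× x ≈ 2× y
      2×-cong p = +-cong p p
      M = n ℕ.+ N
      b = ∣ t M ∣
      q = 2× (2× b)
      nb≤ : n · b ≤ ∣ t N ∣
      nb≤ = ≤-trans (≤-trans (≤-reflexive (sym (+-identityˡ _))) (+-monoˡ-≤ _ 0≤∣x∣)) (decay n)
      2q≤ε : 2× q ≤ ε
      2q≤ε ε<2q = ≤-trans (·-monoʳ-≤ n (<⇒≤ ε<2q)) (≤-trans
        (≤-reflexive (trans 2×-· (2×-cong (trans 2×-· (2×-cong 2×-·)))))
        (2×-≤ (2×-≤ (2×-≤ nb≤)))) 8b<nε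
      q<ε : q < ε
      q<ε with <-cotrans 0<ε q
      ... | inj₂ p = p
      ... | inj₁ 0<q = <-≤-trans (<.<-respˡ-≈ (+-identityˡ q) (+-monoˡ-< q 0<q)) 2q≤ε

  fromℕ-mono : ∀ {m n} → m ℕ.≤ n → fromℕ m ≤ fromℕ n
  fromℕ-mono {n = n} ℕ.z≤n = ·-nonneg n (<⇒≤ 0<1)
  fromℕ-mono (ℕ.s≤s m≤n)   = +-monoʳ-≤ 1# (fromℕ-mono m≤n)

  fraction-halves : ∀ n .{{_ : NonZero n}} → y + y ≤ fromℕ n → - y + - y ≤ fromℕ n →
    ∣ x * (y * 1/ n) ∣ + ∣ x * (y * 1/ n) ∣ ≤ ∣ x ∣
  fraction-halves {y} n p q = ∣xy∣-halves
    (≤-trans (≤-reflexive (sym (distribʳ (1/ n) y y))) (scale p))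
    (≤-trans (≤-reflexive (trans (-‿cong (sym (distribʳ (1/ n) y y))) (trans (-‿distribˡ-* (y + y) (1/ n))
      (*-congʳ (sym (-‿+-comm y y)))))) (scale q))
    where
    scale : z ≤ fromℕ n → z * 1/ n ≤ 1#
    scale z≤n = ≤-trans (*-monoʳ-≤ (<⇒≤ (1/-pos n)) z≤n) (≤-reflexive (trans (*-comm _ _) (1/n*n≈1 n)))

  -- expTerm x k = xᵏ / k!
  expTerm : Carrier → ℕ → Carrier
  expTerm x zero    = 1#
  expTerm x (suc k) = expTerm x k * (x * 1/ (suc k))

  opaque
    expSeries-cauchy : ∀ x → Cauchy (series (expTerm x))
    expSeries-cauchy x with archimedean (∣ x ∣ + ∣ x ∣) 0<1
    ... | N , 2∣x∣<N = RatioTest.cauchy (expTerm x) N λ {k} N≤k →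
      fraction-halves {x} (suc k) (bound x≤∣x∣ (ℕ.m≤n⇒m≤1+n N≤k)) (bound -x≤∣x∣ (ℕ.m≤n⇒m≤1+n N≤k))
      where
      bound : ∀ {k} → y ≤ ∣ x ∣ → N ℕ.≤ k → y + y ≤ fromℕ k
      bound p N≤k = ≤-trans (+-mono-≤ p p) (≤-trans (<⇒≤ 2∣x∣<N) (fromℕ-mono N≤k))

  exp : Carrier → Carrier
  exp x = proj₁ (complete (series (expTerm x)) (expSeries-cauchy x))

  -- Euler's series  π/2 = Σₖ k! / (1·3·5⋯(2k+1))
  πTerm : ℕ → Carrier
  πTerm zero    = 1#
  πTerm (suc k) = πTerm k * (fromℕ (suc k) * 1/ (suc (2 ℕ.* suc k)))

  opaque
    πSeries-cauchy : Cauchy (series πTerm)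
    πSeries-cauchy = RatioTest.cauchy πTerm 0 λ {k} _ → fraction-halves {fromℕ (suc k)} (suc (2 ℕ.* suc k))
      (≤-trans (≤-reflexive (sym (×-homo-+ 1# (suc k) (suc k))))
        (fromℕ-mono (ℕ.≤-trans (ℕ.+-monoʳ-≤ (suc k) (ℕ.m≤m+n (suc k) 0)) (ℕ.n≤1+n _))))
      (≤-trans (+-mono-≤ (neg (suc k)) (neg (suc k))) (≤-trans (≤-reflexive (+-identityˡ 0#)) (·-nonneg (suc (2 ℕ.* suc k)) (<⇒≤ 0<1))))
      where
      neg : ∀ k → - fromℕ k ≤ 0#
      neg k = ≤-trans (≤-reflexive (sym (+-identityˡ _))) (≤-trans (+-monoˡ-≤ _ (·-nonneg k (<⇒≤ 0<1))) (≤-reflexive (-‿inverseʳ _)))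

  π : Carrier
  π = fromℕ 2 * proj₁ (complete (series πTerm) πSeries-cauchy)

MultiIndex : ℕ → Set
MultiIndex n = Vec ℕ n

infix 8 _!ₘ
infixl 6 _+ₘ_
infix 4 _≟ₘ_ _≤ₗₑₓ_ _⊢_ _⊢?_

degree : ∀ {n} → MultiIndex n → ℕ
degree i = Vec.sum i

_!ₘ : ∀ {n} → MultiIndex n → ℕ
i !ₘ = ListAction.product (Vec.toList (Vec.map _! i))

0ₘ : ∀ {n} → MultiIndex n
0ₘ = Vec.replicate _ 0

_+ₘ_ : ∀ {n} → MultiIndex n → MultiIndex n → MultiIndex n
_+ₘ_ = Vec.zipWith ℕ._+_

eₘ : ∀ {n} → Fin n → MultiIndex n
eₘ r = 0ₘ Vec.[ r ]≔ 1

_≟ₘ_ : ∀ {n} → DecidableEquality (MultiIndex n)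
_≟ₘ_ = Vec.≡-dec ℕ._≟_

-- all j with j ≤ i componentwise
box : ∀ {n} → MultiIndex n → List (MultiIndex n)
box []      = [] ∷ []
box (k ∷ i) = cartesianProductWith _∷_ (upTo (suc k)) (box i)

-- A matrix with n rows, given by its list of columns.
Columns : ℕ → Set
Columns n = List (MultiIndex n)

_≤ₗₑₓ_ : ∀ {n} → Rel (MultiIndex n) Level.zero
_≤ₗₑₓ_ = Lex.Lex-≤ _≡_ ℕ._≤_

rowSums : ∀ {n} → Columns n → MultiIndex n
rowSums = List.foldr _+ₘ_ 0ₘ

_⊢_ : ∀ {n} → Columns n → MultiIndex n → Set
λs ⊢ i = Linked _≤ₗₑₓ_ λs × All (_≢ 0ₘ) λs × rowSums λs ≡ i

_⊢?_ : ∀ {n} (λs : Columns n) (i : MultiIndex n) → Dec (λs ⊢ i)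
λs ⊢? i = linked? (Lex.≤-dec ℕ._≟_ ℕ._≤?_) λs ×-dec all? (λ v → ¬? (v ≟ₘ 0ₘ)) λs ×-dec (rowSums λs ≟ₘ i)

words : ∀ {a} {A : Set a} → ℕ → List A → List (List A)
words zero    xs = [] ∷ []
words (suc l) xs = cartesianProductWith _∷_ xs (words l xs)

candidates : ∀ {n} → MultiIndex n → List (Columns n)
candidates i = concatMap (λ l → words l (box i)) (upTo (suc (degree i)))

-- The columns of λ ⊢ i are nonzero and bounded by i, and there are at most
-- |i| of them; see ∈-partitions and partitions-unique.
partitions : ∀ {n} → MultiIndex n → List (Columns n)
partitions i = filter (_⊢? i) (candidates i)

distinct : ∀ {n} → Columns n → Columns n
distinct = deduplicate _≟ₘ_

multiplicity : ∀ {n} → MultiIndex n → Columns n → ℕ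
multiplicity v λs = length (filter (v ≟ₘ_) λs)

-- 𝔪(λ)!
𝔪! : ∀ {n} → Columns n → ℕ
𝔪! λs = ListAction.product (List.map (λ v → multiplicity v λs !) (distinct λs))

-- λ!
columns! : ∀ {n} → Columns n → ℕ
columns! λs = ListAction.product (List.map (λ v → (v !ₘ) ℕ.^ multiplicity v λs) (distinct λs))

!ₘ≢0 : ∀ {n} (i : MultiIndex n) → NonZero (i !ₘ)
!ₘ≢0 i = product≢0 (go i)
  where
  go : ∀ {n} (i : MultiIndex n) → All NonZero (Vec.toList (Vec.map _! i))
  go []      = []
  go (k ∷ i) = (k !≢0) ∷ go i

𝔪!*columns!≢0 : ∀ {n} (λs : Columns n) → NonZero (𝔪! λs ℕ.* columns! λs)
𝔪!*columns!≢0 λs = ℕ.m*n≢0 (𝔪! λs) (columns! λs)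
  ⦃ product≢0 (All.map⁺ (All.universal (λ v → multiplicity v λs !≢0) (distinct λs))) ⦄
  ⦃ product≢0 (All.map⁺ (All.universal (λ v → ℕ.m^n≢0 (v !ₘ) (multiplicity v λs) ⦃ !ₘ≢0 v ⦄) (distinct λs))) ⦄

∈-box : ∀ {n} {i : MultiIndex n} (v u : MultiIndex n) → v +ₘ u ≡ i → v ∈ box i
∈-box []      []      ≡.refl = here ≡.refl
∈-box (k ∷ v) (l ∷ u) ≡.refl = ∈-cartesianProductWith⁺ _∷_ (∈-upTo⁺ (ℕ.s≤s (ℕ.m≤m+n k l))) (∈-box v u ≡.refl)

∈-words : ∀ {a} {A : Set a} {xs : List A} (w : List A) → All (_∈ xs) w → w ∈ words (length w) xs
∈-words []      []         = here ≡.refl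
∈-words (x ∷ w) (x∈ ∷ w∈) = ∈-cartesianProductWith⁺ _∷_ x∈ (∈-words w w∈)

degree-+ : ∀ {n} (u v : MultiIndex n) → degree (u +ₘ v) ≡ degree u ℕ.+ degree v
degree-+ []      []      = ≡.refl
degree-+ (k ∷ u) (l ∷ v) = ≡.trans (≡.cong ((k ℕ.+ l) ℕ.+_) (degree-+ u v)) (interchange k l (degree u) (degree v))
  where open CommutativeSemigroup ℕ.+-commutativeSemigroup using (interchange)

∣v∣≡0⇒v≡0 : ∀ {n} (v : MultiIndex n) → degree v ≡ 0 → v ≡ 0ₘ
∣v∣≡0⇒v≡0 []         _ = ≡.refl
∣v∣≡0⇒v≡0 (zero ∷ v) p = ≡.cong (0 ∷_) (∣v∣≡0⇒v≡0 v p)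

length≤∣rowSums∣ : ∀ {n} (λs : Columns n) → All (_≢ 0ₘ) λs → length λs ℕ.≤ degree (rowSums λs)
length≤∣rowSums∣ []       []       = ℕ.z≤n
length≤∣rowSums∣ (v ∷ λs) (p ∷ ps) = ≡.subst (suc (length λs) ℕ.≤_) (≡.sym (degree-+ v (rowSums λs)))
  (ℕ.+-mono-≤ (ℕ.n≢0⇒n>0 (p ∘ ∣v∣≡0⇒v≡0 v)) (length≤∣rowSums∣ λs ps))

columns∈box : ∀ {n} {i : MultiIndex n} (λs : Columns n) (u : MultiIndex n) →
  u +ₘ rowSums λs ≡ i → All (_∈ box i) λs
columns∈box []       u p = []
columns∈box (v ∷ λs) u p =
    ∈-box v (u +ₘ rowSums λs) (≡.trans (x∙yz≈y∙xz v u (rowSums λs)) p)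
  ∷ columns∈box λs (u +ₘ v) (≡.trans (Vec.zipWith-assoc ℕ.+-assoc u v (rowSums λs)) p)
  where
  x∙yz≈y∙xz : ∀ {n} (x y z : MultiIndex n) → x +ₘ (y +ₘ z) ≡ y +ₘ (x +ₘ z)
  x∙yz≈y∙xz x y z = ≡.trans (≡.sym (Vec.zipWith-assoc ℕ.+-assoc x y z))
    (≡.trans (≡.cong (_+ₘ z) (Vec.zipWith-comm ℕ.+-comm x y)) (Vec.zipWith-assoc ℕ.+-assoc y x z))

∈-partitions : ∀ {n} {i : MultiIndex n} {λs} → λs ∈ partitions i ⇔ λs ⊢ i
∈-partitions {n} {i} {λs} = mk⇔ (λ λs∈ → proj₂ (∈-filter⁻ (_⊢? i) {xs = candidates i} λs∈)) complete
  where
  complete : λs ⊢ i → λs ∈ partitions i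
  complete λs⊢i@(_ , nz , ≡.refl) = ∈-filter⁺ (_⊢? i) (∈-concatMap⁺ (λ l → words l (box i))
    (lose (∈-upTo⁺ (ℕ.s≤s (length≤∣rowSums∣ λs nz)))
      (∈-words λs (columns∈box λs 0ₘ (Vec.zipWith-identityˡ ℕ.+-identityˡ (rowSums λs)))))) λs⊢i

box-unique : ∀ {n} (i : MultiIndex n) → Unique (box i)
box-unique []      = [] ∷ []
box-unique (k ∷ i) = cartesianProductWith⁺ _∷_ Vec.∷-injective (upTo⁺ (suc k)) (box-unique i)

words-unique : ∀ {a} {A : Set a} {xs : List A} l → Unique xs → Unique (words l xs)
words-unique zero    u = [] ∷ []
words-unique (suc l) u = cartesianProductWith⁺ _∷_ List.∷-injective u (words-unique l u)

words-length : ∀ {a} {A : Set a} {xs : List A} l {w} → w ∈ words l xs → length w ≡ l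
words-length zero    (here ≡.refl) = ≡.refl
words-length {xs = xs} (suc l) w∈ with ∈-cartesianProductWith⁻ _∷_ xs (words l xs) w∈
... | _ , _ , _ , w′∈ , ≡.refl = ≡.cong suc (words-length l w′∈)

partitions-unique : ∀ {n} (i : MultiIndex n) → Unique (partitions i)
partitions-unique i = filter⁺ (_⊢? i) {xs = candidates i} (concat⁺
  (All.map⁺ (All.universal (λ l → words-unique l (box-unique i)) (upTo (suc (degree i)))))
  (AllPairs.map⁺ (AllPairs.map (λ l≢m {_} → disjoint l≢m) (upTo⁺ (suc (degree i))))))
  where
  disjoint : ∀ {l m} → l ≢ m → Disjoint (words l (box i)) (words m (box i))
  disjoint l≢m (p , q) = l≢m (≡.trans (≡.sym (words-length _ p)) (words-length _ q))

-- The polynomial ring K[A] on a set A of indeterminates, presented as the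
-- free commutative K-algebra on A: expressions modulo the congruence _≋_
-- generated by the commutative ring laws and the arithmetic of K.

module PolynomialRing {k ℓ a} (K : CommutativeRing k ℓ) (A : Set a) where

  private module K = CommutativeRing K

  infixl 7 _⊗_
  infixl 6 _⊕_
  infix  8 ⊝_
  infix  4 _≋_

  data Poly : Set (k ⊔ a) where
    con     : K.Carrier → Poly
    var     : A → Poly
    _⊕_ _⊗_ : Poly → Poly → Poly
    ⊝_      : Poly → Poly

  private variable
    p p′ q q′ r : Poly
    κ κ′        : K.Carrier

  data _≋_ : Rel Poly (k ⊔ ℓ ⊔ a) where
    ≋-refl    : p ≋ p
    ≋-sym     : p ≋ q → q ≋ p
    ≋-trans   : p ≋ q → q ≋ r → p ≋ r
    con-cong  : κ K.≈ κ′ → con κ ≋ con κ′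
    ⊕-cong    : p ≋ p′ → q ≋ q′ → p ⊕ q ≋ p′ ⊕ q′
    ⊗-cong    : p ≋ p′ → q ≋ q′ → p ⊗ q ≋ p′ ⊗ q′
    ⊝-cong    : p ≋ q → ⊝ p ≋ ⊝ q
    con-⊕     : con (κ K.+ κ′) ≋ con κ ⊕ con κ′
    con-⊗     : con (κ K.* κ′) ≋ con κ ⊗ con κ′
    ⊕-assoc   : (p ⊕ q) ⊕ r ≋ p ⊕ (q ⊕ r)
    ⊕-comm    : p ⊕ q ≋ q ⊕ p
    ⊕-zeroˡ   : con K.0# ⊕ p ≋ p
    ⊕-inverse : ⊝ p ⊕ p ≋ con K.0#
    ⊗-assoc   : (p ⊗ q) ⊗ r ≋ p ⊗ (q ⊗ r)
    ⊗-comm    : p ⊗ q ≋ q ⊗ p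
    ⊗-oneˡ    : con K.1# ⊗ p ≋ p
    distribʳ  : (q ⊕ r) ⊗ p ≋ q ⊗ p ⊕ r ⊗ p

  polynomialRing : CommutativeRing (k ⊔ a) (k ⊔ ℓ ⊔ a)
  polynomialRing = record
    { Carrier = Poly ; _≈_ = _≋_ ; _+_ = _⊕_ ; _*_ = _⊗_ ; -_ = ⊝_ ; 0# = con K.0# ; 1# = con K.1#
    ; isCommutativeRing = record
      { isRing = record
        { +-isAbelianGroup = record
          { isGroup = record
            { isMonoid = record
              { isSemigroup = record
                { isMagma = record
                  { isEquivalence = record { refl = ≋-refl ; sym = ≋-sym ; trans = ≋-trans }
                  ; ∙-cong = ⊕-cong }
                ; assoc = λ _ _ _ → ⊕-assoc }
              ; identity = (λ _ → ⊕-zeroˡ) , (λ _ → ≋-trans ⊕-comm ⊕-zeroˡ) }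
            ; inverse = (λ _ → ⊕-inverse) , (λ _ → ≋-trans ⊕-comm ⊕-inverse)
            ; ⁻¹-cong = ⊝-cong }
          ; comm = λ _ _ → ⊕-comm }
        ; *-cong = ⊗-cong
        ; *-assoc = λ _ _ _ → ⊗-assoc
        ; *-identity = (λ _ → ⊗-oneˡ) , (λ _ → ≋-trans ⊗-comm ⊗-oneˡ)
        ; distrib = (λ _ _ _ → ≋-trans ⊗-comm (≋-trans distribʳ (⊕-cong ⊗-comm ⊗-comm)))
                  , (λ _ _ _ → distribʳ) }
      ; *-comm = λ _ _ → ⊗-comm } }

  IsMonomial : Poly → Set (k ⊔ ℓ ⊔ a)
  IsMonomial p = ∃ λ (w : List A) → p ≋ List.foldr (λ α q → var α ⊗ q) (con K.1#) w

module Complex {c ℓ} (R : CommutativeRing c ℓ) where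

  open CommutativeRing R
  open import Algebra.Properties.Ring ring using (-0#≈0#; -‿distribˡ-*; -‿distribʳ-*; -‿+-comm)
  open CommutativeSemigroup (CommutativeMonoid.commutativeSemigroup +-commutativeMonoid) using (interchange)

  private
    ℂ : Set c
    ℂ = Carrier × Carrier

    infix 4 _≈ᶜ_
    _≈ᶜ_ : Rel ℂ ℓ
    (a , b) ≈ᶜ (a′ , b′) = a ≈ a′ × b ≈ b′

    infixl 6 _+ᶜ_
    _+ᶜ_ : ℂ → ℂ → ℂ
    (a , b) +ᶜ (a′ , b′) = a + a′ , b + b′

    infixl 7 _*ᶜ_
    _*ᶜ_ : ℂ → ℂ → ℂ
    (a , b) *ᶜ (a′ , b′) = a * a′ - b * b′ , a * b′ + b * a′

    expandʳ : ∀ x y z → (x - y) * z ≈ x * z - y * z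
    expandʳ x y z = trans (distribʳ z x (- y)) (+-congˡ (sym (-‿distribˡ-* y z)))

    expandˡ : ∀ x y z → x * (y - z) ≈ x * y - x * z
    expandˡ x y z = trans (distribˡ x y (- z)) (+-congˡ (sym (-‿distribʳ-* x z)))

    negʳ : ∀ x y z → - ((x + y) * z) ≈ - (x * z) + - (y * z)
    negʳ x y z = trans (-‿cong (distribʳ z x y)) (sym (-‿+-comm _ _))

    rotate : ∀ {x y u v p q r s} → x ≈ p + q → y ≈ r + s → u ≈ p + r → v ≈ s + q → x + y ≈ u + v
    rotate {p = p} {q} {r} {s} e₁ e₂ e₃ e₄ = trans (+-cong e₁ e₂) (trans (+-assoc p q _) (trans
      (+-congˡ (trans (+-comm q _) (+-assoc r s q))) (trans (sym (+-assoc p r _)) (sym (+-cong e₃ e₄)))))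

    *ᶜ-comm : ∀ z w → z *ᶜ w ≈ᶜ w *ᶜ z
    *ᶜ-comm (a , b) (a′ , b′) =
        +-cong (*-comm a a′) (-‿cong (*-comm b b′))
      , trans (+-comm _ _) (+-cong (*-comm b a′) (*-comm a b′))

    *ᶜ-identityˡ : ∀ z → (1# , 0#) *ᶜ z ≈ᶜ z
    *ᶜ-identityˡ (a , b) =
        trans (+-cong (*-identityˡ a) (trans (-‿cong (zeroˡ b)) -0#≈0#)) (+-identityʳ a)
      , trans (+-cong (*-identityˡ b) (zeroˡ a)) (+-identityʳ b)

    *ᶜ-distribˡ : ∀ z w w′ → z *ᶜ (w +ᶜ w′) ≈ᶜ z *ᶜ w +ᶜ z *ᶜ w′
    *ᶜ-distribˡ (a , b) (a′ , b′) (a″ , b″) =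
        trans (+-cong (distribˡ a a′ a″) (trans (-‿cong (distribˡ b b′ b″)) (sym (-‿+-comm _ _)))) (interchange _ _ _ _)
      , trans (+-cong (distribˡ a b′ b″) (distribˡ b a′ a″)) (interchange _ _ _ _)

  complexNumbers : CommutativeRing c ℓ
  complexNumbers = record
    { Carrier = ℂ
    ; _≈_ = _≈ᶜ_
    ; _+_ = _+ᶜ_
    ; _*_ = _*ᶜ_
    ; -_ = λ (a , b) → - a , - b
    ; 0# = 0# , 0#
    ; 1# = 1# , 0#
    ; isCommutativeRing = record
      { isRing = record
        { +-isAbelianGroup = AbelianGroup.isAbelianGroup (DirectProduct.abelianGroup +-abelianGroup +-abelianGroup)
        ; *-cong = λ (p , q) (p′ , q′) →
            +-cong (*-cong p p′) (-‿cong (*-cong q q′)) , +-cong (*-cong p q′) (*-cong q p′)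
        ; *-assoc = λ (a , b) (a′ , b′) (a″ , b″) →
            rotate (trans (expandʳ (a * a′) (b * b′) a″) (+-cong (*-assoc a a′ a″) (-‿cong (*-assoc b b′ a″))))
              (trans (negʳ (a * b′) (b * a′) b″) (+-cong (-‿cong (*-assoc a b′ b″)) (-‿cong (*-assoc b a′ b″))))
              (expandˡ a (a′ * a″) (b′ * b″))
              (trans (-‿cong (distribˡ b (a′ * b″) (b′ * a″))) (sym (-‿+-comm _ _)))
          , rotate (trans (expandʳ (a * a′) (b * b′) b″) (+-cong (*-assoc a a′ b″) (-‿cong (*-assoc b b′ b″))))
              (trans (distribʳ a″ (a * b′) (b * a′)) (+-cong (*-assoc a b′ a″) (*-assoc b a′ a″)))
              (distribˡ a (a′ * b″) (b′ * a″))
              (expandˡ b (a′ * a″) (b′ * b″))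
        ; *-identity = *ᶜ-identityˡ , λ z →
            trans (proj₁ (*ᶜ-comm z (1# , 0#))) (proj₁ (*ᶜ-identityˡ z))
          , trans (proj₂ (*ᶜ-comm z (1# , 0#))) (proj₂ (*ᶜ-identityˡ z))
        ; distrib = *ᶜ-distribˡ , λ z w w′ →
            trans (proj₁ (*ᶜ-comm (w +ᶜ w′) z)) (trans (proj₁ (*ᶜ-distribˡ z w w′))
              (+-cong (proj₁ (*ᶜ-comm z w)) (proj₁ (*ᶜ-comm z w′))))
          , trans (proj₂ (*ᶜ-comm (w +ᶜ w′) z)) (trans (proj₂ (*ᶜ-distribˡ z w w′))
              (+-cong (proj₂ (*ᶜ-comm z w)) (proj₂ (*ᶜ-comm z w′)))) }
      ; *-comm = *ᶜ-comm } }

module Hermite {c ℓ₁ ℓ₂} (ℝ : RealField c ℓ₁ ℓ₂) where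

  open RealField ℝ
  open RealAnalysis ℝ

  Vecℝ : ℕ → Set c
  Vecℝ n = Vector Carrier n

  ℝFunction : ℕ → Set c
  ℝFunction n = Vecℝ n → Carrier

  Matrix : ℕ → Set c
  Matrix n = Fin n → Fin n → Carrier

  infixl 7 _ᵛ*_ _*ᴹ_

  _ᵛ*_ : ∀ {n} → Vecℝ n → Matrix n → Vecℝ n
  (x ᵛ* M) j = sum λ i → x i * M i j

  _*ᴹ_ : ∀ {n} → Matrix n → Matrix n → Matrix n
  (M *ᴹ P) i = M i ᵛ* P

  Iᴹ : ∀ {n} → Matrix n
  Iᴹ i j = if does (i Fin.≟ j) then 1# else 0#

  -- x M xᵀ
  quadratic : ∀ {n} → Matrix n → Vecℝ n → Carrier
  quadratic M x = sum λ j → (x ᵛ* M) j * x j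

  -- Laplace expansion along the first row
  det : ∀ {n} → Matrix n → Carrier
  det {zero}  M = 1#
  det {suc n} M = sum λ j → (- 1#) ^ Fin.toℕ j * M Fin.zero j * det (λ i k → M (Fin.suc i) (Fin.punchIn j k))

  record IsCovarianceMatrix {n} (S : Matrix n) : Set (c ⊔ ℓ₁ ⊔ ℓ₂) where
    field
      symmetric            : ∀ i j → S i j ≈ S j i
      positiveSemidefinite : ∀ x → 0# ≤ quadratic S x

  -- rank n, i.e. the row space is the whole space
  HasFullRank : ∀ {n} → Matrix n → Set (c ⊔ ℓ₁)
  HasFullRank {n} M = ∀ (y : Vecℝ n) → ∃ λ (x : Vecℝ n) → ∀ j → (x ᵛ* M) j ≈ y j

  IsInverse : ∀ {n} → Matrix n → Matrix n → Set ℓ₁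
  IsInverse M P = (∀ i j → (M *ᴹ P) i j ≈ Iᴹ i j) × (∀ i j → (P *ᴹ M) i j ≈ Iᴹ i j)

  -- q = a / b
  IsQuotient : Carrier → Carrier → Carrier → Set (ℓ₁ ⊔ ℓ₂)
  IsQuotient q a b = b # 0# × q * b ≈ a

  -- φ(x; m, S) = exp(-½ (x - m) S⁻¹ (x - m)ᵀ) / √((2π)ⁿ det S)
  record IsGaussianDensity {n} (m : Vecℝ n) (S : Matrix n) (φ : ℝFunction n) : Set (c ⊔ ℓ₁ ⊔ ℓ₂) where
    field
      S⁻¹       : Matrix n
      isInverse : IsInverse S S⁻¹
      root      : Carrier
      0<root    : 0# < root
      root²     : root * root ≈ (fromℕ 2 * π) ^ n * det S
      density   : ∀ x → IsQuotient (φ x) (exp (- (½ * quadratic S⁻¹ (λ j → x j - m j)))) root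

  HasDerivativeAt : (Carrier → Carrier) → Carrier → Carrier → Set (c ⊔ ℓ₂)
  HasDerivativeAt f x d = ∀ {ε} → 0# < ε → ∃[ δ ] (0# < δ ×
    (∀ h → ∣ h ∣ < δ → ∣ f (x + h) - f x - d * h ∣ ≤ ε * ∣ h ∣))

  -- g = ∂f/∂xᵣ
  IsPartialDerivative : ∀ {n} → Fin n → (f g : ℝFunction n) → Set (c ⊔ ℓ₂)
  IsPartialDerivative r f g = ∀ x → HasDerivativeAt (λ s → f (updateAt x r (λ _ → s))) (x r) (g x)

  -- IsIteratedPartial (r₁ ∷ … ∷ rₖ ∷ []) f g  says  g = ∂/∂x_{r₁} ⋯ ∂/∂x_{rₖ} f
  data IsIteratedPartial {n} : List (Fin n) → (f g : ℝFunction n) → Set (c ⊔ ℓ₁ ⊔ ℓ₂) where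
    []  : ∀ {f g} → (∀ x → f x ≈ g x) → IsIteratedPartial [] f g
    _∷_ : ∀ {r rs f g h} → IsPartialDerivative r g h → IsIteratedPartial rs f g → IsIteratedPartial (r ∷ rs) f h

  -- i₁ copies of the first index, then i₂ copies of the second, …
  word : ∀ {n} → MultiIndex n → List (Fin n)
  word i = List.concat (List.tabulate λ r → List.replicate (lookup i r) r)

  -- g = D⁽ⁱ⁾f
  IsMixedPartial : ∀ {n} → MultiIndex n → (f g : ℝFunction n) → Set (c ⊔ ℓ₁ ⊔ ℓ₂)
  IsMixedPartial i = IsIteratedPartial (word i)

  -- H = Hᵢ(·, S), where φ = φ(·; 0, S):  H(x) = (-1)^|i| D⁽ⁱ⁾φ(x) / φ(x)
  IsHermite : ∀ {n} → (φ : ℝFunction n) → MultiIndex n → (H : ℝFunction n) → Set (c ⊔ ℓ₁ ⊔ ℓ₂)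
  IsHermite {n} φ i H = ∃ λ (Dφ : ℝFunction n) →
    IsMixedPartial i φ Dφ × (∀ x → IsQuotient (H x) ((- 1#) ^ degree i * Dφ x) (φ x))

  -- H̃ = H̃ᵢ(·, S), where S⁻¹ is the inverse of S and φ̃ = φ(·; 0, S⁻¹):
  -- H̃(x) = Hᵢ(xS⁻¹, S⁻¹)
  IsDualHermite : ∀ {n} → (φ̃ : ℝFunction n) (S⁻¹ : Matrix n) → MultiIndex n → (H̃ : ℝFunction n) →
    Set (c ⊔ ℓ₁ ⊔ ℓ₂)
  IsDualHermite {n} φ̃ S⁻¹ i H̃ = ∃ λ (H : ℝFunction n) →
    IsHermite φ̃ i H × (∀ x → H̃ x ≈ H (x ᵛ* S⁻¹))

data ScalarField : Set where
  real complex : ScalarField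

scalars : ∀ {c ℓ₁ ℓ₂} → RealField c ℓ₁ ℓ₂ → ScalarField → CommutativeRing c ℓ₁
scalars ℝ real    = RealField.commutativeRing ℝ
scalars ℝ complex = Complex.complexNumbers (RealField.commutativeRing ℝ)

-- E acts on polynomials in the umbrae A; α^i γ^j ⋯ with α, γ, … distinct is
-- given by the list of pairs (α , i), (γ , j), ….
record UmbralCalculus {k ℓ a} (K : CommutativeRing k ℓ) (A : Set a) : Set (k ⊔ ℓ ⊔ a) where
  private module K = CommutativeRing K
  open PolynomialRing K A
  open RawSemiringDefinitions (Semiring.rawSemiring (CommutativeRing.semiring polynomialRing)) using (_^_)
  field
    E          : Poly → K.Carrier
    E-cong     : ∀ {p q} → p ≋ q → E p K.≈ E q
    E-+        : ∀ p q → E (p ⊕ q) K.≈ E p K.+ E q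
    E-scale    : ∀ κ p → E (con κ ⊗ p) K.≈ κ K.* E p
    E-1        : E (con K.1#) K.≈ K.1#
    E-distinct : ∀ (w : List (A × ℕ)) → Unique (List.map proj₁ w) →
      E (List.foldr (λ (α , i) q → var α ^ i ⊗ q) (con K.1#) w)
        K.≈ List.foldr (λ (α , i) κ → E (var α ^ i) K.* κ) K.1# w

module Umbral {c ℓ₁ ℓ₂ a} (ℝ : RealField c ℓ₁ ℓ₂) (F : ScalarField)
  {A : Set a} (U : UmbralCalculus (scalars ℝ F) A) where

  open RealField ℝ using () renaming (Carrier to R)
  open RealAnalysis ℝ using (1/_; fromℕ; ½)
  open Hermite ℝ using (Matrix)
  open CommutativeRing (scalars ℝ F)
  open RawSemiringDefinitions (Semiring.rawSemiring semiring) using (sum; product; _^_) renaming (_×_ to _·_)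
  open PolynomialRing (scalars ℝ F) A public using (Poly; IsMonomial)
  open UmbralCalculus U public

  ι : R → Carrier
  ι = go F
    where
    go : ∀ F → R → CommutativeRing.Carrier (scalars ℝ F)
    go real    x = x
    go complex x = x , RealField.0# ℝ

  -- gᵢ = E[νⁱ]
  moment : ∀ {n} → Vector Poly n → MultiIndex n → Carrier
  moment ν i = E (P.product λ r → ν r P.^ lookup i r)
    where
    module P = RawSemiringDefinitions
      (Semiring.rawSemiring (CommutativeRing.semiring (PolynomialRing.polynomialRing (scalars ℝ F) A)))

  -- formal power series in t, given by their coefficients
  PowerSeries : ℕ → Set c
  PowerSeries n = MultiIndex n → Carrier

  t^ : ∀ {n} → MultiIndex n → PowerSeries n
  t^ j i = if does (i ≟ₘ j) then 1# else 0#

  -- f(ν, t) = 1 + Σ_{i≠0} gᵢ tⁱ / i!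
  generatingFunction : ∀ {n} → Vector Poly n → PowerSeries n
  generatingFunction ν i = if does (i ≟ₘ 0ₘ) then 1# else moment ν i * ι (1/_ (i !ₘ) ⦃ !ₘ≢0 i ⦄)

  -- 1 + ½ t M tᵀ
  1+½t_tᵀ : ∀ {n} → Matrix n → PowerSeries n
  1+½t M tᵀ i = t^ 0ₘ i + ι ½ * sum λ r → sum λ s → ι (M r s) * t^ (eₘ r +ₘ eₘ s) i

  Σ[_∣_] : ∀ {b} {B : Set b} → List B → (B → Carrier) → Carrier
  Σ[ bs ∣ f ] = List.foldr (λ b κ → f b + κ) 0# bs

  -- g_λ
  gColumns : ∀ {n} → (MultiIndex n → Carrier) → Columns n → Carrier
  gColumns g λs = List.foldr (λ v κ → g v ^ multiplicity v λs * κ) 1# (distinct λs)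

  -- E[(-1.β.ν)ⁱ], in terms of the moments g of ν
  [-1·β·_] : ∀ {n} → (MultiIndex n → Carrier) → MultiIndex n → Carrier
  [-1·β· g ] i = Σ[ partitions i ∣ (λ λs →
    ι (fromℕ (i !ₘ) ℝ.* 1/_ (𝔪! λs ℕ.* columns! λs) ⦃ 𝔪!*columns!≢0 λs ⦄) * (- 1#) ^ length λs * gColumns g λs) ]
    where module ℝ = RealField ℝ

  -- Polynomials in a symbolic n-tuple η, as formal linear combinations of the
  -- powers ηʲ; E is extended to them linearly from the moments of η.
  SymbolicPoly : ℕ → Set c
  SymbolicPoly n = List (Carrier × MultiIndex n)

  E-symbolic : ∀ {n} → (MultiIndex n → Carrier) → SymbolicPoly n → Carrier
  E-symbolic g p = Σ[ p ∣ (λ (κ , j) → κ * g j) ]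

  -- (η + b)ⁱ = Σ_{j≤i} ∏ᵣ (iᵣ choose jᵣ) bᵣ^(iᵣ-jᵣ) ηʲ
  [η+_]^_ : ∀ {n} → Vector Carrier n → MultiIndex n → SymbolicPoly n
  [η+ b ]^ i = List.map (λ j → product (λ r → (lookup i r C lookup j r) · b r ^ (lookup i r ∸ lookup j r)) , j) (box i)

  -- E[(-1.β.ν + b)ⁱ] for a constant real vector b
  E[-1·β·_+_]^_ : ∀ {n} → Vector Poly n → Vector R n → MultiIndex n → Carrier
  E[-1·β· ν + b ]^ i = E-symbolic [-1·β· moment ν ] ([η+ (λ r → ι (b r)) ]^ i)

module Submission where

-- Both sides satisfy the three-term recurrence
--   P_{i+e_r} = b_r P_i - Σ_s i_s M_{rs} P_{i-e_s},   P_0 = 1,   b = x M,   M = S⁻¹,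
-- which determines the family P.
-- On the umbral side, the coefficients of exp(-A), A = Σ_v g_v t^v / v!, are sums over
-- partitions; weighting a partition by its r-th row sum and deleting one column at a time
-- gives D_r exp(-A) = - (D_r A) exp(-A), a two-term recurrence for the moments when A is
-- quadratic.  The binomial shift by b turns it into the three-term one.
-- On the analytic side, the recurrence implies ∂_r P_i = Σ_s i_s M_{rs} P_{i-e_s}, and since
-- ∂_r φ = - b_r φ, the functions (-1)^|i| P_i φ are the successive partial derivatives of φ.
-- Here P_i is real: its real part satisfies the same recurrence, because b and M are real.

-- `IsHermite` is a relation: `H` comes with whatever functions satisfy the ε-δ derivative
-- conditions. Hence derivatives must be shown both to exist, in closed form, and to be unique.
-- Order and equality of the reals are not decidable, so explicit estimates take the place of mean
-- value arguments. The derivative of `exp` and the identity exp y · exp (- y) = 1 both rest on one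
-- bound, ∣exp (y + k) - exp y - k exp y∣ ≤ exp M · k² for ∣y∣, ∣y + k∣ ≤ M, obtained term by term
-- from the series; no addition theorem is involved. The identity makes φ apart from 0, so that the
-- quotient by φ makes sense. Differentiation uses a stronger notion, a remainder at most C h² for
-- ∣h∣ ≤ 1, which is closed under sums, products and `exp` and implies the ε-δ one. Vectors are
-- functions and agree only pointwise; that the polynomials respect this is again read off from the
-- uniqueness of a family with given `b` and `M`.

open import Defs
open import Algebra.Bundles using (CommutativeMonoid; CommutativeRing; Semiring)
import Algebra.Definitions.RawSemiring as RawSemiringDefinitions
import Algebra.Properties.CommutativeSemigroup as CommutativeSemigroup
open import Data.Bool using (if_then_else_)
open import Data.Fin as Fin using (Fin; zero; suc)
open import Data.List as List using (List; []; _∷_; _++_; filter; length; map; upTo; applyUpTo)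
open import Data.List.Membership.Propositional using (_∈_)
open import Data.List.Membership.Propositional.Properties
  using (∈-filter⁺; ∈-filter⁻; ∈-map⁺; ∈-map⁻; ∈-∃++; ∈-cartesianProductWith⁻; ∈-upTo⁻; ∈-deduplicate⁺; ∈-deduplicate⁻)
import Data.List.Properties as List
open import Data.List.Relation.Binary.Permutation.Propositional as ↭ using (_↭_; ↭-sym; ↭-trans; ↭⇒↭ₛ′)
open import Data.List.Relation.Binary.Permutation.Propositional.Properties
  using (shift; ∈-resp-↭; All-resp-↭; ↭-length; filter-↭)
open import Data.List.Relation.Unary.All as All using (All; []; _∷_)
open import Data.List.Relation.Unary.AllPairs using ([]; _∷_)
open import Data.List.Relation.Unary.Any using (here; there)
open import Data.List.Relation.Unary.Unique.Propositional using (Unique)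
open import Data.List.Relation.Unary.Unique.Propositional.Properties using (map⁺; filter⁺)
open import Data.Nat as ℕ using (ℕ; zero; suc; pred; NonZero; s≤s; _!; _∸_)
import Data.Nat.Properties as ℕ
open import Data.Product using (_×_; _,_; proj₁; proj₂; ∃; ∃-syntax)
open import Data.Sum using (_⊎_; inj₁; inj₂; [_,_]′)
open import Data.Vec as Vec using ([]; _∷_; lookup)
open import Data.Vec.Functional using (Vector; updateAt)
import Data.Vec.Properties as Vec
open import Function using (_∘_; mk⇔; Equivalence)
open import Level using (Level; _⊔_)
open import Relation.Binary.PropositionalEquality as ≡ using (_≡_; _≢_)
open import Relation.Nullary using (¬_; yes; no; does; contradiction)

-- Ring solver with integer coefficients

module IntegerRingSolver {c ℓ} (R : CommutativeRing c ℓ) where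

  open import Algebra.Solver.Ring.AlmostCommutativeRing using (fromCommutativeRing; _-Raw-AlmostCommutative⟶_)
  open import Data.Integer as ℤ using (ℤ; +_; -[1+_]; _⊖_; _◃_)
  import Data.Integer.Properties as ℤ
  open import Data.Maybe using (Maybe; just; nothing)
  import Data.Sign as Sign

  open CommutativeRing R hiding (zero)
  open import Algebra.Properties.Ring ring using (-‿distribˡ-*; -‿distribʳ-*; -‿involutive; -0#≈0#; -‿+-comm)
  open import Algebra.Properties.Semiring.Mult.TCOptimised semiring using (×-homo-+; ×1-homo-*; 1+×) renaming (_×_ to _·_)
  open import Relation.Binary.Reasoning.Setoid setoid

  private
    -- Coefficients are integers because normalisation compares them, while equality in `R` need not
    -- be decidable. With the optimised multiples `⟦ + 1 ⟧` unfolds to `1#` itself.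
    ⟦_⟧ : ℤ → Carrier
    ⟦ + n      ⟧ = n · 1#
    ⟦ -[1+ n ] ⟧ = - (suc n · 1#)

    ⟦⊖⟧ : ∀ m n → ⟦ m ⊖ n ⟧ ≈ m · 1# - n · 1#
    ⟦⊖⟧ m       zero    = sym (trans (+-congˡ -0#≈0#) (+-identityʳ _))
    ⟦⊖⟧ zero    (suc n) = sym (+-identityˡ _)
    ⟦⊖⟧ (suc m) (suc n) = begin
      ⟦ suc m ⊖ suc n ⟧                   ≡⟨ ≡.cong ⟦_⟧ (ℤ.[1+m]⊖[1+n]≡m⊖n m n) ⟩
      ⟦ m ⊖ n ⟧                           ≈⟨ ⟦⊖⟧ m n ⟩
      a - b                               ≈⟨ +-congˡ (+-identityˡ (- b)) ⟨
      a + (0# - b)                        ≈⟨ +-congˡ (+-congʳ (-‿inverseʳ 1#)) ⟨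
      a + ((1# - 1#) - b)                 ≈⟨ +-congˡ (+-assoc _ _ _) ⟩
      a + (1# + (- 1# - b))               ≈⟨ +-assoc _ _ _ ⟨
      (a + 1#) + (- 1# - b)               ≈⟨ +-cong (+-comm _ _) (-‿+-comm 1# b) ⟩
      (1# + a) - (1# + b)                 ≈⟨ +-cong (1+× m 1#) (-‿cong (1+× n 1#)) ⟨
      suc m · 1# - suc n · 1#             ∎
      where
      a = m · 1#
      b = n · 1#

    +-homo : ∀ i j → ⟦ i ℤ.+ j ⟧ ≈ ⟦ i ⟧ + ⟦ j ⟧
    +-homo (+ m)    (+ n)    = ×-homo-+ 1# m n
    +-homo (+ m)    -[1+ n ] = ⟦⊖⟧ m (suc n)
    +-homo -[1+ m ] (+ n)    = trans (⟦⊖⟧ n (suc m)) (+-comm _ _)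
    +-homo -[1+ m ] -[1+ n ] = begin
      - (suc (suc (m ℕ.+ n)) · 1#)        ≡⟨ ≡.cong (λ k → - (suc k · 1#)) (≡.sym (ℕ.+-suc m n)) ⟩
      - ((suc m ℕ.+ suc n) · 1#)          ≈⟨ -‿cong (×-homo-+ 1# (suc m) (suc n)) ⟩
      - (suc m · 1# + suc n · 1#)         ≈⟨ -‿+-comm _ _ ⟨
      - (suc m · 1#) - suc n · 1#         ∎

    ⟦-◃⟧ : ∀ n → ⟦ Sign.- ◃ n ⟧ ≈ - (n · 1#)
    ⟦-◃⟧ zero    = sym -0#≈0#
    ⟦-◃⟧ (suc n) = refl

    ⟦+◃⟧ : ∀ n → ⟦ Sign.+ ◃ n ⟧ ≈ n · 1#
    ⟦+◃⟧ zero    = refl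
    ⟦+◃⟧ (suc n) = refl

    *-homo : ∀ i j → ⟦ i ℤ.* j ⟧ ≈ ⟦ i ⟧ * ⟦ j ⟧
    *-homo (+ m)    (+ n)    = trans (⟦+◃⟧ (m ℕ.* n)) (×1-homo-* m n)
    *-homo (+ m)    -[1+ n ] = trans (⟦-◃⟧ (m ℕ.* suc n))
      (trans (-‿cong (×1-homo-* m (suc n))) (-‿distribʳ-* _ _))
    *-homo -[1+ m ] (+ n)    = trans (⟦-◃⟧ (suc m ℕ.* n))
      (trans (-‿cong (×1-homo-* (suc m) n)) (-‿distribˡ-* _ _))
    *-homo -[1+ m ] -[1+ n ] = begin
      ⟦ Sign.+ ◃ suc m ℕ.* suc n ⟧        ≈⟨ ⟦+◃⟧ (suc m ℕ.* suc n) ⟩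
      (suc m ℕ.* suc n) · 1#              ≈⟨ ×1-homo-* (suc m) (suc n) ⟩
      (suc m · 1#) * (suc n · 1#)         ≈⟨ -‿involutive _ ⟨
      - - ((suc m · 1#) * (suc n · 1#))   ≈⟨ -‿cong (-‿distribʳ-* _ _) ⟩
      - ((suc m · 1#) * - (suc n · 1#))   ≈⟨ -‿distribˡ-* _ _ ⟩
      - (suc m · 1#) * - (suc n · 1#)     ∎

    -‿homo : ∀ i → ⟦ ℤ.- i ⟧ ≈ - ⟦ i ⟧
    -‿homo (+ zero)  = sym -0#≈0#
    -‿homo (+ suc n) = refl
    -‿homo -[1+ n ]  = sym (-‿involutive _)

    morphism : ℤ.+-*-rawRing -Raw-AlmostCommutative⟶ fromCommutativeRing R
    morphism = record
      { ⟦_⟧ = ⟦_⟧ ; +-homo = +-homo ; *-homo = *-homo ; -‿homo = -‿homo ; 0-homo = refl ; 1-homo = refl }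

    _coeff≟_ : ∀ i j → Maybe (⟦ i ⟧ ≈ ⟦ j ⟧)
    i coeff≟ j with i ℤ.≟ j
    ... | yes ≡.refl = just refl
    ... | no  _      = nothing

  open import Algebra.Solver.Ring _ _ morphism _coeff≟_ public

  :1 : ∀ {n} → Polynomial n
  :1 = con (+ 1)
  :0 : ∀ {n} → Polynomial n
  :0 = con (+ 0)

-- Finite sums over lists in a commutative monoid

module ListSum {c ℓ} (M : CommutativeMonoid c ℓ) where

  open import Relation.Unary using (Pred; Decidable)

  open CommutativeMonoid M
  open import Algebra.Properties.CommutativeSemigroup commutativeSemigroup using (interchange; x∙yz≈y∙xz)
  open import Relation.Binary.Reasoning.Setoid setoid

  private variable
    a b p : Level
    A : Set a
    B : Set b

  -- A general monoid, since products over columns are treated in the same way as sums of scalars.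
  -- `Σ[_∣_]` and `gColumns` are instances by unfolding.
  Σ : List A → (A → Carrier) → Carrier
  Σ xs f = List.foldr (λ x κ → f x ∙ κ) ε xs

  Σ-cong∈ : ∀ (xs : List A) {f g : A → Carrier} → (∀ {x} → x ∈ xs → f x ≈ g x) → Σ xs f ≈ Σ xs g
  Σ-cong∈ []       f≈g = refl
  Σ-cong∈ (x ∷ xs) f≈g = ∙-cong (f≈g (here ≡.refl)) (Σ-cong∈ xs (λ x∈ → f≈g (there x∈)))

  Σ-cong : ∀ (xs : List A) {f g : A → Carrier} → (∀ x → f x ≈ g x) → Σ xs f ≈ Σ xs g
  Σ-cong xs f≈g = Σ-cong∈ xs (λ {x} _ → f≈g x)

  Σ-∙ : ∀ (xs : List A) {f g : A → Carrier} → Σ xs (λ x → f x ∙ g x) ≈ Σ xs f ∙ Σ xs g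
  Σ-∙ []       = sym (identityˡ ε)
  Σ-∙ (x ∷ xs) = trans (∙-congˡ (Σ-∙ xs)) (interchange _ _ _ _)

  Σ-ε : ∀ (xs : List A) → Σ xs (λ _ → ε) ≈ ε
  Σ-ε []       = refl
  Σ-ε (x ∷ xs) = trans (identityˡ _) (Σ-ε xs)

  Σ-swap : ∀ (xs : List A) (ys : List B) {f : A → B → Carrier} →
    Σ xs (λ x → Σ ys (f x)) ≈ Σ ys (λ y → Σ xs (λ x → f x y))
  Σ-swap []       ys = sym (Σ-ε ys)
  Σ-swap (x ∷ xs) ys = trans (∙-congˡ (Σ-swap xs ys)) (sym (Σ-∙ ys))

  Σ-↭ : ∀ {xs ys : List A} {f : A → Carrier} → xs ↭ ys → Σ xs f ≈ Σ ys f
  Σ-↭ ↭.refl         = refl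
  Σ-↭ (↭.prep x p)   = ∙-congˡ (Σ-↭ p)
  Σ-↭ (↭.swap x y p) = trans (∙-congˡ (∙-congˡ (Σ-↭ p))) (x∙yz≈y∙xz _ _ _)
  Σ-↭ (↭.trans p q)  = trans (Σ-↭ p) (Σ-↭ q)

  Σ-map : ∀ (h : A → B) (xs : List A) {f : B → Carrier} → Σ (List.map h xs) f ≡ Σ xs (λ x → f (h x))
  Σ-map h []       = ≡.refl
  Σ-map h (x ∷ xs) = ≡.cong (_ ∙_) (Σ-map h xs)

  Σ-++ : ∀ (xs ys : List A) {f : A → Carrier} → Σ (xs ++ ys) f ≈ Σ xs f ∙ Σ ys f
  Σ-++ []       ys = sym (identityˡ _)
  Σ-++ (x ∷ xs) ys = trans (∙-congˡ (Σ-++ xs ys)) (sym (assoc _ _ _))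

  Σ-cartesianProductWith : ∀ {c} {C : Set c} (h : A → B → C) (xs : List A) (ys : List B) {f : C → Carrier} →
    Σ (List.cartesianProductWith h xs ys) f ≈ Σ xs (λ x → Σ ys (λ y → f (h x y)))
  Σ-cartesianProductWith h []       ys = refl
  Σ-cartesianProductWith h (x ∷ xs) ys = trans (Σ-++ (List.map (h x) ys) _)
    (∙-cong (reflexive (Σ-map (h x) ys)) (Σ-cartesianProductWith h xs ys))

  Σ-filter : ∀ {P : Pred A p} (P? : Decidable P) (xs : List A) {f : A → Carrier} →
    (∀ {x} → ¬ P x → f x ≈ ε) → Σ xs f ≈ Σ (List.filter P? xs) f
  Σ-filter P? []       f≈ε = refl
  Σ-filter P? (x ∷ xs) f≈ε with P? x
  ... | yes _  = ∙-congˡ (Σ-filter P? xs f≈ε)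
  ... | no ¬Px = trans (∙-congʳ (f≈ε ¬Px)) (trans (identityˡ _) (Σ-filter P? xs f≈ε))

  Σ-single : ∀ {xs : List A} {x} {f : A → Carrier} → Unique xs → x ∈ xs →
    (∀ {y} → y ≢ x → f y ≈ ε) → Σ xs f ≈ f x
  Σ-single {xs = _ ∷ xs} (x∉ ∷ _) (here ≡.refl) f≈ε =
    trans (∙-congˡ (trans (Σ-cong∈ _ (λ y∈ → f≈ε (λ y≡x → All.lookup x∉ y∈ (≡.sym y≡x)))) (Σ-ε xs))) (identityʳ _)
  Σ-single (x∉ ∷ u) (there x∈) f≈ε =
    trans (∙-congʳ (f≈ε (All.lookup x∉ x∈))) (trans (identityˡ _) (Σ-single u x∈ f≈ε))

-- Partitions that contain a given column

module PartitionInsertion where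

  open ≡ using (refl; sym; trans; cong)

  open import Data.List.Membership.Propositional.Properties.WithK using (unique∧set⇒bag)
  open import Data.List.Relation.Binary.BagAndSetEquality using (∼bag⇒↭)
  import Data.List.Relation.Binary.Pointwise as ListPointwise
  open import Data.List.Relation.Unary.Sorted.TotalOrder.Properties using (↗↭↗⇒≋)
  open import Data.List.Sort.InsertionSort using (insert; sort)
  import Data.List.Sort.InsertionSort.Properties as InsertionSort
  import Data.Vec.Relation.Binary.Lex.NonStrict as Lex
  import Data.Vec.Relation.Binary.Pointwise.Inductive as Pointwise
  open import Relation.Binary using (DecTotalOrder)
  import Data.List.Membership.DecPropositional as DecMembership

  -- Without repetitions membership fixes all multiplicities, so reindexing a sum takes only two
  -- inclusions.
  unique∧set⇒↭ : ∀ {a} {A : Set a} {xs ys : List A} → Unique xs → Unique ys →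
    (∀ {x} → x ∈ xs → x ∈ ys) → (∀ {x} → x ∈ ys → x ∈ xs) → xs ↭ ys
  unique∧set⇒↭ u u′ f g = ∼bag⇒↭ (unique∧set⇒bag u u′ (mk⇔ f g))

  +ₘ-comm : ∀ {n} (u v : MultiIndex n) → u +ₘ v ≡ v +ₘ u
  +ₘ-comm = Vec.zipWith-comm ℕ.+-comm

  +ₘ-assoc : ∀ {n} (u v w : MultiIndex n) → (u +ₘ v) +ₘ w ≡ u +ₘ (v +ₘ w)
  +ₘ-assoc = Vec.zipWith-assoc ℕ.+-assoc

  +ₘ-identityˡ : ∀ {n} (v : MultiIndex n) → 0ₘ +ₘ v ≡ v
  +ₘ-identityˡ = Vec.zipWith-identityˡ ℕ.+-identityˡ

  +ₘ-cancelˡ : ∀ {n} (u : MultiIndex n) {v w} → u +ₘ v ≡ u +ₘ w → v ≡ w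
  +ₘ-cancelˡ []      {[]}    {[]}    _ = refl
  +ₘ-cancelˡ (k ∷ u) {l ∷ v} {m ∷ w} p with Vec.∷-injective p
  ... | q , r = ≡.cong₂ _∷_ (ℕ.+-cancelˡ-≡ k l m q) (+ₘ-cancelˡ u r)

  ∈-box⁻ : ∀ {n} {i : MultiIndex n} {v} → v ∈ box i → ∃ λ u → v +ₘ u ≡ i
  ∈-box⁻ {i = []}    (here refl) = [] , refl
  ∈-box⁻ {i = k ∷ i} v∈ with ∈-cartesianProductWith⁻ _∷_ (List.upTo (suc k)) (box i) v∈
  ... | l , w , l∈ , w∈ , refl with ∈-upTo⁻ l∈ | ∈-box⁻ w∈
  ... | s≤s l≤k | u , w+u≡i = (k ℕ.∸ l) ∷ u , ≡.cong₂ _∷_ (ℕ.m+[n∸m]≡n l≤k) w+u≡i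

  rowSums-↭ : ∀ {n} {λs λs′ : Columns n} → λs ↭ λs′ → rowSums λs ≡ rowSums λs′
  rowSums-↭ ↭.refl         = refl
  rowSums-↭ (↭.prep v p)   = cong (v +ₘ_) (rowSums-↭ p)
  rowSums-↭ {λs = _ ∷ _ ∷ λs} (↭.swap v w p) = trans (sym (+ₘ-assoc v w (rowSums λs)))
    (trans (≡.cong₂ _+ₘ_ (+ₘ-comm v w) (rowSums-↭ p)) (+ₘ-assoc w v _))
  rowSums-↭ (↭.trans p q)  = trans (rowSums-↭ p) (rowSums-↭ q)

  module _ {n : ℕ} where

    private
      lexOrder : DecTotalOrder _ _ _
      lexOrder = Lex.≤-decTotalOrder ℕ.≤-decTotalOrder n

      module lex = DecTotalOrder lexOrder
      module Sort = InsertionSort lexOrder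

    open DecMembership (_≟ₘ_ {n}) public using (_∈?_)

    insertColumn : MultiIndex n → Columns n → Columns n
    insertColumn = insert lexOrder

    insertColumn-↭ : ∀ v λs → insertColumn v λs ↭ v ∷ λs
    insertColumn-↭ = Sort.insert-↭

    private
      -- A left inverse of `insertColumn v`, there to make the latter injective.
      remove : MultiIndex n → Columns n → Columns n
      remove v []       = []
      remove v (w ∷ λs) with v ≟ₘ w
      ... | yes _ = λs
      ... | no  _ = w ∷ remove v λs

      -- Insertion passes only columns `w` with `v ≰ w`. These differ from `v` by reflexivity, so
      -- the first `v` met is the inserted one.
      remove-insertColumn : ∀ v λs → remove v (insertColumn v λs) ≡ λs
      remove-insertColumn v [] with v ≟ₘ v
      ... | yes _  = refl
      ... | no v≢v = contradiction refl v≢v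
      remove-insertColumn v (w ∷ λs) with v lex.≤? w
      ... | yes _ with v ≟ₘ v
      ...   | yes _  = refl
      ...   | no v≢v = contradiction refl v≢v
      remove-insertColumn v (w ∷ λs) | no v≰w with v ≟ₘ w
      ...   | yes refl = contradiction lex.refl v≰w
      ...   | no  _    = cong (w ∷_) (remove-insertColumn v λs)

      insertColumn-injective : ∀ v {λs λs′} → insertColumn v λs ≡ insertColumn v λs′ → λs ≡ λs′
      insertColumn-injective v {λs} {λs′} p =
        trans (sym (remove-insertColumn v λs)) (trans (cong (remove v) p) (remove-insertColumn v λs′))

      -- The lexicographic order is antisymmetric, so a partition is determined by the multiset of
      -- its columns.
      sorted-↭⇒≡ : ∀ {λs λs′ : Columns n} {i i′} → λs ⊢ i → λs′ ⊢ i′ → λs ↭ λs′ → λs ≡ λs′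
      sorted-↭⇒≡ (λs↗ , _) (λs′↗ , _) p = ListPointwise.Pointwise-≡⇒≡ (ListPointwise.map Pointwise.Pointwise-≡⇒≡
        (↗↭↗⇒≋ lex.totalOrder λs↗ λs′↗ (↭⇒↭ₛ′ lex.Eq.isEquivalence p)))

      insert-⊢ : ∀ {v u : MultiIndex n} {λs} → v ≢ 0ₘ → λs ⊢ u → insertColumn v λs ⊢ v +ₘ u
      insert-⊢ {v} {λs = λs} v≢0 (λs↗ , nz , refl) =
          Sort.insert-↗ v λs↗
        , All-resp-↭ (↭-sym (insertColumn-↭ v λs)) (v≢0 ∷ nz)
        , rowSums-↭ (insertColumn-↭ v λs)

      ∈⇒insert : ∀ {v u : MultiIndex n} {λs} → λs ⊢ v +ₘ u → v ∈ λs → ∃ λ λs′ → λs′ ⊢ u × λs ≡ insertColumn v λs′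
      ∈⇒insert {v} {u} {λs} λs⊢ v∈ with ∈-∃++ v∈
      ... | xs , ys , refl = λs′ , λs′⊢ , sorted-↭⇒≡ λs⊢ (insert-⊢ v≢0 λs′⊢) (↭-trans p (↭-sym (insertColumn-↭ v λs′)))
        where
        -- Sorting what is left spares the proof that deletion keeps the order; `sorted-↭⇒≡` absorbs
        -- the difference.
        λs′ = sort lexOrder (xs List.++ ys)
        p : λs ↭ v ∷ λs′
        p = ↭-trans (shift v xs ys) (↭.prep v (↭-sym (Sort.sort-↭ (xs List.++ ys))))
        nz : All (_≢ 0ₘ) (v ∷ λs′)
        nz = All-resp-↭ p (proj₁ (proj₂ λs⊢))
        v≢0 : v ≢ 0ₘ
        v≢0 with nz
        ... | v≢0 ∷ _ = v≢0
        λs′⊢ : λs′ ⊢ u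
        λs′⊢ with nz
        ... | _ ∷ nz′ = Sort.sort-↗ (xs List.++ ys) , nz′
          , +ₘ-cancelˡ v (trans (sym (rowSums-↭ p)) (proj₂ (proj₂ λs⊢)))

    -- Equal columns are indistinguishable, so deleting one copy of `v` is a bijection however often
    -- `v` occurs. The multiplicities reappear in `weight-∷`.
    partitions-containing : ∀ {v : MultiIndex n} (u : MultiIndex n) → v ≢ 0ₘ →
      filter (v ∈?_) (partitions (v +ₘ u)) ↭ map (insertColumn v) (partitions u)
    partitions-containing {v} u v≢0 = unique∧set⇒↭
      (filter⁺ (v ∈?_) {xs = partitions (v +ₘ u)} (partitions-unique (v +ₘ u)))
      (map⁺ (insertColumn-injective v) (partitions-unique u)) to from
      where
      to : ∀ {λs} → λs ∈ filter (v ∈?_) (partitions (v +ₘ u)) → λs ∈ map (insertColumn v) (partitions u)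
      to λs∈ with ∈-filter⁻ (v ∈?_) {xs = partitions (v +ₘ u)} λs∈
      ... | λs∈P , v∈ with ∈⇒insert (Equivalence.to ∈-partitions λs∈P) v∈
      ...   | λs′ , λs′⊢ , refl = ∈-map⁺ _ (Equivalence.from ∈-partitions λs′⊢)
      from : ∀ {λs} → λs ∈ map (insertColumn v) (partitions u) → λs ∈ filter (v ∈?_) (partitions (v +ₘ u))
      from λs∈ with ∈-map⁻ (insertColumn v) λs∈
      ... | λs′ , λs′∈ , refl = ∈-filter⁺ (v ∈?_)
        (Equivalence.from ∈-partitions (insert-⊢ v≢0 (Equivalence.to ∈-partitions λs′∈)))
        (∈-resp-↭ (↭-sym (insertColumn-↭ v λs′)) (here refl))

    partitions-0ₘ : partitions (0ₘ {n}) ↭ [] ∷ []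
    partitions-0ₘ = unique∧set⇒↭ (partitions-unique 0ₘ) ([] ∷ []) to from
      where
      open import Data.List.Relation.Unary.Linked using ([])
      to : ∀ {λs} → λs ∈ partitions 0ₘ → λs ∈ [] ∷ []
      to {[]}     _   = here refl
      to {v ∷ λs} λs∈ with Equivalence.to ∈-partitions λs∈
      ... | _ , v≢0 ∷ _ , v+λs≡0 = contradiction (+ₘ-zeroˡ v v+λs≡0) v≢0
        where
        +ₘ-zeroˡ : ∀ {n} (v : MultiIndex n) {w} → v +ₘ w ≡ 0ₘ → v ≡ 0ₘ
        +ₘ-zeroˡ []      _ = refl
        +ₘ-zeroˡ (k ∷ v) {_ ∷ w} p with Vec.∷-injective p
        ... | q , r = ≡.cong₂ _∷_ (ℕ.m+n≡0⇒m≡0 k q) (+ₘ-zeroˡ v r)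
      from : ∀ {λs : Columns n} → λs ∈ [] ∷ [] → λs ∈ partitions 0ₘ
      from (here refl) = Equivalence.from ∈-partitions ([] , [] , refl)

-- Products over the distinct columns of a matrix

module DistinctColumns {c ℓ} (M : CommutativeMonoid c ℓ) {n : ℕ} where

  open import Data.List.Membership.DecPropositional (_≟ₘ_ {n}) using (_∈?_)
  open import Data.List.Relation.Unary.Unique.DecPropositional.Properties (_≟ₘ_ {n}) using (deduplicate-!)
  open PartitionInsertion using (unique∧set⇒↭)

  open CommutativeMonoid M
  open ListSum M

  multiplicity-↭ : ∀ w {λs λs′ : Columns n} → λs ↭ λs′ → multiplicity w λs ≡ multiplicity w λs′
  multiplicity-↭ w p = ↭-length (filter-↭ (w ≟ₘ_) p)

  -- `0 ≡ 1` plays the role of the empty type.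
  multiplicity-∉ : ∀ w (λs : Columns n) → (w ∈ λs → _≡_ {A = ℕ} 0 1) → multiplicity w λs ≡ 0
  multiplicity-∉ w []       _  = ≡.refl
  multiplicity-∉ w (v ∷ λs) w∉ with w ≟ₘ v
  ... | yes w≡v with () ← w∉ (here w≡v)
  ... | no  _   = multiplicity-∉ w λs (w∉ ∘ there)

  module _ (h : MultiIndex n → ℕ → Carrier) (s : MultiIndex n → ℕ → Carrier)
    (h-zero : ∀ v → h v 0 ≈ ε) (h-suc : ∀ v k → h v (suc k) ≈ s v k ∙ h v k) where

    private
      product : Columns n → Carrier
      product λs = Σ (distinct λs) (λ v → h v (multiplicity v λs))

      -- A column absent from `λs` has multiplicity 0 and contributes `ε`; two matrices can thus be
      -- compared over one index list.
      product-superset : ∀ {λs D} → Unique D → (∀ {v} → v ∈ λs → v ∈ D) →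
        Σ D (λ v → h v (multiplicity v λs)) ≈ product λs
      product-superset {λs} {D} u λs⊆D = trans
        (Σ-filter (_∈? λs) D λ {v} v∉ →
          trans (reflexive (≡.cong (h v) (multiplicity-∉ v λs (λ v∈ → contradiction v∈ v∉)))) (h-zero v))
        (Σ-↭ (unique∧set⇒↭ (filter⁺ (_∈? λs) {xs = D} u) (deduplicate-! λs)
          (λ v∈ → ∈-deduplicate⁺ _≟ₘ_ (proj₂ (∈-filter⁻ (_∈? λs) {xs = D} v∈)))
          (λ v∈ → let v∈λs = ∈-deduplicate⁻ _≟ₘ_ λs v∈ in ∈-filter⁺ (_∈? λs) (λs⊆D v∈λs) v∈λs)))

    -- Only the factor at `v` changes, by `s v k` as its multiplicity passes from `k` to `k + 1`.
    -- This serves for the powers g_v^k, the factorials k! and the powers (v!)^k.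
    product-∷ : ∀ {v λs λs⁺} → λs⁺ ↭ v ∷ λs → product λs⁺ ≈ s v (multiplicity v λs) ∙ product λs
    product-∷ {v} {λs} {λs⁺} p = trans (Σ-cong D step) (trans (Σ-∙ D) (∙-cong
      (trans (Σ-single {f = factor} (deduplicate-! λs⁺) (∈-deduplicate⁺ _≟ₘ_ (∈-resp-↭ (↭-sym p) (here ≡.refl))) factor-≢) factor-≡)
      (product-superset (deduplicate-! λs⁺) (λ w∈ → ∈-deduplicate⁺ _≟ₘ_ (∈-resp-↭ (↭-sym p) (there w∈))))))
      where
      D = distinct λs⁺
      factor : MultiIndex n → Carrier
      factor w = if does (w ≟ₘ v) then s v (multiplicity v λs) else ε
      factor-≢ : ∀ {w} → w ≢ v → factor w ≈ ε
      factor-≢ {w} w≢v with w ≟ₘ v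
      ... | yes w≡v = contradiction w≡v w≢v
      ... | no  _   = refl
      factor-≡ : factor v ≈ s v (multiplicity v λs)
      factor-≡ with v ≟ₘ v
      ... | yes _  = refl
      ... | no v≢v = contradiction ≡.refl v≢v
      step : ∀ w → h w (multiplicity w λs⁺) ≈ factor w ∙ h w (multiplicity w λs)
      step w rewrite multiplicity-↭ w p with w ≟ₘ v
      ... | yes ≡.refl = h-suc v (multiplicity v λs)
      ... | no  _      = sym (identityˡ _)

-- Arithmetic of multi-indices

module MultiIndexProperties where

  open ≡ using (refl; sym; trans; cong; cong₂)

  open PartitionInsertion using (+ₘ-identityˡ)

  private variable
    n : ℕ

  _∸ₘ_ : MultiIndex n → MultiIndex n → MultiIndex n
  _∸ₘ_ = Vec.zipWith ℕ._∸_

  -- Stands for i - e_s. If i_s = 0 it returns `i`, but the recurrences multiply such terms by i_s.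
  decrement : Fin n → MultiIndex n → MultiIndex n
  decrement s i = Vec.updateAt i s pred

  v+u∸v≡u : ∀ (v u : MultiIndex n) → (v +ₘ u) ∸ₘ v ≡ u
  v+u∸v≡u []      []      = refl
  v+u∸v≡u (k ∷ v) (l ∷ u) = cong₂ _∷_ (ℕ.m+n∸m≡n k l) (v+u∸v≡u v u)

  lookup-0ₘ : ∀ (r : Fin n) → lookup 0ₘ r ≡ 0
  lookup-0ₘ r = Vec.lookup-replicate r 0

  lookup-+ₘ : ∀ (r : Fin n) u v → lookup (u +ₘ v) r ≡ lookup u r ℕ.+ lookup v r
  lookup-+ₘ r u v = Vec.lookup-zipWith ℕ._+_ r u v

  lookup-eₘ : ∀ (s : Fin n) → lookup (eₘ s) s ≡ 1
  lookup-eₘ s = Vec.lookup∘updateAt s 0ₘ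

  lookup-eₘ+ : ∀ (s : Fin n) u → lookup (eₘ s +ₘ u) s ≡ suc (lookup u s)
  lookup-eₘ+ s u = trans (lookup-+ₘ s (eₘ s) u) (cong (ℕ._+ lookup u s) (lookup-eₘ s))

  decrement-eₘ+ : ∀ (s : Fin n) u → decrement s (eₘ s +ₘ u) ≡ u
  decrement-eₘ+ zero    (k ∷ u) = cong (k ∷_) (+ₘ-identityˡ u)
  decrement-eₘ+ (suc s) (k ∷ u) = cong (k ∷_) (decrement-eₘ+ s u)

  degree-eₘ+ : ∀ (s : Fin n) u → degree (eₘ s +ₘ u) ≡ suc (degree u)
  degree-eₘ+ zero    (k ∷ u) = cong (λ v → suc (k ℕ.+ degree v)) (+ₘ-identityˡ u)
  degree-eₘ+ (suc s) (k ∷ u) = trans (cong (k ℕ.+_) (degree-eₘ+ s u)) (ℕ.+-suc k _)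

  eₘ+-! : ∀ (s : Fin n) u → (eₘ s +ₘ u) !ₘ ≡ suc (lookup u s) ℕ.* u !ₘ
  eₘ+-! zero    (k ∷ u) = trans (cong (λ v → (suc k !) ℕ.* v !ₘ) (+ₘ-identityˡ u)) (ℕ.*-assoc (suc k) (k !) _)
  eₘ+-! (suc s) (k ∷ u) = trans (cong ((k !) ℕ.*_) (eₘ+-! s u)) (x∙yz≈y∙xz (k !) (suc (lookup u s)) _)
    where open CommutativeSemigroup ℕ.*-commutativeSemigroup using (x∙yz≈y∙xz)

  0ₘ! : ∀ n → 0ₘ {n} !ₘ ≡ 1
  0ₘ! zero    = refl
  0ₘ! (suc n) = trans (ℕ.+-identityʳ _) (0ₘ! n)

  -- Replaces subtraction by a case split: either a factor i_s kills the term, or `i` is literally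
  -- e_s + u.
  zero⊎eₘ+ : ∀ (s : Fin n) i → lookup i s ≡ 0 ⊎ ∃ λ u → i ≡ eₘ s +ₘ u
  zero⊎eₘ+ zero    (zero ∷ i)  = inj₁ refl
  zero⊎eₘ+ zero    (suc k ∷ i) = inj₂ (k ∷ i , cong (suc k ∷_) (sym (+ₘ-identityˡ i)))
  zero⊎eₘ+ (suc s) (k ∷ i) with zero⊎eₘ+ s i
  ... | inj₁ p          = inj₁ p
  ... | inj₂ (u , refl) = inj₂ (k ∷ u , refl)

-- Sums in a commutative ring

module RingSum {k ℓ} (K : CommutativeRing k ℓ) where

  open CommutativeRing K hiding (zero)
  open RawSemiringDefinitions (Semiring.rawSemiring semiring) public using (_^_) renaming (_×_ to _·_)
  open import Algebra.Properties.Semiring.Sum semiring public using (sum)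
  open import Algebra.Properties.Semiring.Mult semiring public using (×-homo-+; ×1-homo-*; ×-comm-*; ×-congʳ)
  open ListSum +-commutativeMonoid public
  open MultiIndexProperties

  -- sum is stuck on a neutral length, so the length is an explicit argument.
  module _ (n : ℕ) where

    open import Algebra.Properties.Semiring.Sum semiring as Sum using ()

    sum-cong : ∀ {f g : Fin n → Carrier} → (∀ r → f r ≈ g r) → sum f ≈ sum g
    sum-cong = Sum.sum-cong-≋ {n}

    sum-distribˡ : ∀ x {f : Fin n → Carrier} → x * sum f ≈ sum (λ r → x * f r)
    sum-distribˡ x {f} = Sum.*-distribˡ-sum {n} x f

    sum-+ : ∀ {f g : Fin n → Carrier} → sum (λ r → f r + g r) ≈ sum f + sum g
    sum-+ {f} {g} = Sum.∑-distrib-+ {n} f g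

    sum-0 : ∀ {f : Fin n → Carrier} → (∀ r → f r ≈ 0#) → sum f ≈ 0#
    sum-0 f≈0 = trans (sum-cong f≈0) (Sum.sum-replicate-zero n)

  *-distribˡ-Σ : ∀ {a} {A : Set a} x (xs : List A) {f : A → Carrier} → x * Σ xs f ≈ Σ xs (λ y → x * f y)
  *-distribˡ-Σ x []       = zeroʳ x
  *-distribˡ-Σ x (y ∷ xs) = trans (distribˡ x _ _) (+-congˡ (*-distribˡ-Σ x xs))

  Σ-sum : ∀ {a} {A : Set a} n (xs : List A) {f : A → Fin n → Carrier} →
    Σ xs (λ x → sum (f x)) ≈ sum (λ r → Σ xs (λ x → f x r))
  Σ-sum zero    xs = Σ-ε xs
  Σ-sum (suc n) xs {f} = trans (Σ-∙ xs {f = λ x → f x zero} {g = λ x → sum (λ r → f x (suc r))})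
    (+-congˡ (Σ-sum n xs {f = λ x r → f x (suc r)}))

  -- lookup (eₘ p) r is the Kronecker delta.
  sum-δ : ∀ {n} (r : Fin n) (f : Fin n → Carrier) → sum (λ p → (lookup (eₘ p) r · 1#) * f p) ≈ f r
  sum-δ {suc n} zero f = trans
    (+-cong (trans (*-congʳ (+-identityʳ 1#)) (*-identityˡ _)) (sum-0 n (λ p → zeroˡ _))) (+-identityʳ _)
  sum-δ {suc n} (suc r) f = trans
    (+-cong (trans (*-congʳ (reflexive (≡.cong (_· 1#) (lookup-0ₘ r)))) (zeroˡ _)) (sum-δ r (λ p → f (suc p))))
    (+-identityˡ _)

-- Division by positive integers is all that the partition sums ask of the scalars. `ratio m d` is
-- one symbol so that it can match the coefficient i! / (𝔪(λ)! λ!) as a whole.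
record Ratios {k ℓ} (K : CommutativeRing k ℓ) : Set (k ⊔ ℓ) where
  open CommutativeRing K hiding (zero)
  open RingSum K using (_·_)
  field
    ratio   : ℕ → (d : ℕ) .⦃ _ : NonZero d ⦄ → Carrier
    ratio-* : ∀ m d .⦃ _ : NonZero d ⦄ → ratio m d * (d · 1#) ≈ m · 1#

-- Partition sums and the recurrence of the moments

module Moments {k ℓ} (K : CommutativeRing k ℓ) (Q : Ratios K) where

  import Data.Nat.ListAction as ListAction

  open CommutativeRing K hiding (zero)
  open import Algebra.Properties.Ring ring using (-‿distribʳ-*)
  open import Relation.Binary.Reasoning.Setoid setoid
  open RingSum K
  open IntegerRingSolver K using (solve; _:=_; _:*_; _:+_; :-_; :1)
  open Ratios Q
  open PartitionInsertion
  open MultiIndexProperties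

  cancel : ∀ d .⦃ _ : NonZero d ⦄ {x y} → x * (d · 1#) ≈ y * (d · 1#) → x ≈ y
  cancel d {x} {y} p = begin
    x                           ≈⟨ unit x ⟨
    x * (d · 1#) * ratio 1 d    ≈⟨ *-congʳ p ⟩
    y * (d · 1#) * ratio 1 d    ≈⟨ unit y ⟩
    y                           ∎
    where
    unit : ∀ z → z * (d · 1#) * ratio 1 d ≈ z
    unit z = trans (*-assoc z _ _) (trans (*-congˡ (trans (*-comm _ _) (trans (ratio-* 1 d) (+-identityʳ 1#)))) (*-identityʳ z))

  gColumns : ∀ {n} → (MultiIndex n → Carrier) → Columns n → Carrier
  gColumns g λs = List.foldr (λ v κ → g v ^ multiplicity v λs * κ) 1# (distinct λs)

  partitionMoment : ∀ {n} → (MultiIndex n → Carrier) → MultiIndex n → Carrier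
  partitionMoment g i = Σ (partitions i) λ λs →
    ratio (i !ₘ) (𝔪! λs ℕ.* columns! λs) ⦃ 𝔪!*columns!≢0 λs ⦄ * (- 1#) ^ length λs * gColumns g λs

  module _ {n} (g : MultiIndex n → Carrier) where

    weight : Columns n → Carrier
    weight λs = ratio 1 (𝔪! λs ℕ.* columns! λs) ⦃ 𝔪!*columns!≢0 λs ⦄ * (- 1#) ^ length λs * gColumns g λs

    -- The coefficient of t^i in exp(-A). The factor i! of the moment is split off, so that deleting
    -- a column `v` costs just `- a v`.
    coefficient : MultiIndex n → Carrier
    coefficient i = Σ (partitions i) weight

    -- The coefficient of t^v in A for `v ≢ 0ₘ`. The value at `0ₘ` only occurs multiplied by an
    -- entry of `0ₘ`.
    a : MultiIndex n → Carrier
    a v = g v * ratio 1 (v !ₘ) ⦃ !ₘ≢0 v ⦄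

    partitionMoment≈ : ∀ i → partitionMoment g i ≈ ((i !ₘ) · 1#) * coefficient i
    partitionMoment≈ i = trans (Σ-cong (partitions i) (λ λs →
      trans (*-congʳ (*-congʳ (factor (i !ₘ) (𝔪! λs ℕ.* columns! λs) ⦃ 𝔪!*columns!≢0 λs ⦄)))
        (trans (*-congʳ (*-assoc _ _ _)) (*-assoc _ _ _)))) (sym (*-distribˡ-Σ _ (partitions i)))
      where
      factor : ∀ m d .⦃ _ : NonZero d ⦄ → ratio m d ≈ (m · 1#) * ratio 1 d
      factor m d = cancel d (trans (ratio-* m d) (sym (trans (*-assoc _ _ _)
        (trans (*-congˡ (trans (ratio-* 1 d) (+-identityʳ 1#))) (*-identityʳ _)))))

    private
      module _ {v : MultiIndex n} {λs λs⁺} (p : λs⁺ ↭ v ∷ λs) where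

        gColumns-∷ : gColumns g λs⁺ ≈ g v * gColumns g λs
        gColumns-∷ = DistinctColumns.product-∷ *-commutativeMonoid (λ v k → g v ^ k) (λ v _ → g v)
          (λ _ → refl) (λ _ _ → refl) p

        private
          ∏≡ : ∀ (h : MultiIndex n → ℕ) vs →
            ListAction.product (map h vs) ≡ ListSum.Σ ℕ.*-1-commutativeMonoid vs h
          ∏≡ h vs = ListSum.Σ-map ℕ.*-1-commutativeMonoid h vs {λ m → m}

        𝔪!-∷ : 𝔪! λs⁺ ≡ suc (multiplicity v λs) ℕ.* 𝔪! λs
        𝔪!-∷ = ≡.trans (∏≡ _ (distinct λs⁺)) (≡.trans
          (DistinctColumns.product-∷ ℕ.*-1-commutativeMonoid (λ _ k → k !) (λ _ k → suc k)
            (λ _ → ≡.refl) (λ _ _ → ≡.refl) p)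
          (≡.cong (suc (multiplicity v λs) ℕ.*_) (≡.sym (∏≡ _ (distinct λs)))))

        columns!-∷ : columns! λs⁺ ≡ (v !ₘ) ℕ.* columns! λs
        columns!-∷ = ≡.trans (∏≡ _ (distinct λs⁺)) (≡.trans
          (DistinctColumns.product-∷ ℕ.*-1-commutativeMonoid (λ v k → (v !ₘ) ℕ.^ k) (λ v _ → v !ₘ)
            (λ _ → ≡.refl) (λ _ _ → ≡.refl) p)
          (≡.cong ((v !ₘ) ℕ.*_) (≡.sym (∏≡ _ (distinct λs)))))

        -- The denominator grows by the new multiplicity times v!. The claim is checked after
        -- multiplying by the positive integers `D` and `V`, which can be cancelled.
        ratio-∷ : (suc (multiplicity v λs) · 1#) * ratio 1 (𝔪! λs⁺ ℕ.* columns! λs⁺) ⦃ 𝔪!*columns!≢0 λs⁺ ⦄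
          ≈ ratio 1 (v !ₘ) ⦃ !ₘ≢0 v ⦄ * ratio 1 (𝔪! λs ℕ.* columns! λs) ⦃ 𝔪!*columns!≢0 λs ⦄
        ratio-∷ = cancel D ⦃ D≢0 ⦄ (cancel V ⦃ V≢0 ⦄ (begin
          (M · 1#) * ρ⁺ * (D · 1#) * (V · 1#)     ≈⟨ solve 4 (λ m r d v → m :* r :* d :* v := r :* (m :* (v :* d))) refl (M · 1#) ρ⁺ (D · 1#) (V · 1#) ⟩
          ρ⁺ * ((M · 1#) * ((V · 1#) * (D · 1#))) ≈⟨ *-congˡ (*-congˡ (×1-homo-* V D)) ⟨
          ρ⁺ * ((M · 1#) * ((V ℕ.* D) · 1#))        ≈⟨ *-congˡ (×1-homo-* M (V ℕ.* D)) ⟨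
          ρ⁺ * ((M ℕ.* (V ℕ.* D)) · 1#)             ≡⟨ ≡.cong (λ d → ρ⁺ * (d · 1#)) (≡.sym D⁺≡) ⟩
          ρ⁺ * (D⁺ · 1#)                          ≈⟨ ratio-* 1 D⁺ ⦃ 𝔪!*columns!≢0 λs⁺ ⦄ ⟩
          1 · 1#                                  ≈⟨ +-identityʳ 1# ⟩
          1#                                      ≈⟨ *-identityʳ 1# ⟨
          1# * 1#                                 ≈⟨ *-cong (trans (ratio-* 1 V ⦃ V≢0 ⦄) (+-identityʳ 1#)) (trans (ratio-* 1 D ⦃ D≢0 ⦄) (+-identityʳ 1#)) ⟨
          (ρᵥ * (V · 1#)) * (ρ * (D · 1#))        ≈⟨ solve 4 (λ x v y d → (x :* v) :* (y :* d) := x :* y :* d :* v) refl ρᵥ (V · 1#) ρ (D · 1#) ⟩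
          ρᵥ * ρ * (D · 1#) * (V · 1#)            ∎))
          where
          M = suc (multiplicity v λs)
          V = v !ₘ
          D = 𝔪! λs ℕ.* columns! λs
          D⁺ = 𝔪! λs⁺ ℕ.* columns! λs⁺
          D≢0 = 𝔪!*columns!≢0 λs
          V≢0 = !ₘ≢0 v
          ρ⁺ = ratio 1 D⁺ ⦃ 𝔪!*columns!≢0 λs⁺ ⦄
          ρ  = ratio 1 D ⦃ D≢0 ⦄
          ρᵥ = ratio 1 V ⦃ V≢0 ⦄
          D⁺≡ : D⁺ ≡ M ℕ.* (V ℕ.* D)
          D⁺≡ = ≡.trans (≡.cong₂ ℕ._*_ 𝔪!-∷ columns!-∷) (≡.trans (ℕ.*-assoc M (𝔪! λs) _)
            (≡.cong (M ℕ.*_) (x∙yz≈y∙xz (𝔪! λs) V (columns! λs))))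
            where open CommutativeSemigroup ℕ.*-commutativeSemigroup using (x∙yz≈y∙xz)

        multiplicity-∷ : multiplicity v λs⁺ ≡ suc (multiplicity v λs)
        multiplicity-∷ = ≡.trans (DistinctColumns.multiplicity-↭ +-commutativeMonoid v p) go
          where
          go : multiplicity v (v ∷ λs) ≡ suc (multiplicity v λs)
          go with v ≟ₘ v
          ... | yes _  = ≡.refl
          ... | no v≢v = contradiction ≡.refl v≢v

        -- The multiplicity, one unit for each copy of `v` that may be deleted, cancels the growth
        -- of `𝔪!`. The column leaves behind a sign, `g v` and 1 / v!.
        weight-∷ : (multiplicity v λs⁺ · 1#) * weight λs⁺ ≈ - a v * weight λs
        weight-∷ = begin
          (multiplicity v λs⁺ · 1#) * weight λs⁺
            ≡⟨ ≡.cong₂ (λ m l → (m · 1#) * (ρ⁺ * (- 1#) ^ l * gColumns g λs⁺)) multiplicity-∷ (↭-length p) ⟩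
          M * (ρ⁺ * (- 1# * σ) * gColumns g λs⁺)
            ≈⟨ *-congˡ (*-congˡ gColumns-∷) ⟩
          M * (ρ⁺ * (- 1# * σ) * (g v * G))
            ≈⟨ solve 5 (λ m r s gv G → m :* (r :* (:- :1 :* s) :* (gv :* G)) := (m :* r) :* (:- gv :* (s :* G))) refl M ρ⁺ σ (g v) G ⟩
          (M * ρ⁺) * (- g v * (σ * G))
            ≈⟨ *-congʳ ratio-∷ ⟩
          (ρᵥ * ρ) * (- g v * (σ * G))
            ≈⟨ solve 5 (λ x r s gv G → (x :* r) :* (:- gv :* (s :* G)) := :- (gv :* x) :* (r :* s :* G)) refl ρᵥ ρ σ (g v) G ⟩
          - a v * weight λs
            ∎
          where
          M = suc (multiplicity v λs) · 1#
          ρ⁺ = ratio 1 (𝔪! λs⁺ ℕ.* columns! λs⁺) ⦃ 𝔪!*columns!≢0 λs⁺ ⦄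
          ρ  = ratio 1 (𝔪! λs ℕ.* columns! λs) ⦃ 𝔪!*columns!≢0 λs ⦄
          ρᵥ = ratio 1 (v !ₘ) ⦃ !ₘ≢0 v ⦄
          σ = (- 1#) ^ length λs
          G = gColumns g λs

      multiplicity-∷-δ : ∀ (v w : MultiIndex n) λs →
        multiplicity v (w ∷ λs) · 1# ≈ (if does (v ≟ₘ w) then 1# else 0#) + multiplicity v λs · 1#
      multiplicity-∷-δ v w λs with v ≟ₘ w
      ... | yes _ = refl
      ... | no  _ = sym (+-identityˡ _)

      -- A row sum grouped by equal columns; any list without repetitions that contains all columns
      -- can index the groups.
      rowSums-multiplicity : ∀ {D} → Unique D → ∀ r λs → All (_∈ D) λs →
        Σ D (λ v → (multiplicity v λs · 1#) * (lookup v r · 1#)) ≈ lookup (rowSums λs) r · 1#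
      rowSums-multiplicity {D} u r [] [] = trans (Σ-cong D (λ v → zeroˡ _)) (trans (Σ-ε D)
        (reflexive (≡.cong (_· 1#) (≡.sym (lookup-0ₘ r)))))
      rowSums-multiplicity {D} u r (w ∷ λs) (w∈ ∷ λs∈) = begin
        Σ D (λ v → (multiplicity v (w ∷ λs) · 1#) * x v)
          ≈⟨ Σ-cong D (λ v → trans (*-congʳ (multiplicity-∷-δ v w λs)) (distribʳ _ _ _)) ⟩
        Σ D (λ v → δ v * x v + (multiplicity v λs · 1#) * x v)
          ≈⟨ Σ-∙ D ⟩
        Σ D (λ v → δ v * x v) + Σ D (λ v → (multiplicity v λs · 1#) * x v)
          ≈⟨ +-cong (trans (Σ-single {f = λ v → δ v * x v} u w∈ δ-≢) δ-≡) (rowSums-multiplicity u r λs λs∈) ⟩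
        lookup w r · 1# + lookup (rowSums λs) r · 1#
          ≈⟨ ×-homo-+ 1# (lookup w r) _ ⟨
        (lookup w r ℕ.+ lookup (rowSums λs) r) · 1#
          ≡⟨ ≡.cong (_· 1#) (lookup-+ₘ r w (rowSums λs)) ⟨
        lookup (w +ₘ rowSums λs) r · 1# ∎
        where
        x : MultiIndex n → Carrier
        x v = lookup v r · 1#
        δ : MultiIndex n → Carrier
        δ v = if does (v ≟ₘ w) then 1# else 0#
        δ-≢ : ∀ {v} → v ≢ w → δ v * x v ≈ 0#
        δ-≢ {v} v≢w with v ≟ₘ w
        ... | yes v≡w = contradiction v≡w v≢w
        ... | no  _   = zeroˡ _
        δ-≡ : δ w * x w ≈ x w
        δ-≡ with w ≟ₘ w
        ... | yes _  = *-identityˡ _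
        ... | no w≢w = contradiction ≡.refl w≢w

      -- Partitions without `v` have multiplicity 0 and drop out. The others are insertions of `v`
      -- into partitions of `u`, where `weight-∷` applies.
      removeColumn : ∀ {v u i} → v ≢ 0ₘ → v +ₘ u ≡ i →
        Σ (partitions i) (λ λs → (multiplicity v λs · 1#) * weight λs) ≈ - a v * coefficient u
      removeColumn {v} {u} v≢0 ≡.refl = begin
        Σ (partitions (v +ₘ u)) f                      ≈⟨ Σ-filter (v ∈?_) (partitions (v +ₘ u)) f-∉ ⟩
        Σ (filter (v ∈?_) (partitions (v +ₘ u))) f     ≈⟨ Σ-↭ (partitions-containing u v≢0) ⟩
        Σ (map (insertColumn v) (partitions u)) f      ≡⟨ Σ-map (insertColumn v) (partitions u) ⟩
        Σ (partitions u) (λ λs → f (insertColumn v λs)) ≈⟨ Σ-cong (partitions u) (λ λs → weight-∷ (insertColumn-↭ v λs)) ⟩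
        Σ (partitions u) (λ λs → - a v * weight λs)    ≈⟨ *-distribˡ-Σ (- a v) (partitions u) ⟨
        - a v * coefficient u                          ∎
        where
        f : Columns n → Carrier
        f λs = (multiplicity v λs · 1#) * weight λs
        f-∉ : ∀ {λs} → (v ∈ λs → _) → f λs ≈ 0#
        f-∉ {λs} v∉ = trans (*-congʳ (reflexive (≡.cong (_· 1#)
          (DistinctColumns.multiplicity-∉ +-commutativeMonoid v λs (λ v∈ → contradiction v∈ v∉))))) (zeroˡ _)

    -- Coefficientwise, D_r exp(-A) = - (D_r A) exp(-A) for A = Σ_v a_v t^v.
    coefficient-recurrence : ∀ i r → (lookup i r · 1#) * coefficient i
      ≈ Σ (box i) (λ v → (lookup v r · 1#) * (- a v * coefficient (i ∸ₘ v)))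
    coefficient-recurrence i r = begin
      (lookup i r · 1#) * coefficient i
        ≈⟨ *-distribˡ-Σ _ (partitions i) ⟩
      Σ (partitions i) (λ λs → (lookup i r · 1#) * weight λs)
        ≈⟨ Σ-cong∈ (partitions i) expand ⟩
      Σ (partitions i) (λ λs → Σ (box i) (λ v → x v * ((multiplicity v λs · 1#) * weight λs)))
        ≈⟨ Σ-swap (partitions i) (box i) ⟩
      Σ (box i) (λ v → Σ (partitions i) (λ λs → x v * ((multiplicity v λs · 1#) * weight λs)))
        ≈⟨ Σ-cong (box i) (λ v → sym (*-distribˡ-Σ (x v) (partitions i))) ⟩
      Σ (box i) (λ v → x v * Σ (partitions i) (λ λs → (multiplicity v λs · 1#) * weight λs))
        ≈⟨ Σ-cong∈ (box i) column ⟩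
      Σ (box i) (λ v → x v * (- a v * coefficient (i ∸ₘ v)))
        ∎
      where
      x : MultiIndex n → Carrier
      x v = lookup v r · 1#
      expand : ∀ {λs} → λs ∈ partitions i →
        (lookup i r · 1#) * weight λs ≈ Σ (box i) (λ v → x v * ((multiplicity v λs · 1#) * weight λs))
      expand {λs} λs∈ = begin
        (lookup i r · 1#) * weight λs
          ≡⟨ ≡.cong (λ j → (lookup j r · 1#) * weight λs) rowSums≡ ⟨
        (lookup (rowSums λs) r · 1#) * weight λs
          ≈⟨ *-congʳ (rowSums-multiplicity (box-unique i) r λs
               (columns∈box λs 0ₘ (≡.trans (+ₘ-identityˡ (rowSums λs)) rowSums≡))) ⟨
        Σ (box i) (λ v → (multiplicity v λs · 1#) * x v) * weight λs
          ≈⟨ *-comm _ _ ⟩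
        weight λs * Σ (box i) (λ v → (multiplicity v λs · 1#) * x v)
          ≈⟨ *-distribˡ-Σ (weight λs) (box i) ⟩
        Σ (box i) (λ v → weight λs * ((multiplicity v λs · 1#) * x v))
          ≈⟨ Σ-cong (box i) (λ v → solve 3 (λ w m x → w :* (m :* x) := x :* (m :* w)) refl (weight λs) (multiplicity v λs · 1#) (x v)) ⟩
        Σ (box i) (λ v → x v * ((multiplicity v λs · 1#) * weight λs))
          ∎
        where
        rowSums≡ : rowSums λs ≡ i
        rowSums≡ = proj₂ (proj₂ (Equivalence.to ∈-partitions λs∈))
      column : ∀ {v} → v ∈ box i →
        x v * Σ (partitions i) (λ λs → (multiplicity v λs · 1#) * weight λs)
          ≈ x v * (- a v * coefficient (i ∸ₘ v))
      column {v} v∈ with v ≟ₘ 0ₘ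
      -- `0ₘ` lies in the box but is never a column; its r-th entry makes both sides vanish.
      ... | yes ≡.refl = trans (x0≈0 _) (sym (x0≈0 _))
        where
        x0≈0 : ∀ y → x 0ₘ * y ≈ 0#
        x0≈0 y = trans (*-congʳ (reflexive (≡.cong (_· 1#) (lookup-0ₘ r)))) (zeroˡ y)
      ... | no v≢0 with ∈-box⁻ {i = i} v∈
      ...   | u , v+u≡i = *-congˡ (trans (removeColumn {u = u} v≢0 v+u≡i)
        (*-congˡ (reflexive (≡.cong coefficient (≡.trans (≡.sym (v+u∸v≡u v u)) (≡.cong (_∸ₘ v) v+u≡i))))))

    coefficient-0ₘ : coefficient 0ₘ ≈ 1#
    coefficient-0ₘ = trans (Σ-↭ {f = weight} (partitions-0ₘ {n})) (trans (+-identityʳ _)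
      (trans (*-identityʳ _) (trans (*-identityʳ _) (trans (sym (*-identityʳ _))
        (trans (*-congˡ (sym (+-identityʳ 1#))) (trans (ratio-* 1 1) (+-identityʳ 1#)))))))

    module _ (½ : Carrier) (½+½ : ½ + ½ ≈ 1#) (M : Fin n → Fin n → Carrier) (M-sym : ∀ p q → M p q ≈ M q p)
      (a-quadratic : ∀ v → v ≢ 0ₘ →
        a v ≈ ½ * sum (λ p → sum (λ q → M p q * (if does (v ≟ₘ eₘ p +ₘ eₘ q) then 1# else 0#)))) where

      private
        indicator : (v w : MultiIndex n) → Carrier
        indicator v w = if does (v ≟ₘ w) then 1# else 0#

        indicator-≢ : ∀ {v w} y → v ≢ w → indicator v w * y ≈ 0#
        indicator-≢ {v} {w} y v≢w with v ≟ₘ w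
        ... | yes v≡w = contradiction v≡w v≢w
        ... | no  _   = zeroˡ y

        indicator-≡ : ∀ {v} y → indicator v v * y ≈ y
        indicator-≡ {v} y with v ≟ₘ v
        ... | yes _  = *-identityˡ y
        ... | no v≢v = contradiction ≡.refl v≢v

        -- The coefficient at i - e_p - e_q, or 0 when that is not a multi-index. Written as a sum
        -- over the box, it comes straight out of `coefficient-recurrence` and its symmetry in `p`
        -- and `q` is immediate.
        below : MultiIndex n → (p q : Fin n) → Carrier
        below i p q = Σ (box i) (λ v → indicator v (eₘ p +ₘ eₘ q) * coefficient (i ∸ₘ v))

        below-sym : ∀ i p q → below i p q ≈ below i q p
        below-sym i p q = reflexive (≡.cong (λ w → Σ (box i) (λ v → indicator v w * coefficient (i ∸ₘ v)))
          (+ₘ-comm (eₘ p) (eₘ q)))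

        below-eₘ+ : ∀ p q u → below (eₘ p +ₘ (eₘ q +ₘ u)) p q ≈ coefficient u
        below-eₘ+ p q u = trans (Σ-single {f = λ v → indicator v w * coefficient (i ∸ₘ v)} (box-unique i)
            (∈-box w u (+ₘ-assoc (eₘ p) (eₘ q) u)) (λ {v} v≢w → indicator-≢ {v} {w} _ v≢w))
          (trans (indicator-≡ {w} _) (reflexive (≡.cong coefficient
            (≡.trans (≡.cong (_∸ₘ w) (≡.sym (+ₘ-assoc (eₘ p) (eₘ q) u))) (v+u∸v≡u w u)))))
          where
          w = eₘ p +ₘ eₘ q
          i = eₘ p +ₘ (eₘ q +ₘ u)

        below-zero : ∀ p q i → lookup i q ≡ 0 → below (eₘ p +ₘ i) p q ≈ 0#
        below-zero p q i iq≡0 = trans (Σ-cong∈ (box (eₘ p +ₘ i)) vanish) (Σ-ε (box (eₘ p +ₘ i)))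
          where
          vanish : ∀ {v} → v ∈ box (eₘ p +ₘ i) → indicator v (eₘ p +ₘ eₘ q) * coefficient ((eₘ p +ₘ i) ∸ₘ v) ≈ 0#
          vanish {v} v∈ with ∈-box⁻ {i = eₘ p +ₘ i} v∈
          ... | u , v+u≡ = indicator-≢ {v} {eₘ p +ₘ eₘ q} _ λ where
            ≡.refl → contradiction
              (≡.trans (≡.sym (lookup-eₘ+ q u)) (≡.trans
                (≡.cong (λ j → lookup j q) (+ₘ-cancelˡ (eₘ p) (≡.trans (≡.sym (+ₘ-assoc (eₘ p) (eₘ q) u)) v+u≡))) iq≡0))
              λ ()

      -- The r-th entry of e_p + e_q is δ_pr + δ_qr. Each delta collapses one of the two sums, the
      -- results agree because M is symmetric, and the factor ½ disappears.
      gaussianCoefficient-recurrence : ∀ i r → (lookup i r · 1#) * coefficient i ≈ - sum (λ s → M r s * below i r s)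
      gaussianCoefficient-recurrence i r = begin
        (lookup i r · 1#) * coefficient i
          ≈⟨ coefficient-recurrence i r ⟩
        Σ (box i) (λ v → x v * (- a v * coefficient (i ∸ₘ v)))
          ≈⟨ Σ-cong (box i) term ⟩
        Σ (box i) (λ v → - ½ * sum (λ p → sum (λ q → (x (eₘ p) + x (eₘ q)) * (M p q * (indicator v (eₘ p +ₘ eₘ q) * coefficient (i ∸ₘ v))))))
          ≈⟨ *-distribˡ-Σ (- ½) (box i) ⟨
        - ½ * Σ (box i) (λ v → sum (λ p → sum (λ q → (x (eₘ p) + x (eₘ q)) * (M p q * (indicator v (eₘ p +ₘ eₘ q) * coefficient (i ∸ₘ v))))))
          ≈⟨ *-congˡ (trans (Σ-sum n (box i) {λ v p → sum (λ q → term′ p q v)})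
               (sum-cong n (λ p → trans (Σ-sum n (box i) {λ v q → term′ p q v}) (sum-cong n (λ q →
               trans (sym (*-distribˡ-Σ (x (eₘ p) + x (eₘ q)) (box i))) (*-congˡ (sym (*-distribˡ-Σ (M p q) (box i))))))))) ⟩
        - ½ * sum (λ p → sum (λ q → (x (eₘ p) + x (eₘ q)) * N p q))
          ≈⟨ *-congˡ (trans (sum-cong n (λ p → trans (sum-cong n (λ q → distribʳ (N p q) (x (eₘ p)) (x (eₘ q)))) (sum-+ n {λ q → x (eₘ p) * N p q} {λ q → x (eₘ q) * N p q}))) (sum-+ n {λ p → sum (λ q → x (eₘ p) * N p q)} {λ p → sum (λ q → x (eₘ q) * N p q)})) ⟩
        - ½ * (sum (λ p → sum (λ q → x (eₘ p) * N p q)) + sum (λ p → sum (λ q → x (eₘ q) * N p q)))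
          ≈⟨ *-congˡ (+-cong (trans (sum-cong n (λ p → sym (sum-distribˡ n _ {N p}))) (sum-δ r (λ p → sum (N p))))
               (trans (sum-cong n (λ p → sum-δ r (N p))) (sum-cong n (λ p → *-cong (M-sym p r) (below-sym i p r))))) ⟩
        - ½ * (sum (N r) + sum (N r))
          ≈⟨ solve 2 (λ h y → :- h :* (y :+ y) := :- ((h :+ h) :* y)) refl ½ (sum (N r)) ⟩
        - ((½ + ½) * sum (N r))
          ≈⟨ -‿cong (trans (*-congʳ ½+½) (*-identityˡ _)) ⟩
        - sum (N r)
          ∎
        where
        x : MultiIndex n → Carrier
        x v = lookup v r · 1#
        N : Fin n → Fin n → Carrier
        N p q = M p q * below i p q
        term′ : Fin n → Fin n → MultiIndex n → Carrier
        term′ p q v = (x (eₘ p) + x (eₘ q)) * (M p q * (indicator v (eₘ p +ₘ eₘ q) * coefficient (i ∸ₘ v)))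
        term : ∀ v → x v * (- a v * coefficient (i ∸ₘ v))
          ≈ - ½ * sum (λ p → sum (λ q → (x (eₘ p) + x (eₘ q)) * (M p q * (indicator v (eₘ p +ₘ eₘ q) * coefficient (i ∸ₘ v)))))
        term v = begin
          x v * (- a v * c)
            ≈⟨ solve 3 (λ x a c → x :* (:- a :* c) := (x :* a) :* :- c) refl (x v) (a v) c ⟩
          (x v * a v) * - c
            ≈⟨ *-congʳ xa≈ ⟩
          (x v * (½ * sum (λ p → sum (λ q → M p q * indicator v (eₘ p +ₘ eₘ q))))) * - c
            ≈⟨ solve 4 (λ x h s c → (x :* (h :* s)) :* :- c := :- h :* ((x :* c) :* s)) refl (x v) ½ _ c ⟩
          - ½ * ((x v * c) * sum (λ p → sum (λ q → M p q * indicator v (eₘ p +ₘ eₘ q))))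
            ≈⟨ *-congˡ (trans (sum-distribˡ n (x v * c) {λ p → sum (λ q → M p q * indicator v (eₘ p +ₘ eₘ q))}) (sum-cong n (λ p → trans (sum-distribˡ n (x v * c) {λ q → M p q * indicator v (eₘ p +ₘ eₘ q)}) (sum-cong n (λ q → entry p q))))) ⟩
          - ½ * sum (λ p → sum (λ q → (x (eₘ p) + x (eₘ q)) * (M p q * (indicator v (eₘ p +ₘ eₘ q) * c))))
            ∎
          where
          c = coefficient (i ∸ₘ v)
          xa≈ : x v * a v ≈ x v * (½ * sum (λ p → sum (λ q → M p q * indicator v (eₘ p +ₘ eₘ q))))
          xa≈ with v ≟ₘ 0ₘ
          ... | yes ≡.refl = trans (x0≈0 _) (sym (x0≈0 _))
            where
            x0≈0 : ∀ y → x 0ₘ * y ≈ 0#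
            x0≈0 y = trans (*-congʳ (reflexive (≡.cong (_· 1#) (lookup-0ₘ r)))) (zeroˡ y)
          ... | no v≢0 = *-congˡ (a-quadratic v v≢0)
          entry : ∀ p q → (x v * c) * (M p q * indicator v (eₘ p +ₘ eₘ q))
            ≈ (x (eₘ p) + x (eₘ q)) * (M p q * (indicator v (eₘ p +ₘ eₘ q) * c))
          entry p q with v ≟ₘ eₘ p +ₘ eₘ q
          ... | no  _      = trans (trans (*-congˡ (zeroʳ _)) (zeroʳ _))
            (sym (trans (*-congˡ (trans (*-congˡ (zeroˡ c)) (zeroʳ _))) (zeroʳ _)))
          ... | yes ≡.refl = trans (*-congʳ (*-congʳ (trans
              (reflexive (≡.cong (_· 1#) (lookup-+ₘ r (eₘ p) (eₘ q)))) (×-homo-+ 1# (lookup (eₘ p) r) _))))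
            (solve 4 (λ x c m i → (x :* c) :* (m :* i) := x :* (m :* (i :* c))) refl (x (eₘ p) + x (eₘ q)) c (M p q) 1#)

      -- In (e_r + i)! = (i_r + 1) i! the first factor is consumed by the recurrence at e_r + i. The
      -- remaining i! = i_s (i - e_s)! turns the lower coefficients into moments.
      gaussianMoment-recurrence : ∀ r i → partitionMoment g (eₘ r +ₘ i)
        ≈ - sum (λ s → M r s * ((lookup i s · 1#) * partitionMoment g (decrement s i)))
      gaussianMoment-recurrence r i = begin
        partitionMoment g (eₘ r +ₘ i)
          ≈⟨ partitionMoment≈ (eₘ r +ₘ i) ⟩
        (((eₘ r +ₘ i) !ₘ) · 1#) * coefficient (eₘ r +ₘ i)
          ≈⟨ *-congʳ (trans (reflexive (≡.cong (_· 1#) (≡.trans (eₘ+-! r i) (≡.cong (ℕ._* (i !ₘ)) (≡.sym (lookup-eₘ+ r i))))))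
               (×1-homo-* (lookup (eₘ r +ₘ i) r) (i !ₘ))) ⟩
        (lookup (eₘ r +ₘ i) r · 1#) * ((i !ₘ) · 1#) * coefficient (eₘ r +ₘ i)
          ≈⟨ solve 3 (λ x y z → x :* y :* z := y :* (x :* z)) refl _ _ _ ⟩
        ((i !ₘ) · 1#) * ((lookup (eₘ r +ₘ i) r · 1#) * coefficient (eₘ r +ₘ i))
          ≈⟨ *-congˡ (gaussianCoefficient-recurrence (eₘ r +ₘ i) r) ⟩
        ((i !ₘ) · 1#) * - sum (λ s → M r s * below (eₘ r +ₘ i) r s)
          ≈⟨ -‿distribʳ-* _ _ ⟨
        - (((i !ₘ) · 1#) * sum (λ s → M r s * below (eₘ r +ₘ i) r s))
          ≈⟨ -‿cong (trans (sum-distribˡ n ((i !ₘ) · 1#) {λ s → M r s * below (eₘ r +ₘ i) r s}) (sum-cong n (λ s →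
               trans (solve 3 (λ x y z → x :* (y :* z) := y :* (x :* z)) refl _ _ _) (*-congˡ (entry s))))) ⟩
        - sum (λ s → M r s * ((lookup i s · 1#) * partitionMoment g (decrement s i)))
          ∎
        where
        entry : ∀ s → ((i !ₘ) · 1#) * below (eₘ r +ₘ i) r s ≈ (lookup i s · 1#) * partitionMoment g (decrement s i)
        entry s with zero⊎eₘ+ s i
        ... | inj₁ is≡0 = trans (trans (*-congˡ (below-zero r s i is≡0)) (zeroʳ _))
          (sym (trans (*-congʳ (reflexive (≡.cong (_· 1#) is≡0))) (zeroˡ _)))
        ... | inj₂ (u , ≡.refl) = begin
          (((eₘ s +ₘ u) !ₘ) · 1#) * below (eₘ r +ₘ (eₘ s +ₘ u)) r s
            ≈⟨ *-cong (trans (reflexive (≡.cong (_· 1#) (eₘ+-! s u))) (×1-homo-* (suc (lookup u s)) (u !ₘ))) (below-eₘ+ r s u) ⟩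
          (suc (lookup u s) · 1#) * ((u !ₘ) · 1#) * coefficient u
            ≈⟨ *-assoc _ _ _ ⟩
          (suc (lookup u s) · 1#) * (((u !ₘ) · 1#) * coefficient u)
            ≈⟨ *-congˡ (partitionMoment≈ u) ⟨
          (suc (lookup u s) · 1#) * partitionMoment g u
            ≡⟨ ≡.cong₂ (λ m j → (m · 1#) * partitionMoment g j) (lookup-eₘ+ s u) (decrement-eₘ+ s u) ⟨
          (lookup (eₘ s +ₘ u) s · 1#) * partitionMoment g (decrement s (eₘ s +ₘ u))
            ∎

    partitionMoment-0ₘ : partitionMoment g 0ₘ ≈ 1#
    partitionMoment-0ₘ = trans (partitionMoment≈ 0ₘ) (trans (*-cong
      (trans (reflexive (≡.cong (_· 1#) (0ₘ! n))) (+-identityʳ 1#)) coefficient-0ₘ) (*-identityˡ 1#))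

-- Binomial shift, three-term recurrence and its consequences

module BinomialTransform {k ℓ} (K : CommutativeRing k ℓ) where

  open import Data.Nat.Combinatorics using (_C_; nCk+nC[k+1]≡[n+1]C[k+1]; k>n⇒nCk≡0)

  open CommutativeRing K hiding (zero)
  open import Relation.Binary.Reasoning.Setoid setoid
  open RingSum K
  open import Algebra.Properties.Semiring.Sum semiring using (∑-comm)
  open RawSemiringDefinitions (Semiring.rawSemiring semiring) using (product)
  open IntegerRingSolver K using (solve; _:=_; _:*_; _:+_; :-_; _:-_; :1; :0)
  open PartitionInsertion using (+ₘ-identityˡ; +ₘ-assoc; +ₘ-comm)
  open MultiIndexProperties

  private
    Σ-applyUpTo : ∀ {a} {A : Set a} (h : ℕ → A) N {f : A → Carrier} → Σ (applyUpTo h N) f ≡ Σ (upTo N) (λ j → f (h j))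
    Σ-applyUpTo h zero        = ≡.refl
    Σ-applyUpTo h (suc N) {f} = ≡.cong (f (h 0) +_)
      (≡.trans (Σ-applyUpTo (λ j → h (suc j)) N) (≡.sym (Σ-applyUpTo suc N)))

    Σ-first : ∀ N {f : ℕ → Carrier} → Σ (upTo (suc N)) f ≡ f 0 + Σ (upTo N) (λ j → f (suc j))
    Σ-first N {f} = ≡.cong (f 0 +_) (Σ-applyUpTo suc N)

    Σ-last : ∀ N {f : ℕ → Carrier} → Σ (upTo (suc N)) f ≈ Σ (upTo N) f + f N
    Σ-last zero        = +-comm _ _
    Σ-last (suc N) {f} = begin
      Σ (upTo (suc (suc N))) f                              ≡⟨ Σ-first (suc N) ⟩
      f 0 + Σ (upTo (suc N)) (λ j → f (suc j))              ≈⟨ +-congˡ (Σ-last N) ⟩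
      f 0 + (Σ (upTo N) (λ j → f (suc j)) + f (suc N))      ≈⟨ +-assoc _ _ _ ⟨
      f 0 + Σ (upTo N) (λ j → f (suc j)) + f (suc N)        ≡⟨ ≡.cong (_+ f (suc N)) (Σ-first N) ⟨
      Σ (upTo (suc N)) f + f (suc N)                        ∎

  -- The value at 0 of (β + S)^k f, where S shifts a sequence by one. Peeling off one factor at a
  -- time confines binomial coefficients and truncated subtraction to `binomial₁≈Σ`.
  binomial₁ : ℕ → Carrier → (ℕ → Carrier) → Carrier
  binomial₁ zero    β f = f 0
  binomial₁ (suc k) β f = β * binomial₁ k β f + binomial₁ k β (λ j → f (suc j))

  binomial₁≈Σ : ∀ k β f → binomial₁ k β f ≈ Σ (upTo (suc k)) (λ j → ((k C j) · β ^ (k ∸ j)) * f j)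
  binomial₁≈Σ zero    β f = sym (trans (+-identityʳ _) (trans (*-congʳ (+-identityʳ 1#)) (*-identityˡ _)))
  binomial₁≈Σ (suc k) β f = begin
    β * binomial₁ k β f + binomial₁ k β (λ j → f (suc j))
      ≈⟨ +-cong (*-congˡ (binomial₁≈Σ k β f)) (binomial₁≈Σ k β (λ j → f (suc j))) ⟩
    β * Σ (upTo (suc k)) (λ j → ((k C j) · β ^ (k ∸ j)) * f j) + T
      ≡⟨ ≡.cong (λ s → β * s + T) (Σ-first k) ⟩
    β * ((1 · β ^ k) * f 0 + Σ (upTo k) (λ j → ((k C suc j) · β ^ (k ∸ suc j)) * f (suc j))) + T
      ≈⟨ +-congʳ (distribˡ β _ _) ⟩
    β * ((1 · β ^ k) * f 0) + β * Σ (upTo k) (λ j → ((k C suc j) · β ^ (k ∸ suc j)) * f (suc j)) + T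
      ≈⟨ +-congʳ (+-cong first (*-distribˡ-Σ β (upTo k))) ⟩
    F 0 + Σ (upTo k) (λ j → β * (((k C suc j) · β ^ (k ∸ suc j)) * f (suc j))) + T
      ≈⟨ +-congʳ (+-congˡ (Σ-cong∈ (upTo k) (λ j∈ → absorb (∈-upTo⁻ j∈)))) ⟩
    F 0 + Σ (upTo k) U + T
      -- A term with k C (k + 1) = 0 is added so that both sums run over 0, ..., k and Pascal's rule
      -- applies termwise.
      ≈⟨ +-congʳ (+-congˡ (trans (+-congˡ U-last) (+-identityʳ _))) ⟨
    F 0 + (Σ (upTo k) U + U k) + T
      ≈⟨ +-congʳ (+-congˡ (Σ-last k)) ⟨
    F 0 + Σ (upTo (suc k)) U + T
      ≈⟨ trans (+-assoc _ _ _) (+-congˡ (trans (+-comm _ _) (sym (Σ-∙ (upTo (suc k)))))) ⟩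
    F 0 + Σ (upTo (suc k)) (λ j → ((k C j) · β ^ (k ∸ j)) * f (suc j) + U j)
      ≈⟨ +-congˡ (Σ-cong (upTo (suc k)) pascal) ⟩
    F 0 + Σ (upTo (suc k)) (λ j → F (suc j))
      ≡⟨ Σ-first (suc k) ⟨
    Σ (upTo (suc (suc k))) F ∎
    where
    T = Σ (upTo (suc k)) (λ j → ((k C j) · β ^ (k ∸ j)) * f (suc j))
    F U : ℕ → Carrier
    F j = ((suc k C j) · β ^ (suc k ∸ j)) * f j
    U j = ((k C suc j) · β ^ (k ∸ j)) * f (suc j)
    first : β * ((1 · β ^ k) * f 0) ≈ F 0
    first = trans (*-congˡ (*-congʳ (+-identityʳ _))) (trans (sym (*-assoc _ _ _)) (*-congʳ (sym (+-identityʳ _))))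
    absorb : ∀ {j} → j ℕ.< k → β * (((k C suc j) · β ^ (k ∸ suc j)) * f (suc j)) ≈ U j
    absorb {j} j<k = trans (sym (*-assoc _ _ _)) (*-congʳ (trans (×-comm-* (k C suc j) _ _)
      (×-congʳ (k C suc j) (reflexive (≡.cong (β ^_) (≡.sym (ℕ.+-∸-assoc 1 j<k)))))))
    U-last : U k ≈ 0#
    U-last = trans (*-congʳ (reflexive (≡.cong (_· β ^ (k ∸ k)) (k>n⇒nCk≡0 (ℕ.n<1+n k))))) (zeroˡ _)
    pascal : ∀ j → ((k C j) · β ^ (k ∸ j)) * f (suc j) + U j ≈ F (suc j)
    pascal j = trans (sym (distribʳ _ _ _)) (*-congʳ (trans (sym (×-homo-+ _ (k C j) (k C suc j)))
      (reflexive (≡.cong (_· β ^ (k ∸ j)) (nCk+nC[k+1]≡[n+1]C[k+1] k j)))))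

  binomial₁-cong : ∀ k β {f g} → (∀ j → f j ≈ g j) → binomial₁ k β f ≈ binomial₁ k β g
  binomial₁-cong zero    β f≈g = f≈g 0
  binomial₁-cong (suc k) β f≈g = +-cong (*-congˡ (binomial₁-cong k β f≈g)) (binomial₁-cong k β (λ j → f≈g (suc j)))

  binomial₁-+ : ∀ k β {f g} → binomial₁ k β (λ j → f j + g j) ≈ binomial₁ k β f + binomial₁ k β g
  binomial₁-+ zero    β = refl
  binomial₁-+ (suc k) β = trans (+-cong (*-congˡ (binomial₁-+ k β)) (binomial₁-+ k β))
    (solve 5 (λ b x y z w → b :* (x :+ y) :+ (z :+ w) := (b :* x :+ z) :+ (b :* y :+ w)) refl β _ _ _ _)

  binomial₁-* : ∀ k β x {f} → binomial₁ k β (λ j → x * f j) ≈ x * binomial₁ k β f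
  binomial₁-* zero    β x = refl
  binomial₁-* (suc k) β x = trans (+-cong (*-congˡ (binomial₁-* k β x)) (binomial₁-* k β x))
    (solve 4 (λ b x y z → b :* (x :* y) :+ x :* z := x :* (b :* y :+ z)) refl β x _ _)

  -- Umbrally this is d/dη (β + η)^k = k (β + η)^(k - 1): the sequence j f(j - 1) is what
  -- differentiating η^j produces.
  binomial₁-absorb : ∀ k β f → binomial₁ k β (λ j → (j · 1#) * f (pred j)) ≈ (k · 1#) * binomial₁ (pred k) β f
  binomial₁-absorb zero    β f = trans (zeroˡ _) (sym (zeroˡ _))
  binomial₁-absorb (suc k) β f = begin
    β * binomial₁ k β (λ j → (j · 1#) * f (pred j)) + binomial₁ k β (λ j → (suc j · 1#) * f j)
      ≈⟨ +-cong (*-congˡ (binomial₁-absorb k β f)) (trans (binomial₁-cong k β split) (trans (binomial₁-+ k β)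
           (+-congˡ (binomial₁-absorb k β (λ j → f (suc j)))))) ⟩
    β * ((k · 1#) * binomial₁ (pred k) β f) + (binomial₁ k β f + (k · 1#) * binomial₁ (pred k) β (λ j → f (suc j)))
      ≈⟨ merge k ⟩
    (suc k · 1#) * binomial₁ k β f ∎
    where
    -- Writing `suc (pred j)` for `j` brings the induction hypothesis for the shifted sequence into
    -- play; at j = 0 the factor is 0.
    split : ∀ j → (suc j · 1#) * f j ≈ f j + (j · 1#) * f (suc (pred j))
    split zero    = trans (*-congʳ (+-identityʳ 1#)) (trans (*-identityˡ _) (sym (trans (+-congˡ (zeroˡ _)) (+-identityʳ _))))
    split (suc j) = trans (distribʳ _ _ _) (+-congʳ (*-identityˡ _))
    merge : ∀ k → β * ((k · 1#) * binomial₁ (pred k) β f) + (binomial₁ k β f + (k · 1#) * binomial₁ (pred k) β (λ j → f (suc j)))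
      ≈ (suc k · 1#) * binomial₁ k β f
    merge zero    = solve 3 (λ b x y → b :* (:0 :* x) :+ (x :+ :0 :* y) := (:1 :+ :0) :* x) refl β _ _
    merge (suc k) = solve 4 (λ b c x y → b :* (c :* x) :+ ((b :* x :+ y) :+ c :* y) := (:1 :+ c) :* (b :* x :+ y)) refl β _ _ _

  -- The product of the (b_r + S_r)^(i_r), applied to `m` and evaluated at `0ₘ`.
  binomial : ∀ {n} → MultiIndex n → (Fin n → Carrier) → (MultiIndex n → Carrier) → Carrier
  binomial []      b m = m []
  binomial (k ∷ i) b m = binomial₁ k (b zero) (λ j → binomial i (λ r → b (suc r)) (λ js → m (j ∷ js)))

  binomial≈Σ : ∀ {n} (i : MultiIndex n) b m → binomial i b m
    ≈ Σ (box i) (λ j → product (λ r → (lookup i r C lookup j r) · b r ^ (lookup i r ∸ lookup j r)) * m j)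
  binomial≈Σ []      b m = sym (trans (+-identityʳ _) (*-identityˡ _))
  binomial≈Σ (k ∷ i) b m = begin
    binomial₁ k (b zero) (λ j → binomial i b′ (λ js → m (j ∷ js)))
      ≈⟨ binomial₁-cong k (b zero) (λ j → binomial≈Σ i b′ (λ js → m (j ∷ js))) ⟩
    binomial₁ k (b zero) (λ j → Σ (box i) (λ js → κ js * m (j ∷ js)))
      ≈⟨ binomial₁≈Σ k (b zero) _ ⟩
    Σ (upTo (suc k)) (λ j → κ₁ j * Σ (box i) (λ js → κ js * m (j ∷ js)))
      ≈⟨ Σ-cong (upTo (suc k)) (λ j → trans (*-distribˡ-Σ (κ₁ j) (box i)) (Σ-cong (box i) (λ js → sym (*-assoc _ _ _)))) ⟩
    Σ (upTo (suc k)) (λ j → Σ (box i) (λ js → (κ₁ j * κ js) * m (j ∷ js)))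
      ≈⟨ Σ-cartesianProductWith _∷_ (upTo (suc k)) (box i) ⟨
    Σ (box (k ∷ i)) (λ j → product (λ r → (lookup (k ∷ i) r C lookup j r) · b r ^ (lookup (k ∷ i) r ∸ lookup j r)) * m j) ∎
    where
    b′ : Fin _ → Carrier
    b′ r = b (suc r)
    κ : MultiIndex _ → Carrier
    κ js = product (λ r → (lookup i r C lookup js r) · b′ r ^ (lookup i r ∸ lookup js r))
    κ₁ : ℕ → Carrier
    κ₁ j = (k C j) · b zero ^ (k ∸ j)

  binomial-cong : ∀ {n} (i : MultiIndex n) b {m m′} → (∀ j → m j ≈ m′ j) → binomial i b m ≈ binomial i b m′
  binomial-cong []      b m≈ = m≈ []
  binomial-cong (k ∷ i) b m≈ = binomial₁-cong k _ (λ j → binomial-cong i _ (λ js → m≈ (j ∷ js)))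

  binomial-+ : ∀ {n} (i : MultiIndex n) b {m m′} →
    binomial i b (λ j → m j + m′ j) ≈ binomial i b m + binomial i b m′
  binomial-+ []      b = refl
  binomial-+ (k ∷ i) b = trans (binomial₁-cong k _ (λ j → binomial-+ i _)) (binomial₁-+ k _)

  binomial-* : ∀ {n} (i : MultiIndex n) b x {m} → binomial i b (λ j → x * m j) ≈ x * binomial i b m
  binomial-* []      b x = refl
  binomial-* (k ∷ i) b x = trans (binomial₁-cong k _ (λ j → binomial-* i _ x)) (binomial₁-* k _ x)

  binomial-sum : ∀ {n} (i : MultiIndex n) b N {f : Fin N → MultiIndex n → Carrier} →
    binomial i b (λ j → sum (λ s → f s j)) ≈ sum (λ s → binomial i b (f s))
  binomial-sum i b zero    = trans (binomial-cong i b (λ j → sym (zeroˡ 0#))) (trans (binomial-* i b 0#) (zeroˡ _))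
  binomial-sum i b (suc N) {f} = trans (binomial-+ i b {f zero}) (+-congˡ (binomial-sum i b N {λ s → f (suc s)}))

  binomial-0ₘ : ∀ {n} b (m : MultiIndex n → Carrier) → binomial 0ₘ b m ≈ m 0ₘ
  binomial-0ₘ {zero}  b m = refl
  binomial-0ₘ {suc n} b m = binomial-0ₘ {n} _ (λ js → m (0 ∷ js))

  -- One more factor b_r + S_r, which commutes past the coordinates before `r` because `binomial₁`
  -- is linear.
  binomial-eₘ+ : ∀ {n} (r : Fin n) i b m →
    binomial (eₘ r +ₘ i) b m ≈ b r * binomial i b m + binomial i b (λ j → m (eₘ r +ₘ j))
  binomial-eₘ+ zero (k ∷ i) b m = trans
    (reflexive (≡.cong (λ i′ → binomial (suc k ∷ i′) b m) (+ₘ-identityˡ i)))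
    (+-congˡ (binomial₁-cong k _ (λ j → binomial-cong i _ (λ js →
      reflexive (≡.cong (λ js′ → m (suc j ∷ js′)) (≡.sym (+ₘ-identityˡ js)))))))
  binomial-eₘ+ (suc r) (k ∷ i) b m = trans (binomial₁-cong k _ (λ j → binomial-eₘ+ r i _ (λ js → m (j ∷ js))))
    (trans (binomial₁-+ k _) (+-congʳ (binomial₁-* k _ _)))

  binomial-absorb : ∀ {n} (s : Fin n) i b m →
    binomial i b (λ j → (lookup j s · 1#) * m (decrement s j)) ≈ (lookup i s · 1#) * binomial (decrement s i) b m
  binomial-absorb zero (k ∷ i) b m = trans (binomial₁-cong k _ (λ j → binomial-* i _ (j · 1#)))
    (binomial₁-absorb k _ (λ j → binomial i _ (λ js → m (j ∷ js))))
  binomial-absorb (suc s) (k ∷ i) b m = trans (binomial₁-cong k _ (λ j → binomial-absorb s i _ (λ js → m (j ∷ js))))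
    (binomial₁-* k _ _)

  -- The three-term recurrence of the Hermite polynomials in b = x S⁻¹ and M = S⁻¹.
  record IsHermiteFamily {n} (b : Fin n → Carrier) (M : Fin n → Fin n → Carrier) (P : MultiIndex n → Carrier) :
      Set (k ⊔ ℓ) where
    field
      base : P 0ₘ ≈ 1#
      step : ∀ r i → P (eₘ r +ₘ i) ≈ b r * P i - sum (λ s → M r s * ((lookup i s · 1#) * P (decrement s i)))

  -- The extra factor b_r + S_r gives the term b_r P_i and the shifted moments. The moment
  -- recurrence rewrites the latter, and `binomial-absorb` moves the factors j_s outside as i_s.
  binomial-isHermiteFamily : ∀ {n} (b : Fin n → Carrier) M m → m 0ₘ ≈ 1# →
    (∀ r i → m (eₘ r +ₘ i) ≈ - sum (λ s → M r s * ((lookup i s · 1#) * m (decrement s i)))) →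
    IsHermiteFamily b M (λ i → binomial i b m)
  binomial-isHermiteFamily {n} b M m m0 mstep = record
    { base = trans (binomial-0ₘ b m) m0
    ; step = λ r i → trans (binomial-eₘ+ r i b m) (+-congˡ (begin
        binomial i b (λ j → m (eₘ r +ₘ j))
          ≈⟨ binomial-cong i b (λ j → trans (mstep r j) (solve 1 (λ x → :- x := :- :1 :* x) refl _)) ⟩
        binomial i b (λ j → - 1# * sum (λ s → M r s * ((lookup j s · 1#) * m (decrement s j))))
          ≈⟨ binomial-* i b (- 1#) ⟩
        - 1# * binomial i b (λ j → sum (λ s → M r s * ((lookup j s · 1#) * m (decrement s j))))
          ≈⟨ solve 1 (λ x → :- :1 :* x := :- x) refl _ ⟩
        - binomial i b (λ j → sum (λ s → M r s * ((lookup j s · 1#) * m (decrement s j))))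
          ≈⟨ -‿cong (trans (binomial-sum i b n) (sum-cong n (λ s → trans (binomial-* i b (M r s))
               (*-congˡ (binomial-absorb s i b m))))) ⟩
        - sum (λ s → M r s * ((lookup i s · 1#) * binomial (decrement s i) b m))
          ∎)) }

  zero⊎∃eₘ+ : ∀ {n} (i : MultiIndex n) → i ≡ 0ₘ ⊎ ∃ λ r → ∃ λ u → i ≡ eₘ r +ₘ u
  zero⊎∃eₘ+ []           = inj₁ ≡.refl
  zero⊎∃eₘ+ (suc k ∷ i)  = inj₂ (zero , k ∷ i , ≡.cong (suc k ∷_) (≡.sym (+ₘ-identityˡ i)))
  zero⊎∃eₘ+ (zero ∷ i) with zero⊎∃eₘ+ i
  ... | inj₁ ≡.refl           = inj₁ ≡.refl
  ... | inj₂ (r , u , ≡.refl) = inj₂ (suc r , zero ∷ u , ≡.refl)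

  -- The recurrence reaches down by one and by two degrees, so the step may assume `Q` at `i` and at
  -- every i - e_s.
  degree-induction : ∀ {n p} (Q : MultiIndex n → Set p) → Q 0ₘ →
    (∀ r i → Q i → (∀ s u → i ≡ eₘ s +ₘ u → Q u) → Q (eₘ r +ₘ i)) → ∀ i → Q i
  degree-induction {n} Q base step i = go (degree i) i ℕ.≤-refl
    where
    go : ∀ d i → degree i ℕ.≤ d → Q i
    go d i i≤d with zero⊎∃eₘ+ i
    go d       i i≤d | inj₁ ≡.refl = base
    go zero    i i≤d | inj₂ (r , u , ≡.refl) with () ← ≡.subst (ℕ._≤ 0) (degree-eₘ+ r u) i≤d
    go (suc d) i i≤d | inj₂ (r , u , ≡.refl) = step r u (go d u u≤d) λ s w u≡ →
      go d w (ℕ.≤-trans (ℕ.n≤1+n _) (≡.subst (ℕ._≤ d) (≡.trans (≡.cong degree u≡) (degree-eₘ+ s w)) u≤d))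
      where
      u≤d : degree u ℕ.≤ d
      u≤d = ℕ.≤-pred (≡.subst (ℕ._≤ suc d) (degree-eₘ+ r u) i≤d)

  -- The junk value of decrement at a zero entry is multiplied by that entry.
  lookup*decrement-cong : ∀ {n} {f g : MultiIndex n → Carrier} (s : Fin n) i → (∀ u → i ≡ eₘ s +ₘ u → f u ≈ g u) →
    (lookup i s · 1#) * f (decrement s i) ≈ (lookup i s · 1#) * g (decrement s i)
  lookup*decrement-cong {f = f} {g} s i f≈g with zero⊎eₘ+ s i
  ... | inj₁ p = trans (*-congʳ (reflexive (≡.cong (_· 1#) p))) (trans (zeroˡ _)
    (sym (trans (*-congʳ (reflexive (≡.cong (_· 1#) p))) (zeroˡ _))))
  ... | inj₂ (u , ≡.refl) = *-congˡ (trans (reflexive (≡.cong f (decrement-eₘ+ s u)))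
    (trans (f≈g u ≡.refl) (reflexive (≡.cong g (≡.sym (decrement-eₘ+ s u))))))

  -- Allowing `b` and `M` to vary up to equality makes this a congruence rule as well: it shows that
  -- the polynomials depend on `x` only pointwise.
  hermiteFamily-unique : ∀ {n} {b b′ : Fin n → Carrier} {M M′ P P′} → (∀ r → b r ≈ b′ r) → (∀ r s → M r s ≈ M′ r s) →
    IsHermiteFamily b M P → IsHermiteFamily b′ M′ P′ → ∀ i → P i ≈ P′ i
  hermiteFamily-unique {n} {P = P} {P′} b≈ M≈ F F′ = degree-induction (λ i → P i ≈ P′ i)
    (trans F.base (sym F′.base)) λ r i IH IH′ → trans (F.step r i) (trans
      (+-cong (*-cong (b≈ r) IH) (-‿cong (sum-cong n (λ s → *-cong (M≈ r s) (lookup*decrement-cong s i (IH′ s))))))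
      (sym (F′.step r i)))
    where
    module F  = IsHermiteFamily F
    module F′ = IsHermiteFamily F′

  eₘ-sym : ∀ {n} (p q : Fin n) → lookup (eₘ p) q ≡ lookup (eₘ q) p
  eₘ-sym zero    zero    = ≡.refl
  eₘ-sym zero    (suc q) = lookup-0ₘ q
  eₘ-sym (suc p) zero    = ≡.sym (lookup-0ₘ p)
  eₘ-sym (suc p) (suc q) = eₘ-sym p q

  -- For q ≠ s the decrements touch different entries and commute; for q = s both sides coincide.
  decrement-comm : ∀ {n} (P : MultiIndex n → Carrier) q s i →
    (lookup i q · 1#) * ((lookup (decrement q i) s · 1#) * P (decrement s (decrement q i)))
      ≈ (lookup i s · 1#) * ((lookup (decrement s i) q · 1#) * P (decrement q (decrement s i)))
  decrement-comm P q s i with q Fin.≟ s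
  ... | yes ≡.refl = refl
  ... | no  q≢s = begin
    (lookup i q · 1#) * ((lookup (decrement q i) s · 1#) * P (decrement s (decrement q i)))
      ≡⟨ ≡.cong₂ (λ m j → (lookup i q · 1#) * ((m · 1#) * P j)) (Vec.lookup∘updateAt′ s q (λ s≡q → q≢s (≡.sym s≡q)) i)
           (Vec.updateAt-commutes s q (λ s≡q → q≢s (≡.sym s≡q)) i) ⟩
    (lookup i q · 1#) * ((lookup i s · 1#) * P (decrement q (decrement s i)))
      ≈⟨ solve 3 (λ x y z → x :* (y :* z) := y :* (x :* z)) refl _ _ _ ⟩
    (lookup i s · 1#) * ((lookup i q · 1#) * P (decrement q (decrement s i)))
      ≡⟨ ≡.cong (λ m → (lookup i s · 1#) * ((m · 1#) * P (decrement q (decrement s i)))) (Vec.lookup∘updateAt′ q s q≢s i) ⟨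
    (lookup i s · 1#) * ((lookup (decrement s i) q · 1#) * P (decrement q (decrement s i))) ∎

  module HermiteDerivative {n} {b : Fin n → Carrier} {M P} (F : IsHermiteFamily b M P) where

    open IsHermiteFamily F

    -- The value of ∂ₚ Pᵢ, since ∂ₚ bₛ = M p s.
    derivative : Fin n → MultiIndex n → Carrier
    derivative p i = sum (λ s → M p s * ((lookup i s · 1#) * P (decrement s i)))

    derivative-0ₘ : ∀ p → derivative p 0ₘ ≈ 0#
    derivative-0ₘ p = sum-0 n (λ s → trans (*-congˡ (trans (*-congʳ (reflexive (≡.cong (_· 1#) (lookup-0ₘ s)))) (zeroˡ _))) (zeroʳ _))

    private
      δ-part : ∀ p r i → sum (λ q → M p q * ((lookup (eₘ r) q · 1#) * P (decrement q (eₘ r +ₘ i)))) ≈ M p r * P i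
      δ-part p r i = begin
        sum (λ q → M p q * ((lookup (eₘ r) q · 1#) * P (decrement q (eₘ r +ₘ i))))
          ≈⟨ sum-cong n (λ q → trans (solve 3 (λ x y z → x :* (y :* z) := y :* (x :* z)) refl _ _ _)
               (*-congʳ (reflexive (≡.cong (_· 1#) (eₘ-sym r q))))) ⟩
        sum (λ q → (lookup (eₘ q) r · 1#) * (M p q * P (decrement q (eₘ r +ₘ i))))
          ≈⟨ sum-δ r (λ q → M p q * P (decrement q (eₘ r +ₘ i))) ⟩
        M p r * P (decrement r (eₘ r +ₘ i))
          ≡⟨ ≡.cong (λ j → M p r * P j) (decrement-eₘ+ r i) ⟩
        M p r * P i ∎

      -- With i_q = 0 and q = r the two arguments of `P` would differ, since decrementing would take
      -- away the unit added by e_r. The factor i_q removes that case.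
      shifted : ∀ q r i → (lookup i q · 1#) * P (decrement q (eₘ r +ₘ i)) ≈ (lookup i q · 1#) * P (eₘ r +ₘ decrement q i)
      shifted q r i with zero⊎eₘ+ q i
      ... | inj₁ iq≡0 = trans (*-congʳ zero≈) (trans (zeroˡ _) (sym (trans (*-congʳ zero≈) (zeroˡ _))))
        where zero≈ = reflexive (≡.cong (_· 1#) iq≡0)
      ... | inj₂ (u , ≡.refl) = *-congˡ (reflexive (≡.cong P (≡.trans
        (≡.trans (≡.cong (decrement q) (≡.trans (≡.sym (+ₘ-assoc (eₘ r) (eₘ q) u))
          (≡.trans (≡.cong (_+ₘ u) (+ₘ-comm (eₘ r) (eₘ q))) (+ₘ-assoc (eₘ q) (eₘ r) u)))) (decrement-eₘ+ q (eₘ r +ₘ u)))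
        (≡.cong (eₘ r +ₘ_) (≡.sym (decrement-eₘ+ q u))))))

      -- The recurrence at i - e_q produces a double sum over the lowered indices `q` and `s`.
      -- Exchanging them swaps the roles of `p` and `r`.
      recurrence-part : ∀ p r i → sum (λ q → M p q * ((lookup i q · 1#) * P (decrement q (eₘ r +ₘ i))))
        ≈ b r * derivative p i - sum (λ s → M r s * ((lookup i s · 1#) * derivative p (decrement s i)))
      recurrence-part p r i = begin
        sum (λ q → M p q * ((lookup i q · 1#) * P (decrement q (eₘ r +ₘ i))))
          ≈⟨ sum-cong n (λ q → trans (*-congˡ (trans (shifted q r i) (*-congˡ (step r (decrement q i)))))
               (solve 5 (λ m l b x y → m :* (l :* (b :* x :- y)) := b :* (m :* (l :* x)) :+ :- :1 :* (m :* (l :* y))) refl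
                 (M p q) (lookup i q · 1#) (b r) (P (decrement q i)) (derivative r (decrement q i)))) ⟩
        sum (λ q → b r * (M p q * ((lookup i q · 1#) * P (decrement q i))) + - 1# * (M p q * ((lookup i q · 1#) * derivative r (decrement q i))))
          ≈⟨ sum-+ n ⟩
        sum (λ q → b r * (M p q * ((lookup i q · 1#) * P (decrement q i)))) + sum (λ q → - 1# * (M p q * ((lookup i q · 1#) * derivative r (decrement q i))))
          ≈⟨ +-cong (sum-distribˡ n (b r)) (sum-distribˡ n (- 1#)) ⟨
        b r * derivative p i + - 1# * sum (λ q → M p q * ((lookup i q · 1#) * derivative r (decrement q i)))
          ≈⟨ +-congˡ (trans (solve 1 (λ x → :- :1 :* x := :- x) refl _) (-‿cong exchange)) ⟩
        b r * derivative p i - sum (λ s → M r s * ((lookup i s · 1#) * derivative p (decrement s i))) ∎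
        where
        inner : Fin n → Fin n → Carrier
        inner q s = (lookup i q · 1#) * ((lookup (decrement q i) s · 1#) * P (decrement s (decrement q i)))
        expand : ∀ p r → sum (λ q → M p q * ((lookup i q · 1#) * derivative r (decrement q i)))
          ≈ sum (λ q → sum (λ s → (M p q * M r s) * inner q s))
        expand p r = sum-cong n (λ q → trans (*-congˡ (sum-distribˡ n (lookup i q · 1#))) (trans (sum-distribˡ n (M p q))
          (sum-cong n (λ s → solve 4 (λ m l m′ x → m :* (l :* (m′ :* x)) := (m :* m′) :* (l :* x)) refl (M p q) (lookup i q · 1#) (M r s) _))))
        exchange : sum (λ q → M p q * ((lookup i q · 1#) * derivative r (decrement q i)))
          ≈ sum (λ s → M r s * ((lookup i s · 1#) * derivative p (decrement s i)))
        exchange = begin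
          sum (λ q → M p q * ((lookup i q · 1#) * derivative r (decrement q i)))  ≈⟨ expand p r ⟩
          sum (λ q → sum (λ s → (M p q * M r s) * inner q s))                     ≈⟨ ∑-comm {n} {n} (λ q s → (M p q * M r s) * inner q s) ⟩
          sum (λ s → sum (λ q → (M p q * M r s) * inner q s))
            ≈⟨ sum-cong n (λ s → sum-cong n (λ q → *-cong (*-comm (M p q) (M r s)) (decrement-comm P q s i))) ⟩
          sum (λ s → sum (λ q → (M r s * M p q) * inner s q))                     ≈⟨ expand r p ⟨
          sum (λ s → M r s * ((lookup i s · 1#) * derivative p (decrement s i)))  ∎

    -- This is the recurrence differentiated by the product rule, with ∂ₚ b_r = M p r, but as a
    -- purely algebraic identity. The entry (e_r + i)_q = δ_rq + i_q splits the sum: the delta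
    -- yields M p r P_i, the rest is `recurrence-part`.
    derivative-eₘ+ : ∀ p r i → derivative p (eₘ r +ₘ i)
      ≈ M p r * P i + (b r * derivative p i - sum (λ s → M r s * ((lookup i s · 1#) * derivative p (decrement s i))))
    derivative-eₘ+ p r i = begin
      derivative p (eₘ r +ₘ i)
        ≈⟨ sum-cong n (λ q → trans (*-congˡ (*-congʳ (trans (reflexive (≡.cong (_· 1#) (lookup-+ₘ q (eₘ r) i)))
             (×-homo-+ 1# (lookup (eₘ r) q) _))))
             (solve 4 (λ m x y z → m :* ((x :+ y) :* z) := m :* (x :* z) :+ m :* (y :* z)) refl (M p q) _ _ _)) ⟩
      sum (λ q → M p q * ((lookup (eₘ r) q · 1#) * P (decrement q (eₘ r +ₘ i))) + M p q * ((lookup i q · 1#) * P (decrement q (eₘ r +ₘ i))))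
        ≈⟨ sum-+ n ⟩
      sum (λ q → M p q * ((lookup (eₘ r) q · 1#) * P (decrement q (eₘ r +ₘ i)))) + sum (λ q → M p q * ((lookup i q · 1#) * P (decrement q (eₘ r +ₘ i))))
        ≈⟨ +-cong (δ-part p r i) (recurrence-part p r i) ⟩
      M p r * P i + (b r * derivative p i - sum (λ s → M r s * ((lookup i s · 1#) * derivative p (decrement s i)))) ∎

-- Estimates for limits, series and the exponential

module Exponential {c ℓ₁ ℓ₂} (ℝ : RealField c ℓ₁ ℓ₂) where

  open RealField ℝ hiding (zero)
  open RealAnalysis ℝ
  open CommutativeRing commutativeRing using (ring)
  open IntegerRingSolver commutativeRing using (solve; _:=_; _:*_; _:+_; :-_; _:-_; :1; :0)
  open import Algebra.Properties.Ring ring using (-0#≈0#; -‿involutive)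

  private variable
    x y z u v ε : Carrier

  ≤-≈ : x ≤ y → y ≈ z → x ≤ z
  ≤-≈ p q = ≤-trans p (≤-reflexive q)

  ≈-≤ : x ≈ y → y ≤ z → x ≤ z
  ≈-≤ p q = ≤-trans (≤-reflexive p) q

  <-≈ : x < y → y ≈ z → x < z
  <-≈ p q = <.<-respʳ-≈ q p

  ≈-< : x ≈ y → y < z → x < z
  ≈-< p q = <.<-respˡ-≈ (sym p) q

  -- `≤` negates the strict order, so both ways of being apart are excluded, and apartness is tight.
  ≤-antisym : x ≤ y → y ≤ x → x ≈ y
  ≤-antisym p q = proj₁ (tight _ _) λ x#y → [ q , p ]′ (#⇒<⊎> x#y)

  0≤y-x⇒x≤y : 0# ≤ y - x → x ≤ y
  0≤y-x⇒x≤y {y} {x} p = ≈-≤ (sym (+-identityˡ x)) (≤-≈ (+-monoˡ-≤ x p)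
    (solve 2 (λ x y → y :- x :+ x := y) refl x y))

  x≤y⇒0≤y-x : x ≤ y → 0# ≤ y - x
  x≤y⇒0≤y-x {x} {y} p = ≈-≤ (sym (-‿inverseʳ x)) (+-monoˡ-≤ (- x) p)

  x<y⇒0<y-x : x < y → 0# < y - x
  x<y⇒0<y-x {x} p = ≈-< (sym (-‿inverseʳ x)) (+-monoˡ-< (- x) p)

  +-nonneg : 0# ≤ x → 0# ≤ y → 0# ≤ x + y
  +-nonneg p q = ≈-≤ (sym (+-identityˡ 0#)) (+-mono-≤ p q)

  *-monoˡ-≤ : 0# ≤ z → x ≤ y → z * x ≤ z * y
  *-monoˡ-≤ {z} {x} {y} p q = ≈-≤ (*-comm z x) (≤-≈ (*-monoʳ-≤ p q) (*-comm y z))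

  *-monoʳ-< : 0# < z → x < y → x * z < y * z
  *-monoʳ-< {z} {x} {y} 0<z x<y = ≈-< (sym (+-identityˡ _)) (<-≈
    (+-monoˡ-< (x * z) (*-pos (x<y⇒0<y-x x<y) 0<z))
    (solve 3 (λ x y z → (y :- x) :* z :+ x :* z := y :* z) refl x y z))

  0≤x*x : 0# ≤ x * x
  0≤x*x {x} xx<0 with #⇒<⊎> (product-#0ˡ (<⇒# xx<0))
  ... | inj₁ x<0 = <⇒≤ xx<0 (<-≈ (*-pos (neg-flip x<0) (neg-flip x<0)) (solve 1 (λ x → :- x :* :- x := x :* x) refl x))
  ... | inj₂ 0<x = <⇒≤ xx<0 (*-pos 0<x 0<x)

  ∣∣-nonneg : 0# ≤ x → ∣ x ∣ ≤ x
  ∣∣-nonneg {x} p = ∣∣-least ≤-refl (≤-trans (≈-≤ (sym (+-identityˡ (- x))) (≤-≈ (+-monoˡ-≤ (- x) p) (-‿inverseʳ x))) p)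

  ∣x∣≤u⇒0≤u-x : ∣ x ∣ ≤ u → 0# ≤ u - x
  ∣x∣≤u⇒0≤u-x p = x≤y⇒0≤y-x (≤-trans x≤∣x∣ p)

  ∣x∣≤u⇒0≤u+x : ∣ x ∣ ≤ u → 0# ≤ u + x
  ∣x∣≤u⇒0≤u+x {x} p = ≤-≈ (x≤y⇒0≤y-x (≤-trans -x≤∣x∣ p)) (+-congˡ (-‿involutive x))

  -- u v ∓ x y is the half sum of two products of the nonnegative u ± x and v ± y.
  ∣∣-* : ∣ x ∣ ≤ u → ∣ y ∣ ≤ v → ∣ x * y ∣ ≤ u * v
  ∣∣-* {x} {u} {y} {v} p q = ∣∣-least
    (double-cancel-≤ (0≤y-x⇒x≤y (≤-≈
      (+-nonneg (*-nonneg (∣x∣≤u⇒0≤u-x p) (∣x∣≤u⇒0≤u+x q)) (*-nonneg (∣x∣≤u⇒0≤u+x p) (∣x∣≤u⇒0≤u-x q)))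
      (solve 4 (λ x u y v → (u :- x) :* (v :+ y) :+ (u :+ x) :* (v :- y) := (u :* v :+ u :* v) :- (x :* y :+ x :* y)) refl x u y v))))
    (double-cancel-≤ (0≤y-x⇒x≤y (≤-≈
      (+-nonneg (*-nonneg (∣x∣≤u⇒0≤u-x p) (∣x∣≤u⇒0≤u-x q)) (*-nonneg (∣x∣≤u⇒0≤u+x p) (∣x∣≤u⇒0≤u+x q)))
      (solve 4 (λ x u y v → (u :- x) :* (v :- y) :+ (u :+ x) :* (v :+ y) := (u :* v :+ u :* v) :- (:- (x :* y) :+ :- (x :* y))) refl x u y v))))

  ∣∣-+ : ∣ x ∣ ≤ u → ∣ y ∣ ≤ v → ∣ x + y ∣ ≤ u + v
  ∣∣-+ p q = ≤-trans triangle (+-mono-≤ p q)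

  ∣∣-neg : ∣ x ∣ ≤ u → ∣ - x ∣ ≤ u
  ∣∣-neg = ≤-trans ∣-x∣≤∣x∣

  ∣∣-≈ : x ≈ y → ∣ y ∣ ≤ u → ∣ x ∣ ≤ u
  ∣∣-≈ p = ≤-trans (∣∣-resp p)

  ∣0∣≤ : 0# ≤ u → ∣ 0# ∣ ≤ u
  ∣0∣≤ = ≤-trans (∣∣-nonneg ≤-refl)

  ½-pos : 0# < ½
  ½-pos = 1/-pos 2

  half-pos : 0# < ε → 0# < ½ * ε
  half-pos = *-pos ½-pos

  half-< : 0# < ε → ½ * ε < ε
  half-< {ε} 0<ε = ≈-< (sym (+-identityˡ _)) (<-≈ (+-monoˡ-< (½ * ε) (half-pos 0<ε)) ½+½)

  small⇒≤0 : (∀ {ε} → 0# < ε → x ≤ ε) → x ≤ 0#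
  small⇒≤0 p 0<x = p (half-pos 0<x) (half-< 0<x)

  ∣x∣≤0⇒x≈0 : ∣ x ∣ ≤ 0# → x ≈ 0#
  ∣x∣≤0⇒x≈0 {x} p = ≤-antisym (≤-trans x≤∣x∣ p)
    (≤-≈ (∣x∣≤u⇒0≤u+x p) (+-identityˡ x))

  x-y≈0⇒x≈y : x - y ≈ 0# → x ≈ y
  x-y≈0⇒x≈y {x} {y} p = trans (solve 2 (λ x y → x := (x :- y) :+ y) refl x y) (trans (+-congʳ p) (+-identityˡ y))

  limit-≤ : ∀ {s l u} → s ⟶ l → (∀ n → s n ≤ u) → l ≤ u
  limit-≤ {s} {l} {u} s→l s≤u u<l with s→l (x<y⇒0<y-x u<l)
  ... | N , close = <.irrefl refl (<-≤-trans u<s (s≤u N))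
    where
    l-s<l-u : l - s N < l - u
    l-s<l-u = ≤-<-trans (≈-≤ (solve 2 (λ l s → l :- s := :- (s :- l)) refl l (s N)) -x≤∣x∣) (close ℕ.≤-refl)
    u<s : u < s N
    u<s = ≈-< (solve 3 (λ l s u → u := (l :- s) :+ (u :+ (s :- l))) refl l (s N) u) (<-≈
      (+-monoˡ-< (u + (s N - l)) l-s<l-u) (solve 3 (λ l s u → (l :- u) :+ (u :+ (s :- l)) := s) refl l (s N) u))

  limit-cong : ∀ {s t l} → (∀ n → s n ≈ t n) → s ⟶ l → t ⟶ l
  limit-cong s≈t s→l 0<ε with s→l 0<ε
  ... | N , close = N , λ n≥N → ≤-<-trans (∣∣-resp (+-congʳ (sym (s≈t _)))) (close n≥N)

  limit-unshift : ∀ {s l} → (λ n → s (suc n)) ⟶ l → s ⟶ l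
  limit-unshift s→l 0<ε with s→l 0<ε
  ... | N , close = suc N , λ { (ℕ.s≤s n≥N) → close n≥N }

  limit-+ : ∀ {s t l m} → s ⟶ l → t ⟶ m → (λ n → s n + t n) ⟶ (l + m)
  limit-+ {s} {t} {l} {m} s→l t→m 0<ε with s→l (half-pos 0<ε) | t→m (half-pos 0<ε)
  ... | N , close | N′ , close′ = N ℕ.+ N′ , λ {n} n≥ → ≤-<-trans
    (≤-trans (∣∣-resp (solve 4 (λ s t l m → (s :+ t) :- (l :+ m) := (s :- l) :+ (t :- m)) refl (s n) (t n) l m)) triangle)
    (<-≈ (+-mono-< (close (ℕ.≤-trans (ℕ.m≤m+n N N′) n≥)) (close′ (ℕ.≤-trans (ℕ.m≤n+m N′ N) n≥))) ½+½)

  pos-inverse∃ : 0# < x → ∃[ y ] (0# < y × y * x ≈ 1#)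
  pos-inverse∃ 0<x with inverse (pos⇒#0 0<x)
  ... | y , yx≈1 = y , pos-inverse 0<x yx≈1 , yx≈1

  0<∣x∣+1 : 0# < ∣ x ∣ + 1#
  0<∣x∣+1 = ≤-<-trans (≈-≤ (sym (+-identityʳ 0#)) (+-monoˡ-≤ 0# 0≤∣x∣))
    (<-≈ (≈-< (+-comm _ _) (+-monoˡ-< _ 0<1)) (+-comm _ _))

  -- The tolerance is divided by ∣k∣ + 1, which is positive without deciding whether `k` is 0.
  limit-* : ∀ {s l} k → s ⟶ l → (λ n → k * s n) ⟶ (k * l)
  limit-* {s} {l} k s→l {ε} 0<ε with pos-inverse∃ (0<∣x∣+1 {k})
  ... | w , 0<w , w∣k∣≈1 with s→l (*-pos 0<w 0<ε)
  ... | N , close = N , λ {n} n≥N → ≤-<-trans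
    (≤-trans (∣∣-resp (solve 3 (λ k s l → k :* s :- k :* l := k :* (s :- l)) refl k (s n) l))
      (≤-trans (∣∣-* (∣k∣≤ k) ≤-refl) (≤-reflexive (*-comm _ _))))
    (<-≈ (*-monoʳ-< (0<∣x∣+1 {k}) (close n≥N))
      (trans (solve 3 (λ w e k → w :* e :* k := w :* k :* e) refl w ε _) (trans (*-congʳ w∣k∣≈1) (*-identityˡ ε))))
    where
    ∣k∣≤ : ∀ k → ∣ k ∣ ≤ ∣ k ∣ + 1#
    ∣k∣≤ k = ≈-≤ (sym (+-identityʳ _)) (+-monoʳ-≤ _ (<⇒≤ 0<1))

  limit-∣∣≤ : ∀ {s l u} → s ⟶ l → (∀ n → ∣ s n ∣ ≤ u) → ∣ l ∣ ≤ u
  limit-∣∣≤ {s} {l} s→l ∣s∣≤u = ∣∣-least (limit-≤ s→l (λ n → ≤-trans x≤∣x∣ (∣s∣≤u n)))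
    (≈-≤ (solve 1 (λ x → :- x := :- :1 :* x) refl l) (limit-≤ (limit-* (- 1#) s→l)
      (λ n → ≈-≤ (solve 1 (λ x → :- :1 :* x := :- x) refl (s n)) (≤-trans -x≤∣x∣ (∣s∣≤u n)))))

  limit-unique : ∀ {s l m} → s ⟶ l → s ⟶ m → l ≈ m
  limit-unique {s} {l} {m} s→l s→m = x-y≈0⇒x≈y (∣x∣≤0⇒x≈0
    (∣∣-≈ (solve 2 (λ l m → l :- m := l :+ :- :1 :* m) refl l m) (limit-∣∣≤ (limit-+ s→l (limit-* (- 1#) s→m))
      (λ n → ∣∣-≈ (solve 1 (λ x → x :+ :- :1 :* x := :0) refl (s n)) (∣0∣≤ ≤-refl)))))

  series-cong : ∀ {s t} → (∀ n → s n ≈ t n) → ∀ N → series s N ≈ series t N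
  series-cong s≈t zero    = refl
  series-cong s≈t (suc N) = +-cong (series-cong s≈t N) (s≈t N)

  series-+ : ∀ s t N → series (λ n → s n + t n) N ≈ series s N + series t N
  series-+ s t zero    = sym (+-identityˡ 0#)
  series-+ s t (suc N) = trans (+-congʳ (series-+ s t N))
    (solve 4 (λ a b x y → a :+ b :+ (x :+ y) := a :+ x :+ (b :+ y)) refl _ _ (s N) (t N))

  series-* : ∀ k t N → series (λ n → k * t n) N ≈ k * series t N
  series-* k t zero    = sym (zeroʳ k)
  series-* k t (suc N) = trans (+-congʳ (series-* k t N)) (sym (distribˡ k _ _))

  series-∣∣≤ : ∀ {s t} → (∀ n → ∣ s n ∣ ≤ t n) → ∀ N → ∣ series s N ∣ ≤ series t N
  series-∣∣≤ ∣s∣≤t zero    = ∣0∣≤ ≤-refl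
  series-∣∣≤ ∣s∣≤t (suc N) = ∣∣-+ (series-∣∣≤ ∣s∣≤t N) (∣s∣≤t N)

  series-≤-limit : ∀ {t l} → (∀ n → 0# ≤ t n) → series t ⟶ l → ∀ N → series t N ≤ l
  series-≤-limit {t} {l} 0≤t t→l N l<S with t→l (x<y⇒0<y-x l<S)
  ... | N′ , close = ≤-trans (+-monoˡ-≤ (- l) (mono N′)) x≤∣x∣ (close (ℕ.m≤m+n N′ N))
    where
    mono : ∀ m → series t N ≤ series t (m ℕ.+ N)
    mono zero    = ≤-refl
    mono (suc m) = ≤-trans (mono m) (≈-≤ (sym (+-identityʳ _)) (+-monoʳ-≤ _ (0≤t (m ℕ.+ N))))

  -- For `expTerm x` the n-th entry becomes xⁿ⁻¹ / (n - 1)!, the termwise derivative. The padding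
  -- zero changes no sum, so the series keeps its limit.
  previous : (ℕ → Carrier) → ℕ → Carrier
  previous t zero    = 0#
  previous t (suc n) = t n

  previous-nonneg : ∀ {t} → (∀ n → 0# ≤ t n) → ∀ n → 0# ≤ previous t n
  previous-nonneg 0≤t zero    = ≤-refl
  previous-nonneg 0≤t (suc n) = 0≤t n

  series-previous : ∀ t N → series (previous t) (suc N) ≈ series t N
  series-previous t zero    = +-identityˡ 0#
  series-previous t (suc N) = +-congʳ (series-previous t N)

  series-previous-limit : ∀ {t l} → series t ⟶ l → series (previous t) ⟶ l
  series-previous-limit {t} t→l = limit-unshift {series (previous t)} (limit-cong (λ N → sym (series-previous t N)) t→l)

  exp-limit : ∀ x → series (expTerm x) ⟶ exp x
  exp-limit x = proj₂ (complete (series (expTerm x)) (expSeries-cauchy x))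

  expTerm-cong : x ≈ y → ∀ n → expTerm x n ≈ expTerm y n
  expTerm-cong p zero    = refl
  expTerm-cong p (suc n) = *-cong (expTerm-cong p n) (*-congʳ p)

  exp-cong : x ≈ y → exp x ≈ exp y
  exp-cong {x} {y} p = limit-unique (limit-cong (series-cong (expTerm-cong p)) (exp-limit x)) (exp-limit y)

  expTerm-nonneg : 0# ≤ x → ∀ n → 0# ≤ expTerm x n
  expTerm-nonneg 0≤x zero    = <⇒≤ 0<1
  expTerm-nonneg 0≤x (suc n) = *-nonneg (expTerm-nonneg 0≤x n) (*-nonneg 0≤x (<⇒≤ (1/-pos (suc n))))

  ∣expTerm∣≤ : ∀ {M} → ∣ x ∣ ≤ M → ∀ n → ∣ expTerm x n ∣ ≤ expTerm M n
  ∣expTerm∣≤ p zero    = ∣∣-nonneg (<⇒≤ 0<1)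
  ∣expTerm∣≤ p (suc n) = ∣∣-* (∣expTerm∣≤ p n) (∣∣-* p (∣∣-nonneg (<⇒≤ (1/-pos (suc n)))))

  ∣exp∣≤ : ∀ {M} → ∣ x ∣ ≤ M → ∣ exp x ∣ ≤ exp M
  ∣exp∣≤ {x} {M} p = limit-∣∣≤ (exp-limit x) λ N → ≤-trans (series-∣∣≤ (∣expTerm∣≤ p) N)
    (series-≤-limit (expTerm-nonneg (≤-trans 0≤∣x∣ p)) (exp-limit M) N)

  expTerm-step : ∀ x n → fromℕ n * expTerm x n ≈ x * previous (expTerm x) n
  expTerm-step x zero    = trans (zeroˡ _) (sym (zeroʳ x))
  expTerm-step x (suc n) = trans
    (solve 4 (λ m t x i → m :* (t :* (x :* i)) := (i :* m) :* (x :* t)) refl (fromℕ (suc n)) (expTerm x n) x (1/ (suc n)))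
    (trans (*-congʳ (1/n*n≈1 (suc n))) (*-identityˡ _))

  module _ {M y k} (∣y∣≤M : ∣ y ∣ ≤ M) (∣w∣≤M : ∣ y + k ∣ ≤ M) where

    private
      w = y + k
      0≤M = ≤-trans 0≤∣x∣ ∣y∣≤M
      T = expTerm
      T′ T″ : Carrier → ℕ → Carrier
      T′ x = previous (T x)
      T″ x = previous (T′ x)

      error : ℕ → Carrier
      error n = T w n - T y n - k * T′ y n

      -- The first-order remainder of wⁿ / n! at `y`: passing from n to n + 1 multiplies the old
      -- error by `w` and creates a new one of size k², both divided by n + 1.
      error-suc : ∀ n → error (suc n) ≈ 1/ (suc n) * (w * error n + (k * k) * T′ y n)
      error-suc n = trans
        (+-congˡ (-‿cong (trans (sym (*-identityʳ _)) (*-congˡ (sym (1/n*n≈1 (suc n)))))))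
        (trans (solve 6 (λ a b y k i m → a :* ((y :+ k) :* i) :- b :* (y :* i) :- (k :* b) :* (i :* (:1 :+ m))
            := i :* ((y :+ k) :* a :- (y :+ k) :* b :- k :* (m :* b))) refl (T w n) (T y n) y k i (fromℕ n))
        (*-congˡ (trans (+-congˡ (-‿cong (*-congˡ (expTerm-step y n))))
          (solve 5 (λ a b y k p → (y :+ k) :* a :- (y :+ k) :* b :- k :* (y :* p)
            := (y :+ k) :* (a :- b :- k :* p) :+ (k :* k) :* p) refl (T w n) (T y n) y k (T′ y n)))))
        where i = 1/ (suc n)

      M*T″≤ : ∀ n → M * T″ M n ≤ fromℕ n * T′ M n
      M*T″≤ zero    = ≤-reflexive (trans (zeroʳ M) (sym (zeroˡ _)))
      M*T″≤ (suc n) = ≈-≤ (sym (expTerm-step M n)) (*-monoʳ-≤ (expTerm-nonneg 0≤M n) (fromℕ-mono (ℕ.n≤1+n n)))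

      ∣T′∣≤ : ∀ n → ∣ T′ y n ∣ ≤ T′ M n
      ∣T′∣≤ zero    = ∣0∣≤ ≤-refl
      ∣T′∣≤ (suc n) = ∣expTerm∣≤ ∣y∣≤M n

      ∣kk∣≤ : ∣ k * k ∣ ≤ k * k
      ∣kk∣≤ = ∣∣-nonneg 0≤x*x

      -- The bound k² Mⁿ⁻² / (n - 2)! reproduces itself. Multiplied by M it is at most n k² Mⁿ⁻¹ /
      -- (n - 1)!, the new error adds one more such term, and n + 1 cancels.
      ∣error∣≤ : ∀ n → ∣ error n ∣ ≤ (k * k) * T″ M n
      ∣error∣≤ zero    = ∣∣-≈ (solve 1 (λ k → :1 :- :1 :- k :* :0 := :0) refl k) (∣0∣≤ (≤-reflexive (sym (zeroʳ _))))
      ∣error∣≤ (suc n) = ∣∣-≈ (error-suc n) (≤-trans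
        (∣∣-* (∣∣-nonneg (<⇒≤ (1/-pos (suc n)))) (∣∣-+ (∣∣-* ∣w∣≤M (∣error∣≤ n)) (∣∣-* ∣kk∣≤ (∣T′∣≤ n))))
        (≤-trans (*-monoˡ-≤ (<⇒≤ (1/-pos (suc n))) (+-monoˡ-≤ _
          (≈-≤ (solve 3 (λ m q t → m :* (q :* t) := q :* (m :* t)) refl M (k * k) (T″ M n)) (*-monoˡ-≤ 0≤x*x (M*T″≤ n)))))
        (≤-reflexive (trans
          (solve 4 (λ i q m t → i :* (q :* (m :* t) :+ q :* t) := (i :* (:1 :+ m)) :* (q :* t)) refl (1/ (suc n)) (k * k) (fromℕ n) (T′ M n))
          (trans (*-congʳ (1/n*n≈1 (suc n))) (*-identityˡ _))))))

    -- The termwise bounds sum to at most k² exp M, since shifting the series of exp M twice leaves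
    -- its limit unchanged.
    exp-error : ∣ exp (y + k) - exp y - k * exp y ∣ ≤ exp M * (k * k)
    exp-error = ∣∣-≈ (solve 3 (λ a b k → a :- b :- k :* b := (a :+ :- :1 :* b) :+ (:- k) :* b) refl (exp w) (exp y) k)
      (limit-∣∣≤ (limit-+ (limit-+ (exp-limit w) (limit-* (- 1#) (exp-limit y)))
        (limit-* (- k) (series-previous-limit {expTerm y} (exp-limit y)))) bound)
      where
      0≤T″ : ∀ n → 0# ≤ T″ M n
      0≤T″ = previous-nonneg (previous-nonneg (expTerm-nonneg 0≤M))
      partial : ∀ N → (series (T w) N + - 1# * series (T y) N) + - k * series (T′ y) N ≈ series error N
      partial N = sym (trans (series-cong (λ n → solve 4 (λ a b k c → a :- b :- k :* c := (a :+ :- :1 :* b) :+ (:- k) :* c) refl (T w n) (T y n) k (T′ y n)) N)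
        (trans (series-+ _ _ N) (+-cong (trans (series-+ _ _ N) (+-congˡ (series-* (- 1#) _ N))) (series-* (- k) _ N))))
      bound : ∀ N → ∣ (series (T w) N + - 1# * series (T y) N) + - k * series (T′ y) N ∣ ≤ exp M * (k * k)
      bound N = ∣∣-≈ (partial N) (≤-trans (series-∣∣≤ ∣error∣≤ N) (≈-≤ (series-* (k * k) (T″ M) N)
        (≤-trans (*-monoˡ-≤ 0≤x*x (series-≤-limit 0≤T″
          (series-previous-limit {T′ M} (series-previous-limit {expTerm M} (exp-limit M))) N)) (≤-reflexive (*-comm _ _)))))

  exp-0 : exp 0# ≈ 1#
  exp-0 = limit-unique (exp-limit 0#) (limit-unshift λ {ε} 0<ε → 0 , λ {n} _ →
    ≤-<-trans (∣∣-≈ (trans (+-congʳ (go n)) (-‿inverseʳ 1#)) (∣0∣≤ ≤-refl)) 0<ε)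
    where
    go : ∀ n → series (expTerm 0#) (suc n) ≈ 1#
    go zero    = +-identityˡ 1#
    go (suc n) = trans (+-cong (go n) (trans (*-congˡ (zeroˡ _)) (zeroʳ _))) (+-identityʳ 1#)

  -- Over N equal steps from 0 to y the increments add up to at most D y² / N.
  flat⇒constant : ∀ (g : Carrier → Carrier) {y D} → (∀ {u v} → u ≈ v → g u ≈ g v) →
    (∀ {u k} → ∣ u ∣ ≤ ∣ y ∣ → ∣ k ∣ ≤ ∣ y ∣ → ∣ u + k ∣ ≤ ∣ y ∣ → ∣ g (u + k) - g u ∣ ≤ D * (k * k)) → g y ≈ g 0#
  flat⇒constant g {y} {D} g-cong flat = x-y≈0⇒x≈y (∣x∣≤0⇒x≈0 (small⇒≤0 bound))
    where
    module _ (N : ℕ) where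
      i = 1/ (suc N)
      k = y * i
      0≤i : 0# ≤ i
      0≤i = <⇒≤ (1/-pos (suc N))
      point : ∀ j → j ℕ.≤ suc N → ∣ fromℕ j * k ∣ ≤ ∣ y ∣
      point j j≤N = ≤-trans (∣∣-* {u = fromℕ (suc N)} (≤-trans (∣∣-nonneg (·-nonneg j (<⇒≤ 0<1))) (fromℕ-mono j≤N))
          (∣∣-* ≤-refl (∣∣-nonneg 0≤i)))
        (≤-reflexive (trans (solve 3 (λ m y i → m :* (y :* i) := (i :* m) :* y) refl (fromℕ (suc N)) ∣ y ∣ i)
          (trans (*-congʳ (1/n*n≈1 (suc N))) (*-identityˡ _))))
      next : ∀ j → fromℕ (suc j) * k ≈ fromℕ j * k + k
      next j = solve 2 (λ m k → (:1 :+ m) :* k := m :* k :+ k) refl (fromℕ j) k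
      first : ∣ k ∣ ≤ ∣ y ∣
      first = ∣∣-≈ (solve 1 (λ k → k := (:1 :+ :0) :* k) refl k) (point 1 (ℕ.s≤s ℕ.z≤n))
      telescope : ∀ j → j ℕ.≤ suc N → ∣ g (fromℕ j * k) - g 0# ∣ ≤ fromℕ j * (D * (k * k))
      telescope zero    _   = ∣∣-≈ (trans (+-congʳ (g-cong (zeroˡ k))) (-‿inverseʳ _)) (∣0∣≤ (≤-reflexive (sym (zeroˡ _))))
      telescope (suc j) j<N = ∣∣-≈ (trans (+-congʳ (g-cong (next j)))
          (solve 3 (λ a b c → a :- c := (a :- b) :+ (b :- c)) refl (g (fromℕ j * k + k)) (g (fromℕ j * k)) (g 0#)))
        (≤-trans (∣∣-+ (flat (point j j≤N) first (∣∣-≈ (sym (next j)) (point (suc j) j<N))) (telescope j j≤N))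
          (≤-reflexive (solve 2 (λ m x → x :+ m :* x := (:1 :+ m) :* x) refl (fromℕ j) (D * (k * k)))))
        where j≤N = ℕ.≤-trans (ℕ.n≤1+n j) j<N
      total : ∣ g y - g 0# ∣ ≤ (D * (y * y)) * i
      total = ∣∣-≈ (+-congʳ (g-cong end)) (≤-trans (telescope (suc N) ℕ.≤-refl) (≤-reflexive
        (trans (solve 4 (λ m d y i → m :* (d :* ((y :* i) :* (y :* i))) := (i :* m) :* ((d :* (y :* y)) :* i)) refl (fromℕ (suc N)) D y i)
          (trans (*-congʳ (1/n*n≈1 (suc N))) (*-identityˡ _)))))
        where
        end : y ≈ fromℕ (suc N) * k
        end = sym (trans (solve 3 (λ m y i → m :* (y :* i) := (i :* m) :* y) refl (fromℕ (suc N)) y i)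
          (trans (*-congʳ (1/n*n≈1 (suc N))) (*-identityˡ _)))
    bound : ∀ {ε} → 0# < ε → ∣ g y - g 0# ∣ ≤ ε
    bound {ε} 0<ε with archimedean (D * (y * y)) 0<ε
    -- The Archimedean `n` may be 0, so the interval is cut into n + 1 steps.
    ... | n , Dyy<nε = ≤-trans (total n) (≤-trans (*-monoʳ-≤ (0≤i n) (≤-trans (<⇒≤ Dyy<nε)
        (≈-≤ (sym (+-identityˡ _)) (+-monoˡ-≤ _ (<⇒≤ 0<ε)))))
      (≤-reflexive (trans (*-congʳ (n·ε (suc n))) (trans
        (solve 3 (λ m e i → (m :* e) :* i := (i :* m) :* e) refl (fromℕ (suc n)) ε (i n))
        (trans (*-congʳ (1/n*n≈1 (suc n))) (*-identityˡ _))))))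
      where
      n·ε : ∀ n → n · ε ≈ fromℕ n * ε
      n·ε zero    = sym (zeroˡ ε)
      n·ε (suc n) = trans (+-cong (sym (*-identityˡ ε)) (n·ε n)) (sym (distribʳ ε 1# _))

  -- Increments of exp u · exp (- u) are quadratic in the step because the linear terms cancel, so
  -- the function keeps its value at 0. This bypasses the Cauchy product of the series.
  exp-inverse : ∀ y → exp y * exp (- y) ≈ 1#
  exp-inverse y = trans (flat⇒constant g {y} {D} g-cong flat) (trans (*-cong exp-0 (trans (exp-cong -0#≈0#) exp-0)) (*-identityˡ 1#))
    where
    g : Carrier → Carrier
    g u = exp u * exp (- u)
    M = ∣ y ∣
    E = exp M
    -- One summand for each of the three terms of `identity` below, with E bounding the exponentials
    -- and M bounding the step in f - k f.
    D = E * E + E * (E + M * E) + E * E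
    g-cong : ∀ {u v} → u ≈ v → g u ≈ g v
    g-cong p = *-cong (exp-cong p) (exp-cong (-‿cong p))
    flat : ∀ {u k} → ∣ u ∣ ≤ M → ∣ k ∣ ≤ M → ∣ u + k ∣ ≤ M → ∣ g (u + k) - g u ∣ ≤ D * (k * k)
    flat {u} {k} ∣u∣≤M ∣k∣≤M ∣u+k∣≤M = ∣∣-≈ identity (≤-trans
        (∣∣-+ (∣∣-+ (∣∣-* (∣exp∣≤ ∣u+k∣≤M) ∣σ∣≤) (∣∣-* ∣ρ∣≤ (∣∣-+ ∣f∣≤ (∣∣-neg (∣∣-* ∣k∣≤M ∣f∣≤)))))
          (∣∣-* (∣∣-nonneg 0≤x*x) (∣∣-neg (∣∣-* (∣exp∣≤ ∣u∣≤M) ∣f∣≤))))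
        (≤-reflexive (solve 3 (λ e m q → e :* (e :* q) :+ (e :* q) :* (e :+ m :* e) :+ q :* (e :* e)
          := (e :* e :+ e :* (e :+ m :* e) :+ e :* e) :* q) refl E M (k * k))))
      where
      f = exp (- u)
      ρ = exp (u + k) - exp u - k * exp u
      σ = exp (- (u + k)) - f - - k * f
      ∣-u∣≤M : ∣ - u ∣ ≤ M
      ∣-u∣≤M = ∣∣-neg ∣u∣≤M
      -[u+k] : - (u + k) ≈ - u + - k
      -[u+k] = solve 2 (λ u k → :- (u :+ k) := :- u :+ :- k) refl u k
      ∣f∣≤ : ∣ f ∣ ≤ E
      ∣f∣≤ = ∣exp∣≤ ∣-u∣≤M
      ∣ρ∣≤ : ∣ ρ ∣ ≤ E * (k * k)
      ∣ρ∣≤ = exp-error ∣u∣≤M ∣u+k∣≤M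
      ∣σ∣≤ : ∣ σ ∣ ≤ E * (k * k)
      ∣σ∣≤ = ∣∣-≈ (+-congʳ (+-congʳ (exp-cong -[u+k]))) (≤-≈
        (exp-error ∣-u∣≤M (∣∣-≈ (sym -[u+k]) (∣∣-neg ∣u+k∣≤M)))
        (*-congˡ (solve 1 (λ k → :- k :* :- k := k :* k) refl k)))
      identity : g (u + k) - g u ≈ exp (u + k) * σ + ρ * (f - k * f) + (k * k) * - (exp u * f)
      identity = solve 5 (λ e e′ f f′ k → e′ :* f′ :- e :* f
        := e′ :* (f′ :- f :- :- k :* f) :+ (e′ :- e :- k :* e) :* (f :- k :* f) :+ (k :* k) :* :- (e :* f))
        refl (exp u) (exp (u + k)) f (exp (- (u + k))) k

-- Derivatives with a quadratic remainder

module Calculus {c ℓ₁ ℓ₂} (ℝ : RealField c ℓ₁ ℓ₂) where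

  open RealField ℝ hiding (zero)
  open RealAnalysis ℝ
  open Hermite ℝ using (HasDerivativeAt)
  open Exponential ℝ
  open IntegerRingSolver commutativeRing using (solve; _:=_; _:*_; _:+_; :-_; _:-_; :1; :0)

  record Bounded (u : Carrier → Carrier) : Set (c ⊔ ℓ₂) where
    constructor _,_
    field
      constant : Carrier
      estimate : ∀ h → ∣ h ∣ ≤ 1# → ∣ u h ∣ ≤ constant

  -- An O(h²) bound whose radius is fixed at 1, so that combining estimates never shrinks a
  -- neighbourhood.
  record Quadratic (u : Carrier → Carrier) : Set (c ⊔ ℓ₂) where
    constructor _,_
    field
      constant : Carrier
      estimate : ∀ h → ∣ h ∣ ≤ 1# → ∣ u h ∣ ≤ constant * (h * h)

  private variable
    f g u v : Carrier → Carrier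
    x d e : Carrier

  bounded-const : ∀ x → Bounded (λ _ → x)
  bounded-const x = ∣ x ∣ , λ _ _ → ≤-refl

  bounded-id : Bounded (λ h → h)
  bounded-id = 1# , λ _ p → p

  bounded-+ : Bounded u → Bounded v → Bounded (λ h → u h + v h)
  bounded-+ (C , p) (D , q) = C + D , λ h h≤1 → ∣∣-+ (p h h≤1) (q h h≤1)

  bounded-* : Bounded u → Bounded v → Bounded (λ h → u h * v h)
  bounded-* (C , p) (D , q) = C * D , λ h h≤1 → ∣∣-* (p h h≤1) (q h h≤1)

  bounded-cong : (∀ h → u h ≈ v h) → Bounded u → Bounded v
  bounded-cong u≈v (C , p) = C , λ h h≤1 → ∣∣-≈ (sym (u≈v h)) (p h h≤1)

  quadratic-cong : (∀ h → u h ≈ v h) → Quadratic u → Quadratic v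
  quadratic-cong u≈v (C , p) = C , λ h h≤1 → ∣∣-≈ (sym (u≈v h)) (p h h≤1)

  quadratic-0 : Quadratic (λ _ → 0#)
  quadratic-0 = 0# , λ h _ → ∣0∣≤ (≤-reflexive (sym (zeroˡ _)))

  quadratic-h² : Quadratic (λ h → h * h)
  quadratic-h² = 1# , λ h _ → ≤-trans (∣∣-nonneg 0≤x*x) (≤-reflexive (sym (*-identityˡ _)))

  quadratic-+ : Quadratic u → Quadratic v → Quadratic (λ h → u h + v h)
  quadratic-+ (C , p) (D , q) = C + D , λ h h≤1 → ≤-≈ (∣∣-+ (p h h≤1) (q h h≤1)) (sym (distribʳ _ _ _))

  quadratic-* : Bounded v → Quadratic u → Quadratic (λ h → v h * u h)
  quadratic-* (D , q) (C , p) = D * C , λ h h≤1 → ≤-≈ (∣∣-* (q h h≤1) (p h h≤1)) (sym (*-assoc _ _ _))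

  quadratic⇒bounded : Quadratic u → Bounded u
  quadratic⇒bounded (C , p) = ∣ C ∣ * (1# * 1#) , λ h h≤1 →
    ≤-trans (p h h≤1) (≤-trans x≤∣x∣ (∣∣-* ≤-refl (∣∣-* h≤1 h≤1)))

  -- One constant serves all ε here, so products and exp ∘ f need no ε-δ argument.
  record Differentiable (f : Carrier → Carrier) (x d : Carrier) : Set (c ⊔ ℓ₂) where
    constructor differentiable
    field
      remainder : Quadratic (λ h → f (x + h) - f x - d * h)

  differentiable⇒bounded-increment : Differentiable f x d → Bounded (λ h → f (x + h) - f x)
  differentiable⇒bounded-increment {f} {x} {d} (differentiable f′) = bounded-cong
    (λ h → solve 4 (λ a b d h → (a :- b :- d :* h) :+ d :* h := a :- b) refl (f (x + h)) (f x) d h)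
    (bounded-+ (quadratic⇒bounded f′) (bounded-* (bounded-const d) bounded-id))

  differentiable⇒bounded : Differentiable f x d → Bounded (λ h → f (x + h))
  differentiable⇒bounded {f} {x} {d} f′ = bounded-cong
    (λ h → solve 2 (λ a b → (a :- b) :+ b := a) refl (f (x + h)) (f x))
    (bounded-+ (differentiable⇒bounded-increment f′) (bounded-const (f x)))

  differentiable-cong : (∀ y → f y ≈ g y) → d ≈ e → Differentiable f x d → Differentiable g x e
  differentiable-cong f≈g d≈e (differentiable f′) = differentiable (quadratic-cong
    (λ h → +-cong (+-cong (f≈g _) (-‿cong (f≈g _))) (-‿cong (*-congʳ d≈e))) f′)

  differentiable-const : ∀ y → Differentiable (λ _ → y) x 0#
  differentiable-const y = differentiable (quadratic-cong (λ h → solve 2 (λ y h → :0 := y :- y :- :0 :* h) refl y h) quadratic-0)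

  differentiable-id : Differentiable (λ y → y) x 1#
  differentiable-id {x} = differentiable (quadratic-cong (λ h → solve 2 (λ x h → :0 := x :+ h :- x :- :1 :* h) refl x h) quadratic-0)

  differentiable-+ : Differentiable f x d → Differentiable g x e → Differentiable (λ y → f y + g y) x (d + e)
  differentiable-+ {f} {x} {d} {g} {e} (differentiable f′) (differentiable g′) = differentiable (quadratic-cong
    (λ h → solve 7 (λ a b p q d e h → (a :- b :- d :* h) :+ (p :- q :- e :* h) := (a :+ p) :- (b :+ q) :- (d :+ e) :* h)
      refl (f (x + h)) (f x) (g (x + h)) (g x) d e h) (quadratic-+ f′ g′))

  differentiable-* : Differentiable f x d → Differentiable g x e → Differentiable (λ y → f y * g y) x (d * g x + f x * e)
  differentiable-* {f} {x} {d} {g} {e} ⟨f⟩@(differentiable f′) (differentiable g′) = differentiable (quadratic-cong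
    (λ h → solve 7 (λ a b p q d e h →
        -- The last two summands are (f (x + h) - f x) e h, with the increment of `f` split into d h
        -- and its remainder.
        a :* (p :- q :- e :* h) :+ q :* (a :- b :- d :* h) :+ e :* d :* (h :* h) :+ e :* h :* (a :- b :- d :* h)
        := a :* p :- b :* q :- (d :* q :+ b :* e) :* h)
      refl (f (x + h)) (f x) (g (x + h)) (g x) d e h)
    (quadratic-+ (quadratic-+ (quadratic-+ (quadratic-* (differentiable⇒bounded ⟨f⟩) g′)
        (quadratic-* (bounded-const (g x)) f′))
        (quadratic-* (bounded-const (e * d)) quadratic-h²))
        (quadratic-* (bounded-* (bounded-const e) bounded-id) f′)))

  differentiable-scale : ∀ k → Differentiable f x d → Differentiable (λ y → k * f y) x (k * d)
  differentiable-scale {f} {x} {d} k f′ = differentiable-cong (λ _ → refl)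
    (solve 3 (λ k f d → :0 :* f :+ k :* d := k :* d) refl k (f x) d)
    (differentiable-* (differentiable-const k) f′)

  differentiable-sum : ∀ n {f : Fin n → Carrier → Carrier} {d : Fin n → Carrier} →
    (∀ r → Differentiable (f r) x (d r)) → Differentiable (λ y → sum (λ r → f r y)) x (sum d)
  differentiable-sum zero            f′ = differentiable-const 0#
  differentiable-sum (suc n) {f} {d} f′ = differentiable-+ (f′ zero) (differentiable-sum n (λ r → f′ (suc r)))

  -- With k the increment of `f`, the remainder is that of `exp` at step k plus exp (f x) times that
  -- of `f`. The first is O(k²), and k itself is O(h).
  differentiable-exp : Differentiable f x d → Differentiable (λ y → exp (f y)) x (d * exp (f x))
  differentiable-exp {f} {x} {d} ⟨f⟩@(differentiable f′) = differentiable (quadratic-cong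
      (λ h → trans (+-congʳ (+-congʳ (+-congʳ (exp-cong (f[x+h] h)))))
        (solve 5 (λ a b k d h → (a :- b :- k :* b) :+ b :* (k :- d :* h) := a :- b :- (d :* b) :* h)
          refl (exp (f (x + h))) (exp (f x)) (k h) d h))
      (quadratic-+ error (quadratic-* (bounded-const (exp (f x))) f′)))
    where
    k R : Carrier → Carrier
    k h = f (x + h) - f x
    R h = k h - d * h
    f[x+h] : ∀ h → f x + k h ≈ f (x + h)
    f[x+h] h = solve 2 (λ a b → b :+ (a :- b) := a) refl (f (x + h)) (f x)
    increment = differentiable⇒bounded-increment ⟨f⟩
    B = Bounded.constant increment
    k≤B = Bounded.estimate increment
    -- Bounds f x and f (x + h) for all ∣h∣ ≤ 1, as `exp-error` requires.
    M = ∣ f x ∣ + B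
    0≤B : 0# ≤ B
    0≤B = ≤-trans 0≤∣x∣ (k≤B 0# (∣0∣≤ (<⇒≤ 0<1)))
    k² : Quadratic (λ h → k h * k h)
    k² = quadratic-cong (λ h → solve 3 (λ k d h → d :* d :* (h :* h) :+ (d :* h :+ d :* h) :* (k :- d :* h) :+ (k :- d :* h) :* (k :- d :* h) := k :* k) refl (k h) d h)
      (quadratic-+ (quadratic-+ (quadratic-* (bounded-const (d * d)) quadratic-h²)
        (quadratic-* (bounded-+ (bounded-* (bounded-const d) bounded-id) (bounded-* (bounded-const d) bounded-id)) f′))
        (quadratic-* (quadratic⇒bounded f′) f′))
    error : Quadratic (λ h → exp (f x + k h) - exp (f x) - k h * exp (f x))
    error = Quadratic.constant majorant , λ h h≤1 → ≤-trans
      (exp-error (≈-≤ (sym (+-identityʳ _)) (+-monoʳ-≤ _ 0≤B)) (∣∣-+ ≤-refl (k≤B h h≤1)))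
      (≤-trans x≤∣x∣ (Quadratic.estimate majorant h h≤1))
      where
      majorant : Quadratic (λ h → exp M * (k h * k h))
      majorant = quadratic-* (bounded-const (exp M)) k²

  -- δ = ε / (∣C∣ + 1 + ε) satisfies δ ≤ 1 and (∣C∣ + 1) δ ≤ ε.
  differentiable⇒hasDerivativeAt : Differentiable f x d → HasDerivativeAt f x d
  differentiable⇒hasDerivativeAt {f} {x} {d} (differentiable (C , p)) {ε} 0<ε with pos-inverse∃ {(∣ C ∣ + 1#) + ε}
    (≈-< (sym (+-identityˡ 0#)) (+-mono-< 0<∣x∣+1 0<ε))
  ... | w , 0<w , w*≈1 = ε * w , *-pos 0<ε 0<w , λ h ∣h∣<δ → ≤-trans (p h (≤-trans (<⇒≤ ∣h∣<δ) δ≤1)) (≤-trans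
      (≤-trans x≤∣x∣ (∣∣-* {u = ∣ C ∣ + 1#} (≈-≤ (sym (+-identityʳ _)) (+-monoʳ-≤ _ (<⇒≤ 0<1))) (∣∣-* ≤-refl ≤-refl)))
      (≈-≤ (sym (*-assoc _ _ _)) (*-monoʳ-≤ 0≤∣x∣ (≤-trans (*-monoˡ-≤ (<⇒≤ 0<∣x∣+1) (<⇒≤ ∣h∣<δ)) Cδ≤ε))))
    where
    δ≤1 : ε * w ≤ 1#
    δ≤1 = ≤-trans (*-monoʳ-≤ (<⇒≤ 0<w) (≈-≤ (sym (+-identityˡ ε)) (+-monoˡ-≤ ε (<⇒≤ 0<∣x∣+1))))
      (≤-reflexive (trans (*-comm _ _) w*≈1))
    Cδ≤ε : (∣ C ∣ + 1#) * (ε * w) ≤ ε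
    Cδ≤ε = ≤-trans (*-monoʳ-≤ (<⇒≤ (*-pos 0<ε 0<w)) (≈-≤ (sym (+-identityʳ _)) (+-monoʳ-≤ _ (<⇒≤ 0<ε))))
      (≤-reflexive (trans (solve 3 (λ s e w → s :* (e :* w) := (w :* s) :* e) refl _ ε w) (trans (*-congʳ w*≈1) (*-identityˡ ε))))

  -- The witness d e / (d + e) lies strictly below both numbers without comparing them.
  common-positive : 0# < d → 0# < e → ∃[ h ] (0# < h × h < d × h < e)
  common-positive {d} {e} 0<d 0<e with pos-inverse∃ {d + e} (≈-< (sym (+-identityˡ 0#)) (+-mono-< 0<d 0<e))
  ... | w , 0<w , w[d+e]≈1 = d * (e * w) , *-pos 0<d (*-pos 0<e 0<w) ,
      ≈-< (*-comm d (e * w)) (<-≈ (*-monoʳ-< 0<d ew<1) (*-identityˡ d)) ,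
      ≈-< (solve 3 (λ d e w → d :* (e :* w) := (d :* w) :* e) refl d e w) (<-≈ (*-monoʳ-< 0<e dw<1) (*-identityˡ e))
    where
    ew<1 : e * w < 1#
    ew<1 = <-≈ (*-monoʳ-< 0<w (≈-< (sym (+-identityˡ e)) (+-monoˡ-< e 0<d))) (trans (*-comm _ _) w[d+e]≈1)
    dw<1 : d * w < 1#
    dw<1 = <-≈ (*-monoʳ-< 0<w (≈-< (sym (+-identityˡ d)) (<-≈ (+-monoˡ-< d 0<e) (+-comm e d)))) (trans (*-comm _ _) w[d+e]≈1)

  -- One positive `h` within both tolerances gives ∣d - e∣ h ≤ ε h. Two pointwise equal functions
  -- are allowed because iterated partials are chosen independently.
  derivative-unique : (∀ y → f y ≈ g y) → HasDerivativeAt f x d → HasDerivativeAt g x e → d ≈ e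
  derivative-unique {f} {g} {x} {d} {e} f≈g f′ g′ =
    x-y≈0⇒x≈y (∣x∣≤0⇒x≈0 (small⇒≤0 λ 0<ε → bound (<⇒≤ 0<ε) (f′ (half-pos 0<ε)) (g′ (half-pos 0<ε))))
    where
    Estimate : (Carrier → Carrier) → Carrier → Carrier → Set (c ⊔ ℓ₂)
    Estimate f d ε = ∃[ δ ] (0# < δ × (∀ h → ∣ h ∣ < δ → ∣ f (x + h) - f x - d * h ∣ ≤ ε * ∣ h ∣))
    bound : ∀ {ε} → 0# ≤ ε → Estimate f d (½ * ε) → Estimate g e (½ * ε) → ∣ d - e ∣ ≤ ε
    bound {ε} 0≤ε (δ , 0<δ , p) (δ′ , 0<δ′ , q) = divide (common-positive 0<δ 0<δ′)
      where
      divide : ∃[ h ] (0# < h × h < δ × h < δ′) → ∣ d - e ∣ ≤ ε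
      divide (h , 0<h , h<δ , h<δ′) = scale (pos-inverse∃ 0<h)
        where
        ∣h∣≤h : ∣ h ∣ ≤ h
        ∣h∣≤h = ∣∣-nonneg (<⇒≤ 0<h)
        difference : (d - e) * h ≈ (g (x + h) - g x - e * h) + - (f (x + h) - f x - d * h)
        difference = trans
          (solve 5 (λ a b d e h → (d :- e) :* h := (a :- b :- e :* h) :- (a :- b :- d :* h)) refl (f (x + h)) (f x) d e h)
          (+-congʳ (+-congʳ (+-cong (f≈g (x + h)) (-‿cong (f≈g x)))))
        ∣difference∣≤ : ∣ (d - e) * h ∣ ≤ ε * h
        ∣difference∣≤ = ∣∣-≈ difference
          (≤-trans (∣∣-+ (q h (≤-<-trans ∣h∣≤h h<δ′)) (∣∣-neg (p h (≤-<-trans ∣h∣≤h h<δ))))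
            (≤-trans (≤-reflexive (trans (sym (distribʳ _ _ _)) (*-congʳ ½+½))) (*-monoˡ-≤ 0≤ε ∣h∣≤h)))
        scale : ∃[ w ] (0# < w × w * h ≈ 1#) → ∣ d - e ∣ ≤ ε
        scale (w , 0<w , wh≈1) = ∣∣-≈ (sym (cancel (d - e))) (≤-trans (∣∣-* ∣difference∣≤ (∣∣-nonneg (<⇒≤ 0<w))) (≤-reflexive (cancel ε)))
          where
          cancel : ∀ x → (x * h) * w ≈ x
          cancel x = trans (solve 3 (λ x h w → (x :* h) :* w := (w :* h) :* x) refl x h w) (trans (*-congʳ wh≈1) (*-identityˡ x))

-- Inverse matrices

module InverseMatrix {c ℓ₁ ℓ₂} (ℝ : RealField c ℓ₁ ℓ₂) where

  open RealField ℝ hiding (zero)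
  open Hermite ℝ
  open RingSum commutativeRing using (sum-cong; sum-distribˡ; sum-δ)
  open import Algebra.Properties.Semiring.Sum semiring using (∑-comm; *-distribʳ-sum)
  open import Relation.Binary.Reasoning.Setoid (CommutativeRing.setoid commutativeRing)
  open MultiIndexProperties using (lookup-0ₘ)
  open BinomialTransform commutativeRing using (eₘ-sym)

  private variable
    n : ℕ

  ᵛ*-cong : ∀ {x y : Vecℝ n} {M N : Matrix n} → (∀ i → x i ≈ y i) → (∀ i j → M i j ≈ N i j) →
    ∀ j → (x ᵛ* M) j ≈ (y ᵛ* N) j
  ᵛ*-cong {n} x≈y M≈N j = sum-cong n (λ i → *-cong (x≈y i) (M≈N i j))

  ᵛ*-assoc : ∀ (x : Vecℝ n) (M N : Matrix n) j → ((x ᵛ* M) ᵛ* N) j ≈ (x ᵛ* (M *ᴹ N)) j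
  ᵛ*-assoc {n} x M N j = begin
    sum (λ k → sum (λ i → x i * M i k) * N k j)     ≈⟨ sum-cong n (λ k → *-distribʳ-sum {n} (N k j) (λ i → x i * M i k)) ⟩
    sum (λ k → sum (λ i → x i * M i k * N k j))     ≈⟨ ∑-comm {n} {n} (λ k i → x i * M i k * N k j) ⟩
    sum (λ i → sum (λ k → x i * M i k * N k j))
      ≈⟨ sum-cong n (λ i → trans (sum-cong n (λ k → *-assoc (x i) (M i k) (N k j))) (sym (sum-distribˡ n (x i)))) ⟩
    sum (λ i → x i * sum (λ k → M i k * N k j))     ∎

  Iᴹ-eₘ : ∀ (i j : Fin n) → Iᴹ i j ≈ lookup (eₘ i) j · 1#
  Iᴹ-eₘ zero    zero    = sym (+-identityʳ 1#)
  Iᴹ-eₘ zero    (suc j) = reflexive (≡.cong (_· 1#) (≡.sym (lookup-0ₘ j)))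
  Iᴹ-eₘ (suc i) zero    = refl
  Iᴹ-eₘ (suc i) (suc j) = Iᴹ-eₘ i j

  Iᴹ-sym : ∀ (i j : Fin n) → Iᴹ i j ≈ Iᴹ j i
  Iᴹ-sym i j = trans (Iᴹ-eₘ i j) (trans (reflexive (≡.cong (_· 1#) (eₘ-sym i j))) (sym (Iᴹ-eₘ j i)))

  ᵛ*-identity : ∀ (x : Vecℝ n) j → (x ᵛ* Iᴹ) j ≈ x j
  ᵛ*-identity {n} x j = trans (sum-cong n (λ i → trans (*-comm _ _) (*-congʳ (Iᴹ-eₘ i j)))) (sum-δ j x)

  Iᴹ-ᵛ* : ∀ (i : Fin n) (M : Matrix n) j → (Iᴹ i ᵛ* M) j ≈ M i j
  Iᴹ-ᵛ* {n} i M j = trans (sum-cong n (λ k → *-congʳ (trans (Iᴹ-sym i k) (Iᴹ-eₘ k i)))) (sum-δ i (λ k → M k j))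

  inverse-sym : ∀ {S M : Matrix n} → IsInverse S M → IsInverse M S
  inverse-sym (SM , MS) = MS , SM

  -- Needed because a Gaussian density brings its own inverse of the covariance matrix. M = M (S N)
  -- = (M S) N = N.
  inverse-unique : ∀ {S M N : Matrix n} → IsInverse S M → IsInverse S N → ∀ i j → M i j ≈ N i j
  inverse-unique {n} {S} {M} {N} (_ , MS) (SN , _) i j = begin
    M i j                       ≈⟨ ᵛ*-identity (M i) j ⟨
    (M i ᵛ* Iᴹ) j               ≈⟨ ᵛ*-cong {x = M i} (λ _ → refl) SN j ⟨
    (M i ᵛ* (S *ᴹ N)) j         ≈⟨ ᵛ*-assoc (M i) S N j ⟨
    ((M i ᵛ* S) ᵛ* N) j         ≈⟨ ᵛ*-cong {N = N} (λ k → MS i k) (λ _ _ → refl) j ⟩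
    (Iᴹ i ᵛ* N) j               ≈⟨ Iᴹ-ᵛ* i N j ⟩
    N i j                       ∎

  -- The transpose of `M` is also an inverse of the symmetric `S`.
  inverse-symmetric : ∀ {S M : Matrix n} → (∀ i j → S i j ≈ S j i) → IsInverse S M → ∀ i j → M i j ≈ M j i
  inverse-symmetric {n} {S} {M} S-sym inv@(SM , MS) = inverse-unique inv (SMᵀ , MᵀS)
    where
    SMᵀ : ∀ i j → (S *ᴹ (λ k l → M l k)) i j ≈ Iᴹ i j
    SMᵀ i j = trans (sum-cong n (λ k → trans (*-comm _ _) (*-congˡ (S-sym i k)))) (trans (MS j i) (Iᴹ-sym j i))
    MᵀS : ∀ i j → ((λ k l → M l k) *ᴹ S) i j ≈ Iᴹ i j
    MᵀS i j = trans (sum-cong n (λ k → trans (*-comm _ _) (*-congʳ (S-sym k j)))) (trans (SM j i) (Iᴹ-sym j i))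

-- Words of coordinates and their exponents

module Word where

  open ≡ using (refl; sym; trans; cong; cong₂; module ≡-Reasoning)

  open PartitionInsertion using (+ₘ-identityˡ; +ₘ-assoc)

  -- Iterated partials are indexed by words, so the induction runs over arbitrary words;
  -- `exponent-word` returns to multi-indices at the end.
  exponent : ∀ {n} → List (Fin n) → MultiIndex n
  exponent = List.foldr (λ r i → eₘ r +ₘ i) 0ₘ

  exponent-++ : ∀ {n} (v w : List (Fin n)) → exponent (v ++ w) ≡ exponent v +ₘ exponent w
  exponent-++ []      w = sym (+ₘ-identityˡ _)
  exponent-++ (r ∷ v) w = trans (cong (eₘ r +ₘ_) (exponent-++ v w)) (sym (+ₘ-assoc (eₘ r) _ _))

  exponent-zeros : ∀ {n} k → exponent (List.replicate k (zero {n})) ≡ k ∷ 0ₘ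
  exponent-zeros zero    = refl
  exponent-zeros (suc k) = trans (cong (eₘ zero +ₘ_) (exponent-zeros k)) (cong (suc k ∷_) (+ₘ-identityˡ 0ₘ))

  exponent-suc : ∀ {n} (w : List (Fin n)) → exponent (List.map suc w) ≡ 0 ∷ exponent w
  exponent-suc []      = refl
  exponent-suc (r ∷ w) = cong (eₘ (suc r) +ₘ_) (exponent-suc w)

  exponent-word : ∀ {c ℓ₁ ℓ₂} (ℝ : RealField c ℓ₁ ℓ₂) {n} (i : MultiIndex n) → exponent (Hermite.word ℝ i) ≡ i
  exponent-word ℝ []      = refl
  exponent-word ℝ (k ∷ i) = begin
    exponent (List.replicate k zero ++ List.concat (List.tabulate (λ r → List.replicate (lookup i r) (suc r))))
      ≡⟨ cong (λ ws → exponent (List.replicate k zero ++ List.concat ws)) (trans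
           (List.tabulate-cong (λ r → sym (List.map-replicate suc (lookup i r) r)))
           (sym (List.map-tabulate (λ r → List.replicate (lookup i r) r) (List.map suc)))) ⟩
    exponent (List.replicate k zero ++ List.concat (List.map (List.map suc) (List.tabulate (λ r → List.replicate (lookup i r) r))))
      ≡⟨ cong (λ w → exponent (List.replicate k zero ++ w)) (List.concat-map (List.tabulate (λ r → List.replicate (lookup i r) r))) ⟩
    exponent (List.replicate k zero ++ List.map suc (Hermite.word ℝ i))
      ≡⟨ exponent-++ (List.replicate k zero) _ ⟩
    exponent (List.replicate k zero) +ₘ exponent (List.map suc (Hermite.word ℝ i))
      ≡⟨ cong₂ _+ₘ_ (exponent-zeros k) (trans (exponent-suc (Hermite.word ℝ i)) (cong (0 ∷_) (exponent-word ℝ i))) ⟩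
    (k ∷ 0ₘ) +ₘ (0 ∷ i)
      ≡⟨ cong₂ _∷_ (ℕ.+-identityʳ k) (+ₘ-identityˡ i) ⟩
    k ∷ i ∎
    where
    open ≡-Reasoning

-- Partial derivatives of the Gaussian density

module GaussianDerivatives {c ℓ₁ ℓ₂} (ℝ : RealField c ℓ₁ ℓ₂) {n : ℕ} where

  open import Data.Vec.Functional.Properties using (updateAt-id-local)
  open RealField ℝ hiding (zero)
  open RealAnalysis ℝ
  open Hermite ℝ
  open Exponential ℝ
  open Calculus ℝ
  open InverseMatrix ℝ
  open Word
  open MultiIndexProperties
  open RingSum commutativeRing using (sum-cong; sum-+; sum-δ)
  open BinomialTransform commutativeRing
  open IntegerRingSolver commutativeRing using (solve; _:=_; _:*_; _:+_; :-_; _:-_; :1)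
  open import Relation.Binary.Reasoning.Setoid (CommutativeRing.setoid commutativeRing)

  line : Vecℝ n → Fin n → Carrier → Vecℝ n
  line x r s = updateAt x r (λ _ → s)

  -- The line through `x` meets `x` only pointwise, which is why values at the base point are
  -- transported by `φ-cong` and `P-cong`.
  line-≡ : ∀ x r p → line x r (x r) p ≡ x p
  line-≡ x r = updateAt-id-local r x ≡.refl

  differentiable-coordinate : ∀ {n} (x : Vecℝ n) r p →
    Differentiable (λ s → updateAt x r (λ _ → s) p) (x r) (lookup (eₘ p) r · 1#)
  differentiable-coordinate {suc n} x zero    zero    = differentiable-cong (λ _ → refl) (sym (+-identityʳ 1#)) differentiable-id
  differentiable-coordinate {suc n} x zero    (suc p) = differentiable-const (x (suc p))
  differentiable-coordinate {suc n} x (suc r) zero    = differentiable-cong (λ _ → refl)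
    (reflexive (≡.cong (_· 1#) (≡.sym (lookup-0ₘ r)))) (differentiable-const (x zero))
  differentiable-coordinate {suc n} x (suc r) (suc p) = differentiable-coordinate (λ q → x (suc q)) r p

  module _ (M : Matrix n) (M-sym : ∀ p q → M p q ≈ M q p) where

    differentiable-ᵛ* : ∀ x r p → Differentiable (λ s → (line x r s ᵛ* M) p) (x r) (M r p)
    differentiable-ᵛ* x r p = differentiable-cong
      (λ s → sum-cong n (λ q → *-comm (M q p) (line x r s q)))
      (trans (sum-cong n (λ q → *-comm (M q p) _)) (sum-δ r (λ q → M q p)))
      (differentiable-sum n (λ q → differentiable-scale (M q p) (differentiable-coordinate x r q)))

    -- Each factor of x M xᵀ contributes (x M)_r, the first one by the symmetry of M.
    differentiable-quadratic : ∀ x r → Differentiable (λ s → quadratic M (line x r s)) (x r) ((x ᵛ* M) r + (x ᵛ* M) r)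
    differentiable-quadratic x r = differentiable-cong (λ _ → refl) value
      (differentiable-sum n (λ p → differentiable-* (differentiable-ᵛ* x r p) (differentiable-coordinate x r p)))
      where
      y = line x r (x r)
      y≈x : ∀ p → y p ≈ x p
      y≈x p = reflexive (line-≡ x r p)
      value : sum (λ p → M r p * y p + (y ᵛ* M) p * (lookup (eₘ p) r · 1#)) ≈ (x ᵛ* M) r + (x ᵛ* M) r
      value = trans (sum-+ n) (+-cong
        (sum-cong n (λ p → trans (*-comm _ _) (*-cong (y≈x p) (M-sym r p))))
        (trans (sum-cong n (λ p → *-comm ((y ᵛ* M) p) _)) (trans (sum-δ r (y ᵛ* M))
          (ᵛ*-cong {M = M} y≈x (λ _ _ → refl) r))))

    quadratic-cong′ : ∀ {x y : Vecℝ n} → (∀ p → x p ≈ y p) → quadratic M x ≈ quadratic M y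
    quadratic-cong′ x≈y = sum-cong n (λ p → *-cong (ᵛ*-cong {M = M} x≈y (λ _ _ → refl) p) (x≈y p))

    module _ {φ : ℝFunction n} {κ : Carrier} (φ≈ : ∀ x → φ x ≈ κ * exp (- (½ * quadratic M x))) where

      φ-cong : ∀ {x y} → (∀ p → x p ≈ y p) → φ x ≈ φ y
      φ-cong {x} {y} x≈y = trans (φ≈ x) (trans
        (*-congˡ (exp-cong (-‿cong (*-congˡ (quadratic-cong′ x≈y))))) (sym (φ≈ y)))

      differentiable-φ : ∀ x r → Differentiable (λ s → φ (line x r s)) (x r) (- ((x ᵛ* M) r * φ x))
      differentiable-φ x r = differentiable-cong (λ s → sym (trans (φ≈ (line x r s)) (*-congˡ (exp-cong (neg-½ _)))))
        (trans (*-congˡ (*-congˡ (exp-cong (sym (neg-½ _)))))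
          (trans (solve 4 (λ k h b e → k :* (:- h :* (b :+ b) :* e) := :- (((h :* b) :+ (h :* b)) :* (k :* e))) refl κ ½ b _)
            (-‿cong (*-cong ½+½ (trans (sym (φ≈ (line x r (x r)))) (φ-cong (λ p → reflexive (line-≡ x r p))))))))
        (differentiable-scale κ (differentiable-exp (differentiable-scale (- ½) (differentiable-quadratic x r))))
        where
        b = (x ᵛ* M) r
        neg-½ : ∀ q → - (½ * q) ≈ - ½ * q
        neg-½ q = solve 2 (λ h q → :- (h :* q) := :- h :* q) refl ½ q

      module _ (φ#0 : ∀ x → φ x # 0#) {P : Vecℝ n → MultiIndex n → Carrier}
        (family : ∀ x → IsHermiteFamily (x ᵛ* M) M (P x)) where

        P-cong : ∀ {x y} → (∀ p → x p ≈ y p) → ∀ i → P x i ≈ P y i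
        P-cong {x} {y} x≈y = hermiteFamily-unique (ᵛ*-cong {M = M} x≈y (λ _ _ → refl)) (λ _ _ → refl) (family x) (family y)

        open HermiteDerivative using (derivative; derivative-0ₘ; derivative-eₘ+)

        -- Only the recurrence at each point is known of `P`, so differentiability is built up along
        -- it by degree. `derivative-eₘ+` recognises the outcome of the product rule.
        differentiable-P : ∀ x r i → Differentiable (λ s → P (line x r s) i) (x r) (derivative (family x) r i)
        differentiable-P x p = degree-induction (λ i → Differentiable (λ s → P (line x p s) i) (x p) (derivative (family x) p i))
          (differentiable-cong (λ s → sym (IsHermiteFamily.base (family (line x p s)))) (sym (derivative-0ₘ (family x) p)) (differentiable-const 1#))
          λ r i IH IH′ → differentiable-cong
            (λ s → sym (trans (IsHermiteFamily.step (family (line x p s)) r i) (+-congˡ (neg-1* _))))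
            (trans (trans (+-congʳ (+-cong (*-congˡ (P-cong y≈x i)) (*-congʳ (ᵛ*-cong {M = M} y≈x (λ _ _ → refl) r))))
                (trans (+-congˡ (sym (neg-1* _))) (+-assoc _ _ _)))
              (sym (derivative-eₘ+ (family x) p r i)))
            (differentiable-+ (differentiable-* (differentiable-ᵛ* x p r) IH)
              (differentiable-scale (- 1#) (differentiable-sum n (λ s → differentiable-scale (M r s) (lowered i IH′ s)))))
          where
          y≈x : ∀ q → line x p (x p) q ≈ x q
          y≈x q = reflexive (line-≡ x p q)
          neg-1* : ∀ y → - y ≈ - 1# * y
          neg-1* y = solve 1 (λ y → :- y := :- :1 :* y) refl y
          lowered : ∀ i → (∀ s u → i ≡ eₘ s +ₘ u → Differentiable (λ t → P (line x p t) u) (x p) (derivative (family x) p u)) →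
            ∀ s → Differentiable (λ t → (lookup i s · 1#) * P (line x p t) (decrement s i)) (x p)
                    ((lookup i s · 1#) * derivative (family x) p (decrement s i))
          lowered i IH′ s with zero⊎eₘ+ s i
          ... | inj₁ is≡0 = differentiable-cong (λ t → sym (vanish _)) (sym (vanish _)) (differentiable-const 0#)
            where
            vanish : ∀ y → (lookup i s · 1#) * y ≈ 0#
            vanish y = trans (*-congʳ (reflexive (≡.cong (_· 1#) is≡0))) (zeroˡ y)
          ... | inj₂ (u , ≡.refl) rewrite decrement-eₘ+ s u = differentiable-scale _ (IH′ s u ≡.refl)

        -- D⁽ⁱ⁾φ in closed form.
        signed : MultiIndex n → ℝFunction n
        signed i x = (- 1#) ^ degree i * (P x i * φ x)

        -- The derivative of P_i φ is (∂_r P_i - b_r P_i) φ. Since ∂_r P_i is exactly the sum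
        -- subtracted in the recurrence, this equals - P_{e_r + i} φ, and the sign joins the power
        -- of -1.
        isPartialDerivative-signed : ∀ r i → IsPartialDerivative r (signed i) (signed (eₘ r +ₘ i))
        isPartialDerivative-signed r i x = differentiable⇒hasDerivativeAt (differentiable-cong (λ _ → refl) value
          (differentiable-scale ((- 1#) ^ degree i) (differentiable-* (differentiable-P x r i) (differentiable-φ x r))))
          where
          y≈x : ∀ q → line x r (x r) q ≈ x q
          y≈x q = reflexive (line-≡ x r q)
          D = derivative (family x) r i
          b = (x ᵛ* M) r
          value : (- 1#) ^ degree i * (D * φ (line x r (x r)) + P (line x r (x r)) i * - (b * φ x)) ≈ signed (eₘ r +ₘ i) x
          value = begin
            (- 1#) ^ degree i * (D * φ (line x r (x r)) + P (line x r (x r)) i * - (b * φ x))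
              ≈⟨ *-congˡ (+-cong (*-congˡ (φ-cong y≈x)) (*-congʳ (P-cong y≈x i))) ⟩
            (- 1#) ^ degree i * (D * φ x + P x i * - (b * φ x))
              ≈⟨ solve 5 (λ σ d f p b → σ :* (d :* f :+ p :* :- (b :* f)) := (:- :1 :* σ) :* ((b :* p :- d) :* f)) refl ((- 1#) ^ degree i) D (φ x) (P x i) b ⟩
            (- 1# * (- 1#) ^ degree i) * ((b * P x i - D) * φ x)
              ≈⟨ *-congˡ (*-congʳ (IsHermiteFamily.step (family x) r i)) ⟨
            (- 1#) ^ suc (degree i) * (P x (eₘ r +ₘ i) * φ x)
              ≡⟨ ≡.cong (λ d → (- 1#) ^ d * (P x (eₘ r +ₘ i) * φ x)) (degree-eₘ+ r i) ⟨
            signed (eₘ r +ₘ i) x ∎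

        degree-0ₘ : ∀ m → degree (0ₘ {m}) ≡ 0
        degree-0ₘ zero    = ≡.refl
        degree-0ₘ (suc m) = degree-0ₘ m

        signed-0ₘ : ∀ x → φ x ≈ signed 0ₘ x
        signed-0ₘ x = sym (trans (*-cong (reflexive (≡.cong ((- 1#) ^_) (degree-0ₘ n))) (*-congʳ (IsHermiteFamily.base (family x))))
          (trans (*-identityˡ _) (*-identityˡ _)))

        isIteratedPartial-signed : ∀ w → IsIteratedPartial w φ (signed (exponent w))
        isIteratedPartial-signed []      = [] signed-0ₘ
        isIteratedPartial-signed (r ∷ w) = isPartialDerivative-signed r (exponent w) ∷ isIteratedPartial-signed w

        -- Each differentiation sees functions already known to agree everywhere, in particular
        -- along the coordinate line.
        iteratedPartial-unique : ∀ w {g} → IsIteratedPartial w φ g → ∀ x → g x ≈ signed (exponent w) x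
        iteratedPartial-unique []      ([] φ≈g)  x = trans (sym (φ≈g x)) (signed-0ₘ x)
        iteratedPartial-unique (r ∷ w) (∂ ∷ ∂s) x = derivative-unique
          (λ s → iteratedPartial-unique w ∂s (line x r s)) (∂ x) (isPartialDerivative-signed r (exponent w) x)

        sign² : ∀ d y → (- 1#) ^ d * ((- 1#) ^ d * y) ≈ y
        sign² zero    y = trans (*-identityˡ _) (*-identityˡ _)
        sign² (suc d) y = trans (solve 2 (λ σ y → (:- :1 :* σ) :* ((:- :1 :* σ) :* y) := σ :* (σ :* y)) refl ((- 1#) ^ d) y) (sign² d y)

        isHermite : ∀ i → IsHermite φ i (λ x → P x i)
        isHermite i = signed i ,
          ≡.subst (λ j → IsMixedPartial i φ (signed j)) (exponent-word ℝ i) (isIteratedPartial-signed (word i)) ,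
          λ x → φ#0 x , sym (sign² (degree i) _)

        hermite-unique : ∀ i {H} → IsHermite φ i H → ∀ x → H x ≈ P x i
        hermite-unique i {H} (Dφ , ∂s , quotient) x = cancel (inverse (φ#0 x)) (trans (proj₂ (quotient x))
          (trans (*-congˡ (trans (iteratedPartial-unique (word i) ∂s x) (reflexive (≡.cong (λ j → signed j x) (exponent-word ℝ i)))))
            (sign² (degree i) _)))
          where
          cancel : ∀ {y z f} → ∃ (λ w → w * f ≈ 1#) → y * f ≈ z * f → y ≈ z
          cancel {y} {z} {f} (w , wf≈1) yf≈zf = trans (sym (unit y)) (trans (*-congʳ yf≈zf) (unit z))
            where
            unit : ∀ y → y * f * w ≈ y
            unit y = trans (solve 3 (λ y f w → y :* f :* w := (w :* f) :* y) refl y f w) (trans (*-congʳ wf≈1) (*-identityˡ y))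

-- Real and complex scalars treated together

record RealAlgebra {c ℓ₁ ℓ₂} (ℝ : RealField c ℓ₁ ℓ₂) (K : CommutativeRing c ℓ₁) (ι : RealField.Carrier ℝ → CommutativeRing.Carrier K) :
    Set (c ⊔ ℓ₁) where
  private
    module ℝ = RealField ℝ
    module K = CommutativeRing K
  field
    ι-cong    : ∀ {x y} → x ℝ.≈ y → ι x K.≈ ι y
    ι-+       : ∀ x y → ι (x ℝ.+ y) K.≈ ι x K.+ ι y
    ι-*       : ∀ x y → ι (x ℝ.* y) K.≈ ι x K.* ι y
    ι-neg     : ∀ x → ι (ℝ.- x) K.≈ K.- ι x
    ι-0       : ι ℝ.0# K.≈ K.0#
    ι-1       : ι ℝ.1# K.≈ K.1#
    -- A left inverse of `ι` that is additive and linear over the reals; on complex numbers it is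
    -- not multiplicative.
    re        : K.Carrier → ℝ.Carrier
    re-cong   : ∀ {z w} → z K.≈ w → re z ℝ.≈ re w
    re-+      : ∀ z w → re (z K.+ w) ℝ.≈ re z ℝ.+ re w
    re-scale  : ∀ x z → re (ι x K.* z) ℝ.≈ x ℝ.* re z
    re-ι      : ∀ x → re (ι x) ℝ.≈ x

module _ {c ℓ₁ ℓ₂ a} (ℝ : RealField c ℓ₁ ℓ₂) {A : Set a} where

  open RealField ℝ hiding (zero)
  open CommutativeRing commutativeRing using (ring)
  open import Algebra.Properties.Ring ring using (-0#≈0#)

  scalars-realAlgebra : ∀ F (U : UmbralCalculus (scalars ℝ F) A) → RealAlgebra ℝ (scalars ℝ F) (Umbral.ι ℝ F U)
  scalars-realAlgebra real U = record
    { ι-cong = λ p → p ; ι-+ = λ _ _ → refl ; ι-* = λ _ _ → refl ; ι-neg = λ _ → refl ; ι-0 = refl ; ι-1 = refl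
    ; re = λ x → x ; re-cong = λ p → p ; re-+ = λ _ _ → refl ; re-scale = λ _ _ → refl ; re-ι = λ _ → refl }
  scalars-realAlgebra complex U = record
    { ι-cong = λ p → p , refl
    ; ι-+ = λ _ _ → refl , sym (+-identityˡ 0#)
    ; ι-* = λ x y → sym (drop-0 (x * y) (zeroˡ 0#)) , sym (trans (+-cong (zeroʳ x) (zeroˡ y)) (+-identityˡ 0#))
    ; ι-neg = λ _ → refl , sym -0#≈0#
    ; ι-0 = refl , refl
    ; ι-1 = refl , refl
    ; re = proj₁
    ; re-cong = proj₁
    ; re-+ = λ _ _ → refl
    ; re-scale = λ x z → drop-0 (x * proj₁ z) (zeroˡ (proj₂ z))
    ; re-ι = λ _ → refl }
    where
    drop-0 : ∀ x {y} → y ≈ 0# → x - y ≈ x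
    drop-0 x y≈0 = trans (+-congˡ (trans (-‿cong y≈0) -0#≈0#)) (+-identityʳ x)

module RealPart {c ℓ₁ ℓ₂} (ℝ : RealField c ℓ₁ ℓ₂) (K : CommutativeRing c ℓ₁) {ι : RealField.Carrier ℝ → CommutativeRing.Carrier K}
  (algebra : RealAlgebra ℝ K ι) where

  open RealAlgebra algebra
  private
    module ℝ where
      open RealField ℝ public
      open RingSum commutativeRing public using (sum-cong)
      open BinomialTransform commutativeRing public
      open IntegerRingSolver commutativeRing public using (solve; _:=_; _:*_; :-_; :1)
    module K where
      open CommutativeRing K public
      open RingSum K public using (sum; sum-cong; _·_)
      open BinomialTransform K public
      open IntegerRingSolver K public using (solve; _:=_; _:*_; :-_; :1)

  ι-· : ∀ n → ι (n ℝ.· ℝ.1#) K.≈ n K.· K.1#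
  ι-· zero    = ι-0
  ι-· (suc n) = K.trans (ι-+ ℝ.1# _) (K.+-cong ι-1 (ι-· n))

  ι-sum : ∀ n {f : Fin n → ℝ.Carrier} → ι (ℝ.sum f) K.≈ K.sum (λ r → ι (f r))
  ι-sum zero    = ι-0
  ι-sum (suc n) = K.trans (ι-+ _ _) (K.+-congˡ (ι-sum n))

  re-0 : re K.0# ℝ.≈ ℝ.0#
  re-0 = ℝ.trans (re-cong (K.sym ι-0)) (re-ι ℝ.0#)

  re-neg : ∀ z → re (K.- z) ℝ.≈ ℝ.- re z
  re-neg z = ℝ.trans (re-cong (K.trans (K.solve 1 (λ z → K.:- z K.:= K.:- K.:1 K.:* z) K.refl z)
      (K.*-congʳ (K.sym (K.trans (ι-neg ℝ.1#) (K.-‿cong ι-1))))))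
    (ℝ.trans (re-scale (ℝ.- ℝ.1#) z) (ℝ.solve 1 (λ z → ℝ.:- ℝ.:1 ℝ.:* z ℝ.:= ℝ.:- z) ℝ.refl (re z)))

  re-sum : ∀ n {f : Fin n → K.Carrier} → re (K.sum f) ℝ.≈ ℝ.sum (λ r → re (f r))
  re-sum zero    = re-0
  re-sum (suc n) = ℝ.trans (re-+ _ _) (ℝ.+-congˡ (re-sum n))

  module _ {n} {b : Fin n → ℝ.Carrier} {M : Fin n → Fin n → ℝ.Carrier} where

    re-isHermiteFamily : ∀ {P} → K.IsHermiteFamily (λ r → ι (b r)) (λ r s → ι (M r s)) P → ℝ.IsHermiteFamily b M (λ i → re (P i))
    re-isHermiteFamily {P} F = record
      { base = ℝ.trans (re-cong (K.trans base (K.sym ι-1))) (re-ι ℝ.1#)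
      ; step = λ r i → ℝ.trans (re-cong (step r i)) (ℝ.trans (re-+ _ _) (ℝ.+-cong (re-scale (b r) (P i))
          (ℝ.trans (re-neg _) (ℝ.-‿cong (ℝ.trans (re-sum n) (ℝ.sum-cong n (λ s → ℝ.trans (re-scale (M r s) _)
            (ℝ.*-congˡ (ℝ.trans (re-cong (K.*-congʳ (K.sym (ι-· (lookup i s))))) (re-scale _ _)))))))))) }
      where open K.IsHermiteFamily F

    ι-isHermiteFamily : ∀ {P} → ℝ.IsHermiteFamily b M P → K.IsHermiteFamily (λ r → ι (b r)) (λ r s → ι (M r s)) (λ i → ι (P i))
    ι-isHermiteFamily {P} F = record
      { base = K.trans (ι-cong base) ι-1
      ; step = λ r i → K.trans (ι-cong (step r i)) (K.trans (ι-+ _ _) (K.+-cong (ι-* (b r) (P i))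
          (K.trans (ι-neg _) (K.-‿cong (K.trans (ι-sum n) (K.sum-cong n (λ s → K.trans (ι-* (M r s) _)
            (K.*-congˡ (K.trans (ι-* _ _) (K.*-congʳ (ι-· (lookup i s)))))))))))) }
      where open ℝ.IsHermiteFamily F

    -- The real part of `P`, embedded again, obeys the recurrence that determines `P`.
    ι-re : ∀ {P} → K.IsHermiteFamily (λ r → ι (b r)) (λ r s → ι (M r s)) P → ∀ i → ι (re (P i)) K.≈ P i
    ι-re F = K.hermiteFamily-unique (λ _ → K.refl) (λ _ _ → K.refl) (ι-isHermiteFamily (re-isHermiteFamily F)) F

-- The umbral evaluation as a Hermite family

module UmbralHermite {c ℓ₁ ℓ₂ a} (ℝ : RealField c ℓ₁ ℓ₂) (F : ScalarField) {A : Set a} (U : UmbralCalculus (scalars ℝ F) A) where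

  private
    K = scalars ℝ F
    module ℝ where
      open RealField ℝ public
      open IntegerRingSolver commutativeRing public using (solve; _:=_; _:*_; _:-_; :0)
  open RealAnalysis ℝ using (1/_; fromℕ; ½; ½+½; 1/n*n≈1; exp)
  open Exponential ℝ using (exp-cong; exp-inverse)
  open Hermite ℝ
  open Umbral ℝ F U
  open CommutativeRing K hiding (zero)
  open RingSum K using (Σ-map; sum)
  open BinomialTransform K
  open MultiIndexProperties using (decrement)
  open InverseMatrix ℝ

  algebra : RealAlgebra ℝ K ι
  algebra = scalars-realAlgebra ℝ F U
  open RealAlgebra algebra
  open RealPart ℝ K algebra

  -- Spelled as in the definition of the auxiliary umbra, so that `partitionMoment (moment ν)`
  -- unfolds to `[-1·β· moment ν ]`.
  ratios : Ratios K
  ratios = record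
    { ratio   = λ m d → ι (fromℕ m ℝ.* 1/ d)
    ; ratio-* = λ m d → trans (*-congˡ (sym (ι-· d))) (trans (sym (ι-* _ _)) (trans
        (ι-cong (ℝ.trans (ℝ.*-assoc _ _ _) (ℝ.trans (ℝ.*-congˡ (1/n*n≈1 d)) (ℝ.*-identityʳ _)))) (ι-· m))) }

  open Moments K ratios using (partitionMoment-0ₘ; gaussianMoment-recurrence)

  ι½+ι½ : ι ½ + ι ½ ≈ 1#
  ι½+ι½ = trans (sym (ι-+ ½ ½)) (trans (ι-cong (ℝ.trans (ℝ.+-cong (ℝ.sym (ℝ.*-identityʳ ½)) (ℝ.sym (ℝ.*-identityʳ ½))) ½+½)) ι-1)

  module _ {n} {M : Matrix n} (M-sym : ∀ p q → M p q ℝ.≈ M q p) (ν : Vector Poly n)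
    (f-ν : ∀ i → generatingFunction ν i ≈ (1+½t M tᵀ) i) where

    umbral-isHermiteFamily : ∀ b → IsHermiteFamily (λ r → ι (b r)) (λ r s → ι (M r s)) (E[-1·β· ν + b ]^_)
    umbral-isHermiteFamily b = record
      { base = trans (E≈binomial 0ₘ) base
      ; step = λ r i → trans (E≈binomial (eₘ r +ₘ i)) (trans (step r i) (+-cong (*-congˡ (sym (E≈binomial i)))
          (-‿cong (RingSum.sum-cong K n (λ s → *-congˡ (*-congˡ (sym (E≈binomial (decrement s i))))))))) }
      where
      E≈binomial : ∀ i → E[-1·β· ν + b ]^ i ≈ binomial i (λ r → ι (b r)) [-1·β· moment ν ]
      E≈binomial i = trans (reflexive (Σ-map _ (box i))) (sym (binomial≈Σ i (λ r → ι (b r)) [-1·β· moment ν ]))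
      quadraticMoments : ∀ v → v ≢ 0ₘ → moment ν v * ι (fromℕ 1 ℝ.* (1/ (v !ₘ)) ⦃ !ₘ≢0 v ⦄)
        ≈ ι ½ * sum (λ p → sum (λ q → ι (M p q) * t^ (eₘ p +ₘ eₘ q) v))
      quadraticMoments v v≢0 = trans (*-congˡ (ι-cong (ℝ.trans (ℝ.*-congʳ (ℝ.+-identityʳ ℝ.1#)) (ℝ.*-identityˡ _)))) from-f
        where
        from-f : moment ν v * ι ((1/ (v !ₘ)) ⦃ !ₘ≢0 v ⦄) ≈ ι ½ * sum (λ p → sum (λ q → ι (M p q) * t^ (eₘ p +ₘ eₘ q) v))
        -- For `v ≢ 0ₘ` the abstraction reduces both conditionals at once: the generating function
        -- becomes g_v / v! and the constant term `t^ 0ₘ` vanishes.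
        from-f with v ≟ₘ 0ₘ | f-ν v
        ... | yes v≡0 | _ = contradiction v≡0 v≢0
        ... | no  _   | p = trans p (+-identityˡ _)
      open IsHermiteFamily (binomial-isHermiteFamily (λ r → ι (b r)) (λ r s → ι (M r s)) [-1·β· moment ν ]
        (partitionMoment-0ₘ (moment ν))
        (gaussianMoment-recurrence (moment ν) (ι ½) ι½+ι½ (λ r s → ι (M r s)) (λ p q → ι-cong (M-sym p q)) quadraticMoments))

    -- Follows from uniqueness, without opening the binomial expansion. It is what replaces x Σ⁻¹ Σ
    -- by x in the dual case.
    umbral-cong : ∀ {b b′ : Vecℝ n} → (∀ r → b r ℝ.≈ b′ r) → ∀ i → E[-1·β· ν + b ]^ i ≈ E[-1·β· ν + b′ ]^ i
    umbral-cong {b} {b′} b≈b′ = hermiteFamily-unique (λ r → ι-cong (b≈b′ r)) (λ _ _ → refl) (umbral-isHermiteFamily b) (umbral-isHermiteFamily b′)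

    module _ {S : Matrix n} (S⁻¹≈M : IsInverse S M) {φ} (gaussian : IsGaussianDensity (λ _ → ℝ.0#) S φ) where

      private
        open IsGaussianDensity gaussian
        open RealAnalysis ℝ using (inverse; pos⇒#0; inverse-#0)
        κ = proj₁ (inverse (pos⇒#0 0<root))

        -½q : Vecℝ n → ℝ.Carrier
        -½q x = ℝ.- (½ ℝ.* quadratic M x)

        φ*root : ∀ x → φ x ℝ.* root ℝ.≈ exp (-½q x)
        φ*root x = ℝ.trans (proj₂ (density x)) (exp-cong (ℝ.-‿cong (ℝ.*-congˡ (RingSum.sum-cong ℝ.commutativeRing n (λ p →
          ℝ.*-cong (ᵛ*-cong {M = S⁻¹} (λ q → x-0≈x (x q)) (inverse-unique isInverse S⁻¹≈M) p) (x-0≈x (x p)))))))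
          where
          x-0≈x : ∀ x → x ℝ.- ℝ.0# ℝ.≈ x
          x-0≈x x = ℝ.solve 1 (λ x → x ℝ.:- ℝ.:0 ℝ.:= x) ℝ.refl x

        φ≈ : ∀ x → φ x ℝ.≈ κ ℝ.* exp (-½q x)
        φ≈ x = ℝ.sym (ℝ.trans (ℝ.*-congˡ (ℝ.sym (φ*root x))) (ℝ.trans
          (ℝ.solve 3 (λ k f r → k ℝ.:* (f ℝ.:* r) ℝ.:= (k ℝ.:* r) ℝ.:* f) ℝ.refl κ (φ x) root)
          (ℝ.trans (ℝ.*-congʳ (proj₂ (inverse (pos⇒#0 0<root)))) (ℝ.*-identityˡ _))))

        -- Apartness is shown by exhibiting the inverse root · exp (½ x M xᵀ).
        φ#0 : ∀ x → φ x ℝ.# ℝ.0#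
        φ#0 x = inverse-#0 {x = root ℝ.* exp (ℝ.- -½q x)} (ℝ.trans (ℝ.sym (ℝ.*-assoc _ _ _))
          (ℝ.trans (ℝ.*-congʳ (φ*root x)) (exp-inverse (-½q x))))

        open GaussianDerivatives ℝ {n}

        family : ∀ x → BinomialTransform.IsHermiteFamily ℝ.commutativeRing (x ᵛ* M) M (λ i → re (E[-1·β· ν + x ᵛ* M ]^ i))
        family x = re-isHermiteFamily (umbral-isHermiteFamily (x ᵛ* M))

      umbral-isHermite : ∀ i → ∃ λ H → IsHermite φ i H
      umbral-isHermite i = _ , isHermite M M-sym φ≈ φ#0 family i

      hermite≈umbral : ∀ i H → IsHermite φ i H → ∀ x → ι (H x) ≈ E[-1·β· ν + x ᵛ* M ]^ i
      hermite≈umbral i H isH x = trans (ι-cong (hermite-unique M M-sym φ≈ φ#0 family i isH x))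
        (ι-re (umbral-isHermiteFamily (x ᵛ* M)) i)

proposition4p2 : ∀ {c ℓ₁ ℓ₂ a} (ℝ : RealField c ℓ₁ ℓ₂) (F : ScalarField)
    {A : Set a} (U : UmbralCalculus (scalars ℝ F) A) →
    let open RealField ℝ using (0#)
        open Hermite ℝ
        open Umbral ℝ F U
        open CommutativeRing (scalars ℝ F) using (_≈_)
    in
    ∀ {n} (Σ Σ⁻¹ : Matrix n) →
    IsCovarianceMatrix Σ → HasFullRank Σ → IsInverse Σ Σ⁻¹ →
    (ν : Vector Poly n) → (∀ r → IsMonomial (ν r)) →
    (∀ i → generatingFunction ν i ≈ (1+½t Σ⁻¹ tᵀ) i) →
    (μ : Vector Poly n) → (∀ r → IsMonomial (μ r)) →
    (∀ i → generatingFunction μ i ≈ (1+½t Σ tᵀ) i) →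
    (φ : ℝFunction n) → IsGaussianDensity (λ _ → 0#) Σ φ →
    (φ̃ : ℝFunction n) → IsGaussianDensity (λ _ → 0#) Σ⁻¹ φ̃ →
    ∀ (i : MultiIndex n) →
      ((∃ λ H → IsHermite φ i H) ×
       (∀ H → IsHermite φ i H → ∀ x → ι (H x) ≈ E[-1·β· ν + x ᵛ* Σ⁻¹ ]^ i))
      ×
      ((∃ λ H̃ → IsDualHermite φ̃ Σ⁻¹ i H̃) ×
       (∀ H̃ → IsDualHermite φ̃ Σ⁻¹ i H̃ → ∀ x → ι (H̃ x) ≈ E[-1·β· μ + x ]^ i))
proposition4p2 ℝ F U {n} Σ Σ⁻¹ covariance _ inverse ν _ f-ν μ _ f-μ φ gaussian φ̃ gaussian~ i =
    (umbral-isHermite Σ⁻¹-sym ν f-ν inverse gaussian i , hermite≈umbral Σ⁻¹-sym ν f-ν inverse gaussian i)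
  -- The dual case is the first one with the roles of Σ and Σ⁻¹ exchanged, evaluated at x Σ⁻¹; the
  -- shift is then (x Σ⁻¹) Σ, which is x.
  , ( (_ , H̃ .proj₁ , H̃ .proj₂ , λ _ → RealField.refl ℝ)
    , λ H̃ (H , isH , H̃≈) x → trans (ι-cong (H̃≈ x)) (trans
        (hermite≈umbral symmetric μ f-μ (inverse-sym inverse) gaussian~ i H isH (x ᵛ* Σ⁻¹))
        (umbral-cong symmetric μ f-μ (xΣ⁻¹Σ≈x x) i)))
  where
  open CommutativeRing (scalars ℝ F) using (trans)
  open Hermite ℝ
  open InverseMatrix ℝ
  open UmbralHermite ℝ F U
  open RealAlgebra algebra using (ι-cong)
  open IsCovarianceMatrix covariance using (symmetric)
  Σ⁻¹-sym = inverse-symmetric symmetric inverse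
  H̃ = umbral-isHermite symmetric μ f-μ (inverse-sym inverse) gaussian~ i
  xΣ⁻¹Σ≈x : ∀ x j → RealField._≈_ ℝ (((x ᵛ* Σ⁻¹) ᵛ* Σ) j) (x j)
  xΣ⁻¹Σ≈x x j = RealField.trans ℝ (ᵛ*-assoc x Σ⁻¹ Σ j) (RealField.trans ℝ
    (ᵛ*-cong {x = x} (λ _ → RealField.refl ℝ) (proj₂ inverse) j) (ᵛ*-identity x j))
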